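{- Let $n = p_1^{\alpha_1}\cdots p_r^{\alpha_r}$ be the prime factorisation of a positive integer $n$ (distinct primes, $\alpha_i>0$), and let $e_1 \mid e_2 \mid \dots \mid e_n$ be the elementary divisors of $A_n$; put $e_0 = 1$. Then: (1) the $n$-tuple $\left(e_1, \frac{e_2}{e_1}, \dots, \frac{e_n}{e_{n-1}}\right)$ is a permutation of the $n$-tuple consisting of $p_1$ repeated $\alpha_1$ times, $p_2$ repeated $\alpha_2$ times, $\dots$, $p_r$ repeated $\alpha_r$ times, and $1$ repeated $n - \sum_i \alpha_i$ times; (2) for $1\le j\le n$ and $1 \le i \le r$, the ratio $e_j/e_{j-1}$ equals $p_i$ if and only if $j = n - \frac{n}{p_i^t} + 1$ for some integer $t$ with $1 \le t \le \alpha_i$.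
   Context: For a positive integer $k$, let $\Phi_d$ denote the $d$th cyclotomic polynomial and let $\Psi_k : \mathbf{Z}[X]/(X^k-1) \to \bigoplus_{d \mid k} \mathbf{Z}[X]/(\Phi_d(X))$ be the natural map $f \bmod (X^k-1) \mapsto \bigoplus_{d\mid k} f \bmod \Phi_d(X)$, with bases $(1,\overline{X},\dots,\overline{X}^{k-1})$ on the domain, $(1,\overline{X},\dots,\overline{X}^{\phi(d)-1})$ on each summand, summands ordered by increasing $d$; $A_k$ is the matrix of $\Psi_k$ in these bases. Elementary divisors are those of the Smith normal form over $\mathbf{Z}$, taken non-negative. -}

module Defs where

open import Data.Bool.Base using (if_then_else_)
open import Data.Empty using (⊥-elim)
open import Data.Fin.Base using (Fin; toℕ; cast; inject₁)
open import Data.Fin.Properties using (toℕ<n)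
open import Data.Integer.Base as ℤ using (ℤ; +_; 0ℤ; 1ℤ)
import Data.Integer.Properties as ℤ
open import Data.List.Base as List
  using (List; []; _∷_; _++_; length; map; concat; concatMap; filter; foldr; replicate; upTo; allFin)
open import Data.List.Membership.Propositional using (_∈_)
open import Data.List.Membership.Propositional.Properties
  using (∈-map⁺; ∈-map⁻; ∈-upTo⁺; ∈-upTo⁻; ∈-filter⁺; ∈-filter⁻; ∈-concat⁺′; ∈-concat⁻′)
open import Data.List.Membership.Propositional.Properties.WithK using (unique∧set⇒bag)
open import Data.List.Properties using (length-map; length-upTo; length-++)
open import Data.List.Relation.Binary.BagAndSetEquality using (∼bag⇒↭)
open import Data.List.Relation.Binary.Permutation.Propositional.Properties using (↭-length)
open import Data.List.Relation.Unary.All as All using (all?)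
import Data.List.Relation.Unary.All.Properties as All
import Data.List.Relation.Unary.AllPairs as AllPairs
import Data.List.Relation.Unary.AllPairs.Properties as AllPairs
open import Data.List.Relation.Unary.Unique.Propositional using (Unique)
import Data.List.Relation.Unary.Unique.Propositional.Properties as Unique
open import Data.Nat.Base as ℕ
  using (ℕ; zero; suc; _+_; _*_; _^_; _≤_; NonZero; ≢-nonZero; ≢-nonZero⁻¹)
open import Data.Nat.DivMod using (_/_)
open import Data.Nat.Coprimality using (Coprime; coprime?; coprime⇒gcd≡1; gcd≡1⇒coprime)
open import Data.Nat.Divisibility
  using (_∣_; _∣?_; divides; quotient; ∣⇒≤; m∣m*n)
open import Data.Nat.GCD
  using (gcd; gcd[m,n]∣m; gcd[m,n]∣n; gcd[m,n]≡0⇒n≡0; c*gcd[m,n]≡gcd[cm,cn])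
open import Data.Nat.Induction using (<-rec)
open import Data.Nat.Primality using (Prime; prime⇒nonZero)
import Data.Nat.Properties as ℕ
open import Data.Product.Base using (∃; _×_; _,_; proj₁; proj₂)
import Data.Vec.Functional as Vector
open import Function.Base using (_∘_)
open import Function.Bundles using (mk⇔)
open import Relation.Binary.PropositionalEquality
  using (_≡_; _≢_; refl; sym; trans; cong; cong₂; subst; module ≡-Reasoning)
open import Relation.Nullary.Decidable using (does)

open import Algebra.Properties.Semiring.Sum ℤ.+-*-semiring
  using () renaming (sum to ∑ℤ)

-- Coefficient lists, constant term first; trailing zeros are allowed, so
-- the equality of ℤ[X] is _≈_ rather than _≡_.

Poly : Set
Poly = List ℤ

coeff : Poly → ℕ → ℤ
coeff []      _       = 0ℤ
coeff (a ∷ f) zero    = a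
coeff (a ∷ f) (suc k) = coeff f k

infix 4 _≈_
_≈_ : Poly → Poly → Set
f ≈ g = ∀ k → coeff f k ≡ coeff g k

infixl 6 _⊞_ _⊟_
infixl 7 _⊠_ _·_

_⊞_ : Poly → Poly → Poly
[]      ⊞ g       = g
(a ∷ f) ⊞ []      = a ∷ f
(a ∷ f) ⊞ (b ∷ g) = (a ℤ.+ b) ∷ (f ⊞ g)

_·_ : ℤ → Poly → Poly
c · f = map (c ℤ.*_) f

_⊟_ : Poly → Poly → Poly
f ⊟ g = f ⊞ (ℤ.- 1ℤ) · g

_⊠_ : Poly → Poly → Poly
[]      ⊠ g = []
(a ∷ f) ⊠ g = a · g ⊞ (0ℤ ∷ (f ⊠ g))

∏ : List Poly → Poly
∏ = foldr _⊠_ (1ℤ ∷ [])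

X^ : ℕ → Poly
X^ k = replicate k 0ℤ ++ (1ℤ ∷ [])

deg : Poly → ℕ
deg []      = 0
deg (a ∷ f) = if does (all? (ℤ._≟ 0ℤ) f) then 0 else suc (deg f)

-- Division with remainder by g; only meaningful for monic g.  If
-- f = q g + r then a + X f = (c + X q) g + (a + X r - c g), where c is the
-- coefficient of X^(deg g) in a + X r.

quotRem : Poly → Poly → Poly × Poly
quotRem g []      = [] , []
quotRem g (a ∷ f) =
  let q , r = quotRem g f
      c     = coeff (a ∷ r) (deg g)
  in (c ∷ q) , ((a ∷ r) ⊟ c · g)

infixl 7 _÷_
_÷_ : Poly → Poly → Poly
f ÷ g = proj₁ (quotRem g f)

infix 4 _≈_mod_
_≈_mod_ : Poly → Poly → Poly → Set
f ≈ g mod m = ∃ λ q → f ≈ g ⊞ q ⊠ m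

-- Φ n = (X^n - 1) / ∏_{d ∣ n, d < n} Φ d, i.e. the unique solution of
-- ∏_{d ∣ n} Φ d = X^n - 1 for n ≥ 1.  (0 divides no positive n, so the index
-- 0 of Fin n never contributes.)

Φ : ℕ → Poly
Φ = <-rec (λ _ → Poly) λ n Φ< →
  (X^ n ⊟ X^ 0) ÷ ∏ (map (λ d → Φ< (toℕ<n d)) (filter (λ d → toℕ d ∣? n) (allFin n)))

range : ℕ → List ℕ
range n = map suc (upTo n)

-- In increasing order.
divisors : ℕ → List ℕ
divisors n = filter (_∣? n) (range n)

totatives : ℕ → List ℕ
totatives n = filter (λ i → coprime? i n) (range n)

φ : ℕ → ℕ
φ n = length (totatives n)

-- Representatives of elements of ⨁_{d ∣ k} ℤ[X]/(Φ_d): a polynomial for each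
-- d, of which only the components at the divisors d of k count.

⨁ : Set
⨁ = ℕ → Poly

⨁-Eq : ℕ → ⨁ → ⨁ → Set
⨁-Eq k F G = ∀ d → d ∣ k → F d ≈ G d mod Φ d

-- On representatives, f mod (X^k - 1) ↦ (f mod Φ_d)_d is f ↦ (f)_d.
Ψ : Poly → ⨁
Ψ f d = f

inSummand : ℕ → Poly → ⨁
inSummand d f d′ = if does (d′ ℕ.≟ d) then f else []

codomainBasis : ℕ → List ⨁
codomainBasis k =
  concat (map (λ d → map (inSummand d ∘ X^) (upTo (φ d))) (divisors k))

-- This basis has k elements, by Σ_{d ∣ k} φ(d) = k.  The latter is proved by
-- matching 1 ≤ i ≤ k with the reduced fraction (k / g , i / g), g = gcd i k.

private
  ∈-range⁺ : ∀ {n i} → i ≢ 0 → i ≤ n → i ∈ range n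
  ∈-range⁺ {i = zero}  i≢0 _   = ⊥-elim (i≢0 refl)
  ∈-range⁺ {i = suc i} _   i≤n = ∈-map⁺ suc (∈-upTo⁺ i≤n)

  ∈-range⁻ : ∀ {n i} → i ∈ range n → i ≢ 0 × i ≤ n
  ∈-range⁻ i∈ with _ , j∈ , refl ← ∈-map⁻ suc i∈ = (λ ()) , ∈-upTo⁻ j∈

  range-unique : ∀ n → Unique (range n)
  range-unique n = Unique.map⁺ ℕ.suc-injective (Unique.upTo⁺ n)

  fractionsOver : ℕ → List (ℕ × ℕ)
  fractionsOver d = map (d ,_) (totatives d)

  fractions : ℕ → List (ℕ × ℕ)
  fractions n = concat (map fractionsOver (divisors n))

  fractions-unique : ∀ n → Unique (fractions n)
  fractions-unique n = Unique.concat⁺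
    (All.map⁺ (All.tabulate λ {d} _ →
      Unique.map⁺ (cong proj₂) (Unique.filter⁺ (λ i → coprime? i d) (range-unique d))))
    (AllPairs.map⁺ (AllPairs.map disjoint (Unique.filter⁺ (_∣? n) (range-unique n))))
    where
    disjoint : ∀ {d e} → d ≢ e → ∀ {x} → x ∈ fractionsOver d × x ∈ fractionsOver e → _
    disjoint d≢e (x∈ , y∈)
      with _ , _ , refl ← ∈-map⁻ _ x∈ | _ , _ , eq ← ∈-map⁻ _ y∈ = d≢e (cong proj₁ eq)

  module _ (n : ℕ) .{{_ : NonZero n}} where

    g : ℕ → ℕ
    g i = gcd i n

    den num : ℕ → ℕ
    den i = quotient (gcd[m,n]∣n i n)
    num i = quotient (gcd[m,n]∣m i n)

    n≡den*g : ∀ i → n ≡ den i * g i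
    n≡den*g i = _∣_.equality (gcd[m,n]∣n i n)

    i≡num*g : ∀ i → i ≡ num i * g i
    i≡num*g i = _∣_.equality (gcd[m,n]∣m i n)

    n≢0 : n ≢ 0
    n≢0 = ≢-nonZero⁻¹ n

    g-nonZero : ∀ i → NonZero (g i)
    g-nonZero i = ≢-nonZero (n≢0 ∘ gcd[m,n]≡0⇒n≡0 i)

    den≢0 : ∀ i → den i ≢ 0
    den≢0 i eq = n≢0 (trans (n≡den*g i) (cong (_* g i) eq))

    reduce : ℕ → ℕ × ℕ
    reduce i = den i , num i

    -- (a , b) is the reduced form of i / n as soon as b / a is reduced
    reduce-spec : ∀ {i a b} c → n ≡ a * c → i ≡ b * c → Coprime b a → (a , b) ≡ reduce i
    reduce-spec {i} {a} {b} c n≡ i≡ b⊥a = cong₂ _,_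
      (ℕ.*-cancelʳ-≡ a (den i) (g i) {{g-nonZero i}}
        (trans (cong (a *_) g≡c) (trans (sym n≡) (n≡den*g i))))
      (ℕ.*-cancelʳ-≡ b (num i) (g i) {{g-nonZero i}}
        (trans (cong (b *_) g≡c) (trans (sym i≡) (i≡num*g i))))
      where
      open ≡-Reasoning
      g≡c : g i ≡ c
      g≡c = begin
        gcd i n             ≡⟨ cong₂ gcd (trans i≡ (ℕ.*-comm b c)) (trans n≡ (ℕ.*-comm a c)) ⟩
        gcd (c * b) (c * a) ≡⟨ c*gcd[m,n]≡gcd[cm,cn] c b a ⟨
        c * gcd b a         ≡⟨ cong (c *_) (coprime⇒gcd≡1 b⊥a) ⟩
        c * 1               ≡⟨ ℕ.*-identityʳ c ⟩
        c                   ∎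

    reduce-coprime : ∀ i → Coprime (num i) (den i)
    reduce-coprime i = gcd≡1⇒coprime
      (ℕ.*-cancelˡ-≡ _ _ (g i) {{g-nonZero i}} (begin
        g i * gcd (num i) (den i)         ≡⟨ c*gcd[m,n]≡gcd[cm,cn] (g i) (num i) (den i) ⟩
        gcd (g i * num i) (g i * den i)   ≡⟨ cong₂ gcd (ℕ.*-comm (g i) (num i)) (ℕ.*-comm (g i) (den i)) ⟩
        gcd (num i * g i) (den i * g i)   ≡⟨ cong₂ gcd (i≡num*g i) (n≡den*g i) ⟨
        gcd i n                           ≡⟨ ℕ.*-identityʳ (g i) ⟨
        g i * 1                           ∎))
      where open ≡-Reasoning

    reduce-injective : ∀ {i j} → reduce i ≡ reduce j → i ≡ j
    reduce-injective {i} {j} eq =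
      trans (i≡num*g i) (trans (cong₂ _*_ (cong proj₂ eq) g≡) (sym (i≡num*g j)))
      where
      g≡ : g i ≡ g j
      g≡ = ℕ.*-cancelˡ-≡ (g i) (g j) (den i) {{≢-nonZero (den≢0 i)}}
        (trans (sym (n≡den*g i)) (trans (n≡den*g j) (cong (_* g j) (sym (cong proj₁ eq)))))

    reduce∈ : ∀ {i} → i ∈ range n → reduce i ∈ fractions n
    reduce∈ {i} i∈ = ∈-concat⁺′
      (∈-map⁺ (den i ,_) (∈-filter⁺ (λ j → coprime? j (den i)) (∈-range⁺ num≢0 num≤den) (reduce-coprime i)))
      (∈-map⁺ fractionsOver (∈-filter⁺ (_∣? n) (∈-range⁺ (den≢0 i) (∣⇒≤ den∣n)) den∣n))
      where
      den∣n : den i ∣ n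
      den∣n = subst (den i ∣_) (sym (n≡den*g i)) (m∣m*n (g i))
      num≢0 : num i ≢ 0
      num≢0 eq = proj₁ (∈-range⁻ i∈) (trans (i≡num*g i) (cong (_* g i) eq))
      num≤den : num i ≤ den i
      num≤den = ℕ.*-cancelʳ-≤ (num i) (den i) (g i) {{g-nonZero i}}
        (ℕ.≤-trans (ℕ.≤-reflexive (sym (i≡num*g i)))
          (ℕ.≤-trans (proj₂ (∈-range⁻ i∈)) (ℕ.≤-reflexive (n≡den*g i))))

    fraction∈ : ∀ {x} → x ∈ fractions n → x ∈ map reduce (range n)
    fraction∈ x∈
      with _ , x∈d , d∈ ← ∈-concat⁻′ (map fractionsOver (divisors n)) x∈
      with d , d∈D , refl ← ∈-map⁻ fractionsOver d∈
      with i , i∈T , refl ← ∈-map⁻ (d ,_) x∈d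
      with _ , divides c n≡c*d ← ∈-filter⁻ (_∣? n) {xs = range n} d∈D
      with i∈ , i⊥d ← ∈-filter⁻ (λ j → coprime? j d) {xs = range d} i∈T
      = subst (_∈ map reduce (range n)) (sym (reduce-spec c n≡d*c refl i⊥d))
          (∈-map⁺ reduce (∈-range⁺ i*c≢0 i*c≤n))
      where
      n≡d*c : n ≡ d * c
      n≡d*c = trans n≡c*d (ℕ.*-comm c d)
      c≢0 : c ≢ 0
      c≢0 eq = n≢0 (trans n≡c*d (cong (_* d) eq))
      i*c≢0 : i * c ≢ 0
      i*c≢0 = ≢-nonZero⁻¹ _ {{ℕ.m*n≢0 i c {{≢-nonZero (proj₁ (∈-range⁻ i∈))}} {{≢-nonZero c≢0}}}}
      i*c≤n : i * c ≤ n
      i*c≤n = ℕ.≤-trans (ℕ.*-monoˡ-≤ c (proj₂ (∈-range⁻ i∈))) (ℕ.≤-reflexive (sym n≡d*c))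

    length-fractions : length (fractions n) ≡ n
    length-fractions = begin
      length (fractions n)            ≡⟨ ↭-length (∼bag⇒↭ (unique∧set⇒bag (fractions-unique n)
                                           (Unique.map⁺ reduce-injective (range-unique n))
                                           (mk⇔ fraction∈ back))) ⟩
      length (map reduce (range n))   ≡⟨ length-map reduce (range n) ⟩
      length (range n)                ≡⟨ length-map suc (upTo n) ⟩
      length (upTo n)                 ≡⟨ length-upTo n ⟩
      n                               ∎
      where
      open ≡-Reasoning
      back : ∀ {x} → x ∈ map reduce (range n) → x ∈ fractions n
      back x∈ with _ , i∈ , refl ← ∈-map⁻ reduce x∈ = reduce∈ i∈

  length-concat-map : ∀ {A B C : Set} (F : A → List B) (G : A → List C) →
                      (∀ x → length (F x) ≡ length (G x)) →
                      ∀ xs → length (concat (map F xs)) ≡ length (concat (map G xs))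
  length-concat-map F G eq []       = refl
  length-concat-map F G eq (x ∷ xs) =
    trans (length-++ (F x)) (trans (cong₂ _+_ (eq x) (length-concat-map F G eq xs))
      (sym (length-++ (G x))))

length-codomainBasis : ∀ k → length (codomainBasis k) ≡ k
length-codomainBasis zero      = refl
length-codomainBasis k@(suc _) = trans
  (length-concat-map _ fractionsOver
    (λ d → trans (trans (length-map _ (upTo (φ d))) (length-upTo (φ d)))
                 (sym (length-map (d ,_) (totatives d))))
    (divisors k))
  (length-fractions k)

basis : ∀ k → Fin k → ⨁
basis k i = List.lookup (codomainBasis k) (cast (sym (length-codomainBasis k)) i)

Matrix : ℕ → ℕ → Set
Matrix m n = Fin m → Fin n → ℤ

infix 4 _≋_
_≋_ : ∀ {m n} → Matrix m n → Matrix m n → Set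
A ≋ B = ∀ i j → A i j ≡ B i j

infixl 7 _⊗_
_⊗_ : ∀ {l m n} → Matrix l m → Matrix m n → Matrix l n
(A ⊗ B) i j = ∑ℤ λ k → A i k ℤ.* B k j

diag : ∀ {n} → (Fin n → ℤ) → Matrix n n
diag a i j = if does (toℕ i ℕ.≟ toℕ j) then a i else 0ℤ

Unimodular : ∀ {n} → Matrix n n → Set
Unimodular U = ∃ λ V → U ⊗ V ≋ diag (λ _ → 1ℤ) × V ⊗ U ≋ diag (λ _ → 1ℤ)

record ElementaryDivisors {n} (A : Matrix n n) (e : Fin n → ℕ) : Set where
  field
    left right       : Matrix n n
    left-unimodular  : Unimodular left
    right-unimodular : Unimodular right
    smith            : left ⊗ A ⊗ right ≋ diag (λ i → + e i)
    chain            : ∀ i j → toℕ i ≤ toℕ j → e i ∣ e j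

∑⨁ : ∀ {k} → (Fin k → ⨁) → ⨁
∑⨁ v d = Vector.foldr (λ F f → F d ⊞ f) [] v

-- Column j holds the coordinates of Ψ(X^j) in the basis of the codomain.
IsMatrixOfΨ : ∀ k → Matrix k k → Set
IsMatrixOfΨ k A =
  ∀ (j : Fin k) → ⨁-Eq k (Ψ (X^ (toℕ j))) (∑⨁ λ i d → A i j · basis k i d)

-- Prefixes e_0 = 1, so that the entry at k is e_k, whereas e itself is
-- indexed from 0 (e i is e_{i+1}).
withe₀ : ∀ {n} → (Fin n → ℕ) → Fin (suc n) → ℕ
withe₀ e = 1 Vector.∷ e

ratio : ∀ {n} (e : Fin n → ℕ) → (∀ k → NonZero (withe₀ e k)) → Fin n → ℕ
ratio e nz j = _/_ (e j) (withe₀ e (inject₁ j)) {{nz (inject₁ j)}}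

infixl 7 _/_^_[_]
_/_^_[_] : ∀ (n p t : ℕ) → Prime p → ℕ
n / p ^ t [ p-prime ] = _/_ n (p ^ t) {{ℕ.m^n≢0 p t {{prime⇒nonZero p-prime}}}}

{-# OPTIONS --safe #-}
module Submission where

-- The valuations of the elementary divisors are read off modulo p, one power
-- p^t at a time.  In Smith coordinates, the number of e_j divisible by p^t is
-- the dimension of the space of reductions modulo p of polynomials f of
-- degree < n with f ∈ (p^t) + (Φ_d) for every d ∣ n.
--
-- If n = p^t N, this space contains the N-dimensional space of multiples of
-- (X^n - 1)/(X^N - 1), which is 0 modulo Φ_d when d ∤ N, and p^t when d ∣ N.
--
-- It contains nothing else.  Let n = m p^α with p ∤ m, G_0 = X^m - 1 and
-- G_s = (X^(m p^s) - 1)/(X^(m p^(s-1)) - 1).  For fixed s, the Φ_d dividing G_s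
-- are comaximal modulo p^t, so f ∈ (p^t) + (G_s) for all s ≤ α.  Write
-- f = p^t k + G_α r.  As G_α ≡ p modulo G_s for s < α, and p is a non-zero-divisor
-- modulo the monic G_s, it follows that r ∈ (p^(t-1)) + (G_s) for s < α.
-- Iterating, f is modulo p a multiple of G_α ⋯ G_(α-t+1) = (X^n - 1)/(X^N - 1),
-- and f ≡ 0 modulo p if t = α + 1.
--
-- So p^t ∣ e_j exactly for p^t ∣ n and j > n - n/p^t, and since these thresholds
-- are distinct for distinct prime powers, e_j/e_(j-1) is a prime or 1.

-- In Smith coordinates x = `right` y, the condition p^t ∣ A x reads p^t ∣ e_j y_j for all j: y_j is
-- free if p^t ∣ e_j and is forced to be divisible by p otherwise. This is the source of the
-- dimension count. The count is made by pigeonhole on residues: a linear map into fewer coordinates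
-- kills a vector that is nonzero modulo p. The obstacle is that Φ_a and Φ_b are not comaximal
-- modulo p when b/a is a power of p, so the divisors of n cannot be treated all at once. They are
-- grouped by their p-part. Within a group the scalars in u Φ_a + v Φ_b = c are 1 or a quotient of
-- two indices, hence prime to p, and the product over a group is G_s. Different groups interact
-- only through G_α ≡ p. These scalars come from the Bézout relation between X^a - 1 and X^b - 1;
-- neither irreducibility nor complex roots enter. The same Chinese remainder argument, with π = 0
-- and nonzero scalars, first shows that the division defining Φ_n is exact.

open import Defs
open import Algebra.Bundles using (CommutativeRing)
open import Data.Bool.Base using (if_then_else_)
open import Data.Empty using (⊥-elim)
open import Data.Fin.Base as Fin using (Fin; zero; suc; toℕ; fromℕ<; inject₁; finToFun; funToFin)
import Data.Fin.Properties as Fin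
open import Data.Integer.Base using (ℤ; +_; 0ℤ; 1ℤ)
open import Data.Integer.Base using () renaming (_+_ to _+ᶻ_; _*_ to _*ᶻ_; -_ to -ᶻ_; _-_ to _-ᶻ_)
import Data.Integer.Base as ℤ
open import Data.Integer.DivMod using (_%ℕ_; _/ℕ_; n%ℕd<d; a≡a%ℕn+[a/ℕn]*n)
open import Data.Integer.Divisibility.Signed
  using (divides; ∣m∣n⇒∣m+n; ∣m+n∣m⇒∣n; ∣m+n∣n⇒∣m; ∣n⇒∣m*n; ∣m⇒∣m*n; ∣⇒∣ᵤ; ∣ᵤ⇒∣) renaming (_∣_ to _∣ᶻ_; 0∣⇒≡0 to 0∣ᶻ⇒≡0)
import Data.Integer.Properties as ℤ
import Data.Integer.Tactic.RingSolver as ℤSolver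
open import Data.List.Base
  using (List; []; _∷_; _++_; tabulate; concat; replicate; map; filter; allFin; upTo; length; lookup)
open import Data.List.Membership.Propositional using (_∈_)
open import Data.List.Membership.Propositional.Properties
  using (∈-map⁺; ∈-map⁻; ∈-upTo⁺; ∈-upTo⁻; ∈-filter⁺; ∈-filter⁻; ∈-allFin; ∈-∃++; ∈-++⁺ʳ; ∈-++⁻;
         ∈-tabulate⁺; ∈-tabulate⁻; ∈-concat⁺′; ∈-concat⁻′; ∈-lookup)
open import Data.List.Membership.Propositional.Properties.WithK using (unique∧set⇒bag)
open import Data.List.Properties
  using (length-map; length-upTo; length-++; length-tabulate; map-++; map-cong; map-∘; map-tabulate; concat-map; tabulate-cong)
open import Data.List.Relation.Binary.BagAndSetEquality using (∼bag⇒↭)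
open import Data.List.Relation.Binary.Permutation.Propositional as Perm
  using (_↭_; ↭-sym; ↭-trans; ↭-reflexive; ↭⇒↭ₛ; prep)
import Data.List.Relation.Binary.Permutation.Propositional.Properties as Perm
import Data.List.Relation.Binary.Permutation.Setoid.Properties as PermS
open import Data.List.Relation.Unary.All as All using (All; []; _∷_; all?)
import Data.List.Relation.Unary.All.Properties as All
open import Data.List.Relation.Unary.AllPairs as AllPairs using (AllPairs; []; _∷_)
import Data.List.Relation.Unary.AllPairs.Properties as AllPairs
open import Data.List.Relation.Unary.Any as Any using (here; there)
open import Data.List.Relation.Unary.Unique.Propositional using (Unique)
import Data.List.Relation.Unary.Unique.Propositional.Properties as Unique
open import Data.Maybe.Base as Maybe using (Maybe; just; nothing)
open import Data.Nat.Base as ℕ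
  using (ℕ; zero; suc; _+_; _∸_; _^_; _≤_; _<_; z≤n; s≤s; NonZero; >-nonZero; ≢-nonZero; ≢-nonZero⁻¹; nonTrivial⇒n>1)
open import Data.Nat.Coprimality using (Coprime; coprime-Bézout; coprime-divisor)
open import Data.Nat.Divisibility
  using (_∣_; _∣?_; _∣0; 1∣_; divides; ∣⇒≤; ∣-trans; ∣-refl; ∣-antisym; ∣1⇒≡1; 0∣⇒≡0; m∣m*n; n∣m*n;
         *-cancelˡ-∣; *-monoʳ-∣; *-pres-∣)
open import Data.Nat.DivMod using (m*n/n≡m; m/n*n≡m)
open import Data.Nat.GCD using (gcd; gcd-GCD; gcd[m,n]∣m; gcd[m,n]∣n; module Bézout)
open import Data.Nat.Induction using (<-wellFounded; <-rec)
open import Data.Nat.ListAction using (sum; product)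
open import Data.Nat.ListAction.Properties using (sum-↭)
open import Data.Nat.Primality
  using (Prime; prime[2]; ¬prime[0]; ¬prime[1]; prime⇒nonZero; prime⇒nonTrivial; prime⇒irreducible; euclidsLemma)
open import Data.Nat.Primality.Factorisation using (factorise; PrimeFactorisation)
import Data.Nat.Properties as ℕ
open import Data.Product.Base using (Σ; ∃; ∃₂; _×_; _,_; proj₁; proj₂)
open import Data.Sum.Base using (_⊎_; inj₁; inj₂)
import Data.Vec.Functional as Vector
open import Function.Base using (_∘_)
open import Function.Bundles using (_⇔_; mk⇔)
open import Function.Definitions using (Injective)
open import Induction.WellFounded using (module FixPoint)
open import Relation.Binary.Definitions using (tri<; tri≈; tri>)
open import Relation.Binary.PropositionalEquality
  using (_≡_; _≢_; refl; sym; trans; cong; cong₂; subst; subst₂; setoid; module ≡-Reasoning)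
import Relation.Binary.Reasoning.Setoid as SetoidReasoning
open import Relation.Nullary using (¬_; Dec; yes; no)
open import Relation.Nullary.Decidable using (does; dec-true; dec-false)
open import Tactic.RingSolver using (solve-∀)
open import Tactic.RingSolver.Core.AlmostCommutativeRing using (AlmostCommutativeRing; fromCommutativeRing)

open import Algebra.Properties.Semiring.Sum ℤ.+-*-semiring
  using (sum-cong-≗; *-distribˡ-sum; *-distribʳ-sum; ∑-comm; ∑-distrib-+) renaming (sum to ∑ℤ)

-- The ring ℤ[X]

-- _≈_ unfolds to a function type, from which Agda cannot recover the two
-- polynomials; the wrapper makes them inferable.
infix 4 _≃_
record _≃_ (f g : Poly) : Set where
  constructor mk
  field coeff-≡ : f ≈ g
open _≃_ public

≃-refl : ∀ {f} → f ≃ f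
≃-refl = mk λ k → refl

≃-sym : ∀ {f g} → f ≃ g → g ≃ f
≃-sym (mk p) = mk λ k → sym (p k)

≃-trans : ∀ {f g h} → f ≃ g → g ≃ h → f ≃ h
≃-trans (mk p) (mk q) = mk λ k → trans (p k) (q k)

coeff-⊞ : ∀ f g k → coeff (f ⊞ g) k ≡ coeff f k +ᶻ coeff g k
coeff-⊞ []      g       k       = sym (ℤ.+-identityˡ _)
coeff-⊞ (a ∷ f) []      k       = sym (ℤ.+-identityʳ _)
coeff-⊞ (a ∷ f) (b ∷ g) zero    = refl
coeff-⊞ (a ∷ f) (b ∷ g) (suc k) = coeff-⊞ f g k

coeff-· : ∀ c f k → coeff (c · f) k ≡ c *ᶻ coeff f k
coeff-· c []      k       = sym (ℤ.*-zeroʳ c)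
coeff-· c (a ∷ f) zero    = refl
coeff-· c (a ∷ f) (suc k) = coeff-· c f k

⊞-cong : ∀ {f f′ g g′} → f ≃ f′ → g ≃ g′ → f ⊞ g ≃ f′ ⊞ g′
⊞-cong {f} {f′} {g} {g′} (mk p) (mk q) =
  mk λ k → trans (coeff-⊞ f g k) (trans (cong₂ _+ᶻ_ (p k) (q k)) (sym (coeff-⊞ f′ g′ k)))

·-cong : ∀ c {f g} → f ≃ g → c · f ≃ c · g
·-cong c {f} {g} (mk p) =
  mk λ k → trans (coeff-· c f k) (trans (cong (c *ᶻ_) (p k)) (sym (coeff-· c g k)))

∷-cong : ∀ {a b f g} → a ≡ b → f ≃ g → (a ∷ f) ≃ (b ∷ g)
∷-cong a≡b (mk p) = mk λ { zero → a≡b ; (suc k) → p k }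

⊞-comm : ∀ f g → f ⊞ g ≃ g ⊞ f
⊞-comm f g = mk λ k →
  trans (coeff-⊞ f g k) (trans (ℤ.+-comm (coeff f k) _) (sym (coeff-⊞ g f k)))

⊞-assoc : ∀ f g h → (f ⊞ g) ⊞ h ≃ f ⊞ (g ⊞ h)
⊞-assoc f g h = mk λ k → begin
  coeff ((f ⊞ g) ⊞ h) k                     ≡⟨ coeff-⊞ (f ⊞ g) h k ⟩
  coeff (f ⊞ g) k +ᶻ coeff h k             ≡⟨ cong (_+ᶻ coeff h k) (coeff-⊞ f g k) ⟩
  coeff f k +ᶻ coeff g k +ᶻ coeff h k     ≡⟨ ℤ.+-assoc (coeff f k) _ _ ⟩
  coeff f k +ᶻ (coeff g k +ᶻ coeff h k)   ≡⟨ cong (coeff f k +ᶻ_) (coeff-⊞ g h k) ⟨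
  coeff f k +ᶻ coeff (g ⊞ h) k             ≡⟨ coeff-⊞ f (g ⊞ h) k ⟨
  coeff (f ⊞ (g ⊞ h)) k                     ∎
  where open ≡-Reasoning

⊞-identityʳ : ∀ f → f ⊞ [] ≃ f
⊞-identityʳ f = mk λ k → trans (coeff-⊞ f [] k) (ℤ.+-identityʳ _)

⊞-inverseʳ : ∀ f → f ⊞ (-ᶻ 1ℤ) · f ≃ []
⊞-inverseʳ f = mk λ k → begin
  coeff (f ⊞ (-ᶻ 1ℤ) · f) k                  ≡⟨ coeff-⊞ f _ k ⟩
  coeff f k +ᶻ coeff ((-ᶻ 1ℤ) · f) k        ≡⟨ cong (coeff f k +ᶻ_) (coeff-· (-ᶻ 1ℤ) f k) ⟩
  coeff f k +ᶻ (-ᶻ 1ℤ) *ᶻ coeff f k        ≡⟨ cong (coeff f k +ᶻ_) (ℤ.-1*i≡-i (coeff f k)) ⟩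
  coeff f k +ᶻ -ᶻ coeff f k                 ≡⟨ ℤ.+-inverseʳ (coeff f k) ⟩
  0ℤ                                          ∎
  where open ≡-Reasoning

⊞-interchange : ∀ f g h k → (f ⊞ g) ⊞ (h ⊞ k) ≃ (f ⊞ h) ⊞ (g ⊞ k)
⊞-interchange f g h k = mk λ i → begin
  coeff ((f ⊞ g) ⊞ (h ⊞ k)) i  ≡⟨ expand f g h k i ⟩
  (coeff f i +ᶻ coeff g i) +ᶻ (coeff h i +ᶻ coeff k i)
    ≡⟨ shuffle (coeff f i) (coeff g i) (coeff h i) (coeff k i) ⟩
  (coeff f i +ᶻ coeff h i) +ᶻ (coeff g i +ᶻ coeff k i)  ≡⟨ expand f h g k i ⟨
  coeff ((f ⊞ h) ⊞ (g ⊞ k)) i  ∎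
  where
  open ≡-Reasoning
  expand : ∀ f g h k i → coeff ((f ⊞ g) ⊞ (h ⊞ k)) i ≡
           (coeff f i +ᶻ coeff g i) +ᶻ (coeff h i +ᶻ coeff k i)
  expand f g h k i = trans (coeff-⊞ (f ⊞ g) _ i) (cong₂ _+ᶻ_ (coeff-⊞ f g i) (coeff-⊞ h k i))
  shuffle : ∀ a b c d → (a +ᶻ b) +ᶻ (c +ᶻ d) ≡ (a +ᶻ c) +ᶻ (b +ᶻ d)
  shuffle = ℤSolver.solve-∀

·-distribˡ-⊞ : ∀ c f g → c · (f ⊞ g) ≃ c · f ⊞ c · g
·-distribˡ-⊞ c f g = mk λ k → begin
  coeff (c · (f ⊞ g)) k                     ≡⟨ coeff-· c (f ⊞ g) k ⟩
  c *ᶻ coeff (f ⊞ g) k                     ≡⟨ cong (c *ᶻ_) (coeff-⊞ f g k) ⟩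
  c *ᶻ (coeff f k +ᶻ coeff g k)           ≡⟨ ℤ.*-distribˡ-+ c (coeff f k) _ ⟩
  c *ᶻ coeff f k +ᶻ c *ᶻ coeff g k       ≡⟨ cong₂ _+ᶻ_ (coeff-· c f k) (coeff-· c g k) ⟨
  coeff (c · f) k +ᶻ coeff (c · g) k       ≡⟨ coeff-⊞ (c · f) (c · g) k ⟨
  coeff (c · f ⊞ c · g) k                   ∎
  where open ≡-Reasoning

·-assoc : ∀ a b f → a · (b · f) ≃ (a *ᶻ b) · f
·-assoc a b f = mk λ k → begin
  coeff (a · (b · f)) k        ≡⟨ coeff-· a (b · f) k ⟩
  a *ᶻ coeff (b · f) k        ≡⟨ cong (a *ᶻ_) (coeff-· b f k) ⟩
  a *ᶻ (b *ᶻ coeff f k)      ≡⟨ ℤ.*-assoc a b _ ⟨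
  a *ᶻ b *ᶻ coeff f k        ≡⟨ coeff-· (a *ᶻ b) f k ⟨
  coeff ((a *ᶻ b) · f) k      ∎
  where open ≡-Reasoning

0·f≃[] : ∀ f → 0ℤ · f ≃ []
0·f≃[] f = mk λ k → coeff-· 0ℤ f k

1·f≃f : ∀ f → 1ℤ · f ≃ f
1·f≃f f = mk λ k → trans (coeff-· 1ℤ f k) (ℤ.*-identityˡ _)

0∷[]≃[] : (0ℤ ∷ []) ≃ []
0∷[]≃[] = mk λ { zero → refl ; (suc k) → refl }

⊠-congʳ : ∀ f {g g′} → g ≃ g′ → f ⊠ g ≃ f ⊠ g′
⊠-congʳ []      g≃ = ≃-refl {[]}
⊠-congʳ (a ∷ f) g≃ = ⊞-cong (·-cong a g≃) (∷-cong refl (⊠-congʳ f g≃))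

⊠-zeroʳ : ∀ f → f ⊠ [] ≃ []
⊠-zeroʳ []      = ≃-refl
⊠-zeroʳ (a ∷ f) = ≃-trans (∷-cong refl (⊠-zeroʳ f)) 0∷[]≃[]

⊠-∷ʳ : ∀ f b g → f ⊠ (b ∷ g) ≃ b · f ⊞ (0ℤ ∷ (f ⊠ g))
⊠-∷ʳ []      b g = ≃-sym 0∷[]≃[]
⊠-∷ʳ (a ∷ f) b g = ∷-cong (cong (_+ᶻ 0ℤ) (ℤ.*-comm a b)) (≃-trans
  (⊞-cong (≃-refl {a · g}) (⊠-∷ʳ f b g)) (≃-trans
  (≃-sym (⊞-assoc (a · g) (b · f) _)) (≃-trans
  (⊞-cong (⊞-comm (a · g) (b · f)) ≃-refl)
  (⊞-assoc (b · f) (a · g) _))))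

⊠-comm : ∀ f g → f ⊠ g ≃ g ⊠ f
⊠-comm []      g = ≃-sym (⊠-zeroʳ g)
⊠-comm (a ∷ f) g =
  ≃-trans (⊞-cong (≃-refl {a · g}) (∷-cong refl (⊠-comm f g))) (≃-sym (⊠-∷ʳ g a f))

⊠-cong : ∀ {f f′ g g′} → f ≃ f′ → g ≃ g′ → f ⊠ g ≃ f′ ⊠ g′
⊠-cong {f} {f′} {g} {g′} f≃ g≃ = ≃-trans (⊠-congʳ f g≃)
  (≃-trans (⊠-comm f g′) (≃-trans (⊠-congʳ g′ f≃) (⊠-comm g′ f′)))

⊠-distribˡ-⊞ : ∀ f g h → f ⊠ (g ⊞ h) ≃ f ⊠ g ⊞ f ⊠ h
⊠-distribˡ-⊞ []      g h = ≃-refl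
⊠-distribˡ-⊞ (a ∷ f) g h = ≃-trans
  (⊞-cong (·-distribˡ-⊞ a g h) (∷-cong refl (⊠-distribˡ-⊞ f g h)))
  (⊞-interchange (a · g) (a · h) (0ℤ ∷ (f ⊠ g)) (0ℤ ∷ (f ⊠ h)))

⊠-distribʳ-⊞ : ∀ f g h → (g ⊞ h) ⊠ f ≃ g ⊠ f ⊞ h ⊠ f
⊠-distribʳ-⊞ f g h = ≃-trans (⊠-comm (g ⊞ h) f) (≃-trans (⊠-distribˡ-⊞ f g h)
  (⊞-cong (⊠-comm f g) (⊠-comm f h)))

·-⊠ : ∀ c f g → (c · f) ⊠ g ≃ c · (f ⊠ g)
·-⊠ c []      g = ≃-refl
·-⊠ c (a ∷ f) g = ≃-trans
  (⊞-cong (≃-sym (·-assoc c a g)) (∷-cong (sym (ℤ.*-zeroʳ c)) (·-⊠ c f g)))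
  (≃-sym (·-distribˡ-⊞ c (a · g) (0ℤ ∷ (f ⊠ g))))

0∷-⊠ : ∀ f g → (0ℤ ∷ f) ⊠ g ≃ (0ℤ ∷ (f ⊠ g))
0∷-⊠ f g = ⊞-cong (0·f≃[] g) ≃-refl

⊠-assoc : ∀ f g h → (f ⊠ g) ⊠ h ≃ f ⊠ (g ⊠ h)
⊠-assoc []      g h = ≃-refl
⊠-assoc (a ∷ f) g h = ≃-trans (⊠-distribʳ-⊞ h (a · g) (0ℤ ∷ (f ⊠ g)))
  (⊞-cong (·-⊠ a g h) (≃-trans (0∷-⊠ (f ⊠ g) h) (∷-cong refl (⊠-assoc f g h))))

⊠-identityˡ : ∀ f → (1ℤ ∷ []) ⊠ f ≃ f
⊠-identityˡ f = ≃-trans (⊞-cong (1·f≃f f) 0∷[]≃[]) (⊞-identityʳ f)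

ℤ[X] : CommutativeRing _ _
ℤ[X] = record
  { Carrier = Poly
  ; _≈_ = _≃_
  ; _+_ = _⊞_
  ; _*_ = _⊠_
  ; -_ = (-ᶻ 1ℤ) ·_
  ; 0# = []
  ; 1# = 1ℤ ∷ []
  ; isCommutativeRing = record
    { isRing = record
      { +-isAbelianGroup = record
        { isGroup = record
          { isMonoid = record
            { isSemigroup = record
              { isMagma = record
                { isEquivalence = record { refl = ≃-refl ; sym = ≃-sym ; trans = ≃-trans }
                ; ∙-cong = ⊞-cong }
              ; assoc = ⊞-assoc }
            ; identity = (λ f → ≃-refl) , ⊞-identityʳ }
          ; inverse = (λ f → ≃-trans (⊞-comm _ f) (⊞-inverseʳ f)) , ⊞-inverseʳ
          ; ⁻¹-cong = ·-cong (-ᶻ 1ℤ) }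
        ; comm = ⊞-comm }
      ; *-cong = ⊠-cong
      ; *-assoc = ⊠-assoc
      ; *-identity = ⊠-identityˡ , (λ f → ≃-trans (⊠-comm f _) (⊠-identityˡ f))
      ; distrib = ⊠-distribˡ-⊞ , ⊠-distribʳ-⊞ }
    ; *-comm = ⊠-comm } }

-- Lets the ring solver drop vanishing coefficients: 1 - 1 computes to `0ℤ ∷ []`, not to `[]`.
0≃? : ∀ f → Maybe ([] ≃ f)
0≃? []         = just ≃-refl
0≃? (+ 0 ∷ f)  = Maybe.map (λ eq → ≃-trans (≃-sym 0∷[]≃[]) (∷-cong refl eq)) (0≃? f)
0≃? (_ ∷ f)    = nothing

ℤ[X]-acr : AlmostCommutativeRing _ _
ℤ[X]-acr = fromCommutativeRing ℤ[X] 0≃?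

module ≃-Reasoning = SetoidReasoning (CommutativeRing.setoid ℤ[X])

-- Monic polynomials

0ᶻ∣ : ∀ c → c ∣ᶻ 0ℤ
0ᶻ∣ c = divides 0ℤ refl

∣ᶻ-resp : ∀ {c x y} → x ≡ y → c ∣ᶻ x → c ∣ᶻ y
∣ᶻ-resp refl d = d

≡0⇒∣ᶻ : ∀ {c x} → x ≡ 0ℤ → c ∣ᶻ x
≡0⇒∣ᶻ refl = 0ᶻ∣ _

coeff-⊠-∷ʳ : ∀ f b g k → coeff (f ⊠ (b ∷ g)) k ≡ b *ᶻ coeff f k +ᶻ coeff (0ℤ ∷ (f ⊠ g)) k
coeff-⊠-∷ʳ f b g k = begin
  coeff (f ⊠ (b ∷ g)) k                           ≡⟨ coeff-≡ (⊠-∷ʳ f b g) k ⟩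
  coeff (b · f ⊞ (0ℤ ∷ (f ⊠ g))) k                ≡⟨ coeff-⊞ (b · f) _ k ⟩
  coeff (b · f) k +ᶻ coeff (0ℤ ∷ (f ⊠ g)) k       ≡⟨ cong (_+ᶻ coeff (0ℤ ∷ (f ⊠ g)) k) (coeff-· b f k) ⟩
  b *ᶻ coeff f k +ᶻ coeff (0ℤ ∷ (f ⊠ g)) k        ∎
  where open ≡-Reasoning

coeff-⊠-∷ˡ : ∀ a f g k → coeff ((a ∷ f) ⊠ g) k ≡ a *ᶻ coeff g k +ᶻ coeff (0ℤ ∷ (f ⊠ g)) k
coeff-⊠-∷ˡ a f g k =
  trans (coeff-⊞ (a · g) _ k) (cong (_+ᶻ coeff (0ℤ ∷ (f ⊠ g)) k) (coeff-· a g k))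

∣-coeff-⊠ : ∀ {c} f g → (∀ j → c ∣ᶻ coeff g j) → ∀ j → c ∣ᶻ coeff (f ⊠ g) j
∣-coeff-⊠ []      g c∣g j = 0ᶻ∣ _
∣-coeff-⊠ {c} (a ∷ f) g c∣g j =
  ∣ᶻ-resp (sym (coeff-⊠-∷ˡ a f g j)) (∣m∣n⇒∣m+n (∣n⇒∣m*n a (c∣g j)) (shifted j))
  where
  shifted : ∀ j → c ∣ᶻ coeff (0ℤ ∷ (f ⊠ g)) j
  shifted zero    = 0ᶻ∣ _
  shifted (suc j) = ∣-coeff-⊠ f g c∣g j

record Monic (k : ℕ) (f : Poly) : Set where
  constructor monic
  field
    leading : coeff f k ≡ 1ℤ
    above   : ∀ j → k < j → coeff f j ≡ 0ℤ
open Monic public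

Monic-resp : ∀ {k f g} → f ≃ g → Monic k f → Monic k g
Monic-resp (mk f≈g) (monic ld ab) =
  monic (trans (sym (f≈g _)) ld) (λ j k<j → trans (sym (f≈g j)) (ab j k<j))

-- Multiplying by a monic M carries the top coefficient of s over unchanged, so divisibility
-- descends coefficient by coefficient from the top. The case c = 0 is about vanishing and gives
-- degrees, cancellation and uniqueness of quotients.
monic-∣ : ∀ {c k M} → Monic k M → ∀ s l →
          (∀ j → k ℕ.+ l ≤ j → c ∣ᶻ coeff (M ⊠ s) j) → ∀ j → l ≤ j → c ∣ᶻ coeff s j
monic-∣ mM []      l       c∣Ms j       l≤j = 0ᶻ∣ _
monic-∣ {c} {k} {M} mM (a ∷ s) l c∣Ms = go l c∣Ms
  where
  tail-∣ : ∀ j → k ≤ j → c ∣ᶻ coeff (M ⊠ (a ∷ s)) (suc j) → c ∣ᶻ coeff (M ⊠ s) j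
  tail-∣ j k≤j = ∣ᶻ-resp (begin
    coeff (M ⊠ (a ∷ s)) (suc j)                ≡⟨ coeff-⊠-∷ʳ M a s (suc j) ⟩
    a *ᶻ coeff M (suc j) +ᶻ coeff (M ⊠ s) j    ≡⟨ cong (λ z → a *ᶻ z +ᶻ coeff (M ⊠ s) j) (above mM (suc j) (s≤s k≤j)) ⟩
    a *ᶻ 0ℤ +ᶻ coeff (M ⊠ s) j                 ≡⟨ cong (_+ᶻ coeff (M ⊠ s) j) (ℤ.*-zeroʳ a) ⟩
    0ℤ +ᶻ coeff (M ⊠ s) j                      ≡⟨ ℤ.+-identityˡ _ ⟩
    coeff (M ⊠ s) j                            ∎)
    where open ≡-Reasoning
  go : ∀ l → (∀ j → k ℕ.+ l ≤ j → c ∣ᶻ coeff (M ⊠ (a ∷ s)) j) → ∀ j → l ≤ j → c ∣ᶻ coeff (a ∷ s) j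
  go zero c∣ = λ { zero _ → c∣a ; (suc j) _ → c∣s j }
    where
    c∣s : ∀ j → c ∣ᶻ coeff s j
    c∣s j = monic-∣ mM s 0 (λ i k≤i → tail-∣ i (subst (_≤ i) (ℕ.+-identityʳ k) k≤i)
              (c∣ (suc i) (ℕ.m≤n⇒m≤1+n k≤i))) j z≤n
    shifted : ∀ j → c ∣ᶻ coeff (0ℤ ∷ (M ⊠ s)) j
    shifted zero    = 0ᶻ∣ _
    shifted (suc j) = ∣-coeff-⊠ M s c∣s j
    -- In the coefficient at k, a is multiplied by the leading 1 of M, and c already divides the
    -- contribution of s.
    c∣a : c ∣ᶻ a
    c∣a = ∣ᶻ-resp (trans (cong (a *ᶻ_) (leading mM)) (ℤ.*-identityʳ a))
      (∣m+n∣n⇒∣m (∣ᶻ-resp (coeff-⊠-∷ʳ M a s k) (c∣ k (ℕ.≤-reflexive (ℕ.+-identityʳ k)))) (shifted k))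
  go (suc l) c∣ zero    ()
  go (suc l) c∣ (suc j) (s≤s l≤j) = monic-∣ mM s l
    (λ i k+l≤i → tail-∣ i (ℕ.≤-trans (ℕ.m≤m+n k l) k+l≤i)
      (c∣ (suc i) (subst (_≤ suc i) (sym (ℕ.+-suc k l)) (s≤s k+l≤i)))) j l≤j

coeff-⊠-above : ∀ k l f g → (∀ j → k < j → coeff f j ≡ 0ℤ) → (∀ j → l < j → coeff g j ≡ 0ℤ) →
                ∀ j → k ℕ.+ l < j → coeff (f ⊠ g) j ≡ 0ℤ
coeff-⊠-above k l [] g f0 g0 j lt = refl
coeff-⊠-above k l (a ∷ f) g f0 g0 (suc j) lt = begin
  coeff ((a ∷ f) ⊠ g) (suc j)                 ≡⟨ coeff-⊠-∷ˡ a f g (suc j) ⟩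
  a *ᶻ coeff g (suc j) +ᶻ coeff (f ⊠ g) j     ≡⟨ cong₂ (λ x y → a *ᶻ x +ᶻ y) (g0 (suc j) (ℕ.≤-<-trans (ℕ.m≤n+m l k) lt)) (rest k f0 lt) ⟩
  a *ᶻ 0ℤ +ᶻ 0ℤ                               ≡⟨ ℤ.+-identityʳ _ ⟩
  a *ᶻ 0ℤ                                     ≡⟨ ℤ.*-zeroʳ a ⟩
  0ℤ                                          ∎
  where
  open ≡-Reasoning
  rest : ∀ k → (∀ j → k < j → coeff (a ∷ f) j ≡ 0ℤ) → k ℕ.+ l < suc j → coeff (f ⊠ g) j ≡ 0ℤ
  rest zero    f0 lt = 0∣ᶻ⇒≡0 (∣ᶻ-resp (coeff-≡ (⊠-comm g f) j)
    (∣-coeff-⊠ g f (λ i → ≡0⇒∣ᶻ (f0 (suc i) (s≤s z≤n))) j))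
  rest (suc k) f0 (s≤s lt) = coeff-⊠-above k l f g (λ i k<i → f0 (suc i) (s≤s k<i)) g0 j lt

coeff-⊠-top : ∀ k l f g → (∀ j → k < j → coeff f j ≡ 0ℤ) → (∀ j → l < j → coeff g j ≡ 0ℤ) →
              coeff (f ⊠ g) (k ℕ.+ l) ≡ coeff f k *ᶻ coeff g l
coeff-⊠-top k       l []      g f0 g0 = refl
coeff-⊠-top zero    l (a ∷ f) g f0 g0 = begin
  coeff ((a ∷ f) ⊠ g) l                         ≡⟨ coeff-⊠-∷ˡ a f g l ⟩
  a *ᶻ coeff g l +ᶻ coeff (0ℤ ∷ (f ⊠ g)) l      ≡⟨ cong (λ z → a *ᶻ coeff g l +ᶻ z) (shifted l) ⟩
  a *ᶻ coeff g l +ᶻ 0ℤ                          ≡⟨ ℤ.+-identityʳ _ ⟩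
  a *ᶻ coeff g l                                ∎
  where
  open ≡-Reasoning
  shifted : ∀ l → coeff (0ℤ ∷ (f ⊠ g)) l ≡ 0ℤ
  shifted zero    = refl
  shifted (suc j) = 0∣ᶻ⇒≡0 (∣ᶻ-resp (coeff-≡ (⊠-comm g f) j)
    (∣-coeff-⊠ g f (λ i → ≡0⇒∣ᶻ (f0 (suc i) (s≤s z≤n))) j))
coeff-⊠-top (suc k) l (a ∷ f) g f0 g0 = begin
  coeff ((a ∷ f) ⊠ g) (suc (k ℕ.+ l))                     ≡⟨ coeff-⊠-∷ˡ a f g (suc (k ℕ.+ l)) ⟩
  a *ᶻ coeff g (suc (k ℕ.+ l)) +ᶻ coeff (f ⊠ g) (k ℕ.+ l) ≡⟨ cong₂ (λ x y → a *ᶻ x +ᶻ y) (g0 _ (s≤s (ℕ.m≤n+m l k)))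
                                                              (coeff-⊠-top k l f g (λ i k<i → f0 (suc i) (s≤s k<i)) g0) ⟩
  a *ᶻ 0ℤ +ᶻ coeff f k *ᶻ coeff g l                       ≡⟨ cong (_+ᶻ coeff f k *ᶻ coeff g l) (ℤ.*-zeroʳ a) ⟩
  0ℤ +ᶻ coeff f k *ᶻ coeff g l                            ≡⟨ ℤ.+-identityˡ _ ⟩
  coeff f k *ᶻ coeff g l                                  ∎
  where open ≡-Reasoning

Monic-1 : Monic 0 (1ℤ ∷ [])
Monic-1 = monic refl λ { (suc j) _ → refl }

Monic-⊠ : ∀ {k l f g} → Monic k f → Monic l g → Monic (k ℕ.+ l) (f ⊠ g)
Monic-⊠ {k} {l} {f} {g} mf mg = monic
  (trans (coeff-⊠-top k l f g (above mf) (above mg)) (cong₂ _*ᶻ_ (leading mf) (leading mg)))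
  (coeff-⊠-above k l f g (above mf) (above mg))

Monic-quotient : ∀ {k n M} q → Monic k M → Monic n (M ⊠ q) → ∃ λ l → n ≡ k ℕ.+ l × Monic l q
Monic-quotient {k} {n} {M} q mM mMq with k ℕ.≤? n
... | yes k≤n = l , n≡ , monic
      (begin
        coeff q l                   ≡⟨ ℤ.*-identityˡ _ ⟨
        1ℤ *ᶻ coeff q l             ≡⟨ cong (_*ᶻ coeff q l) (leading mM) ⟨
        coeff M k *ᶻ coeff q l      ≡⟨ coeff-⊠-top k l M q (above mM) q0 ⟨
        coeff (M ⊠ q) (k ℕ.+ l)     ≡⟨ cong (coeff (M ⊠ q)) n≡ ⟨
        coeff (M ⊠ q) n             ≡⟨ leading mMq ⟩
        1ℤ                          ∎)
      q0
  where
  open ≡-Reasoning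
  l = n ℕ.∸ k
  n≡ : n ≡ k ℕ.+ l
  n≡ = sym (ℕ.m+[n∸m]≡n k≤n)
  q0 : ∀ j → l < j → coeff q j ≡ 0ℤ
  q0 j l<j = 0∣ᶻ⇒≡0 (monic-∣ mM q (suc l) (λ i lt → ≡0⇒∣ᶻ (above mMq i
    (subst (_≤ i) (trans (ℕ.+-suc k l) (cong suc (sym n≡))) lt))) j l<j)
-- If k > n, the coefficients of M q vanish from k on, which forces q = 0 and contradicts the
-- leading 1 of M q.
... | no k≰n = ⊥-elim (1≢0 (trans (sym (leading mMq)) (0∣ᶻ⇒≡0 (∣-coeff-⊠ M q
      (λ j → monic-∣ mM q 0 (λ i lt → ≡0⇒∣ᶻ (above mMq i (ℕ.<-≤-trans (ℕ.≰⇒> k≰n)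
        (subst (_≤ i) (ℕ.+-identityʳ k) lt)))) j z≤n) n))))
  where
  1≢0 : 1ℤ ≡ 0ℤ → _
  1≢0 ()

deg-monic : ∀ {k} f → Monic k f → deg f ≡ k
deg-monic [] (monic () _)
deg-monic {k} (a ∷ f) mf with all? (ℤ._≟ 0ℤ) f
deg-monic {zero}  (a ∷ f) mf | yes _   = refl
deg-monic {suc k} (a ∷ f) mf | yes f≡0 = ⊥-elim (absurd f k f≡0 (leading mf))
  where
  absurd : ∀ f k → All (_≡ 0ℤ) f → coeff f k ≡ 1ℤ → _
  absurd (_ ∷ f) zero    (refl ∷ _) ()
  absurd (_ ∷ f) (suc k) (_ ∷ f≡0) eq = absurd f k f≡0 eq
deg-monic {zero}  (a ∷ f) mf | no f≢0 = ⊥-elim (f≢0 (zeros f (λ j → above mf (suc j) (s≤s z≤n))))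
  where
  zeros : ∀ f → (∀ j → coeff f j ≡ 0ℤ) → All (_≡ 0ℤ) f
  zeros []      f0 = []
  zeros (b ∷ f) f0 = f0 0 ∷ zeros f (λ j → f0 (suc j))
deg-monic {suc k} (a ∷ f) mf | no f≢0 =
  cong suc (deg-monic f (monic (leading mf) λ j k<j → above mf (suc j) (s≤s k<j)))

quotRem-spec : ∀ g f → f ≃ proj₁ (quotRem g f) ⊠ g ⊞ proj₂ (quotRem g f)
quotRem-spec g []      = ≃-refl
quotRem-spec g (a ∷ f) with quotRem g f | quotRem-spec g f
... | q , r | f≃ = ≃-sym (≃-trans (regroup (coeff (a ∷ r) (deg g) · g) (0ℤ ∷ (q ⊠ g)) (a ∷ r))
                     (∷-cong (ℤ.+-identityˡ a) (≃-sym f≃)))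
  where
  regroup : ∀ cg sqg ar → (cg ⊞ sqg) ⊞ (ar ⊟ cg) ≃ sqg ⊞ ar
  regroup = solve-∀ ℤ[X]-acr

rem-above : ∀ {k} g f → Monic k g → ∀ j → k ≤ j → coeff (proj₂ (quotRem g f)) j ≡ 0ℤ
rem-above g [] mg j k≤j = refl
rem-above {k} g (a ∷ f) mg j k≤j rewrite deg-monic g mg with quotRem g f | rem-above g f mg
... | q , r | r0 = trans (coeff-⊞ (a ∷ r) ((-ᶻ 1ℤ) · (c · g)) j) (trans (cong (coeff (a ∷ r) j +ᶻ_)
        (trans (coeff-· (-ᶻ 1ℤ) (c · g) j) (cong (-ᶻ 1ℤ *ᶻ_) (coeff-· c g j)))) (go j k≤j))
  where
  open ≡-Reasoning
  c = coeff (a ∷ r) k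
  cancel : ∀ x → x +ᶻ -ᶻ 1ℤ *ᶻ (x *ᶻ 1ℤ) ≡ 0ℤ
  cancel = ℤSolver.solve-∀
  vanish : ∀ x → 0ℤ +ᶻ -ᶻ 1ℤ *ᶻ (x *ᶻ 0ℤ) ≡ 0ℤ
  vanish = ℤSolver.solve-∀
  go : ∀ j → k ≤ j → coeff (a ∷ r) j +ᶻ -ᶻ 1ℤ *ᶻ (c *ᶻ coeff g j) ≡ 0ℤ
  go j k≤j with ℕ.m≤n⇒m<n∨m≡n k≤j
  ... | inj₂ refl = trans (cong (λ z → c +ᶻ -ᶻ 1ℤ *ᶻ (c *ᶻ z)) (leading mg)) (cancel c)
  ... | inj₁ k<j@(s≤s {n = i} k≤i) =
    trans (cong₂ (λ y z → y +ᶻ -ᶻ 1ℤ *ᶻ (c *ᶻ z)) (r0 i k≤i) (above mg j k<j)) (vanish c)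

⊟≃[]⇒≃ : ∀ {f g} → f ⊟ g ≃ [] → f ≃ g
⊟≃[]⇒≃ {f} {g} eq = ≃-trans (restore f g) (⊞-cong eq ≃-refl)
  where
  restore : ∀ f g → f ≃ (f ⊟ g) ⊞ g
  restore = solve-∀ ℤ[X]-acr

monic-≃[] : ∀ {k M} → Monic k M → ∀ s → (∀ j → k ≤ j → coeff (M ⊠ s) j ≡ 0ℤ) → s ≃ []
monic-≃[] {k} mM s zeros = mk λ j → 0∣ᶻ⇒≡0 (monic-∣ mM s 0
  (λ i k≤i → ≡0⇒∣ᶻ (zeros i (subst (_≤ i) (ℕ.+-identityʳ k) k≤i))) j z≤n)

⊠-cancelˡ : ∀ {k M} → Monic k M → ∀ f g → M ⊠ f ≃ M ⊠ g → f ≃ g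
⊠-cancelˡ {M = M} mM f g Mf≃Mg = ⊟≃[]⇒≃ (monic-≃[] mM (f ⊟ g) λ i _ →
  coeff-≡ (≃-trans (expand M f g) (≃-trans (⊞-cong Mf≃Mg ≃-refl) (⊞-inverseʳ (M ⊠ g)))) i)
  where
  expand : ∀ M f g → M ⊠ (f ⊟ g) ≃ M ⊠ f ⊟ M ⊠ g
  expand = solve-∀ ℤ[X]-acr

-- M (q - f ÷ M) equals the remainder, which vanishes from the degree of M on; a multiple of a monic
-- M can only do so if the cofactor is 0.
÷-exact : ∀ {k M} f q → Monic k M → f ≃ M ⊠ q → f ÷ M ≃ q
÷-exact {k} {M} f q mM f≃ = ≃-sym (⊟≃[]⇒≃ (monic-≃[] mM (q ⊟ (f ÷ M)) λ j k≤j →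
  trans (coeff-≡ (≃-trans (expand M q (f ÷ M)) (≃-trans
    (⊞-cong (≃-trans (≃-sym f≃) (quotRem-spec M f)) ≃-refl)
    (cancel (f ÷ M ⊠ M) r))) j)
    (rem-above M f mM j k≤j)))
  where
  r = proj₂ (quotRem M f)
  expand : ∀ M q d → M ⊠ (q ⊟ d) ≃ M ⊠ q ⊟ d ⊠ M
  expand = solve-∀ ℤ[X]-acr
  cancel : ∀ p r → (p ⊞ r) ⊟ p ≃ r
  cancel = solve-∀ ℤ[X]-acr

-- Divisibility of polynomials by integers

const : ℤ → Poly
const c = c ∷ []

·≃const⊠ : ∀ c f → c · f ≃ const c ⊠ f
·≃const⊠ c f = ≃-sym (≃-trans (⊞-cong (≃-refl {c · f}) 0∷[]≃[]) (⊞-identityʳ (c · f)))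

coeff-const⊠ : ∀ c f j → coeff (const c ⊠ f) j ≡ c *ᶻ coeff f j
coeff-const⊠ c f j = trans (sym (coeff-≡ (·≃const⊠ c f) j)) (coeff-· c f j)

∣-coeffs⇒const⊠ : ∀ c f → (∀ j → c ∣ᶻ coeff f j) → ∃ λ h → f ≃ const c ⊠ h
∣-coeffs⇒const⊠ c f c∣f = h f c∣f , ≃-sym (≃-trans (≃-sym (·≃const⊠ c (h f c∣f))) (h-spec f c∣f))
  where
  h : ∀ f → (∀ j → c ∣ᶻ coeff f j) → Poly
  h []      _   = []
  h (a ∷ f) c∣f = _∣ᶻ_.quotient (c∣f 0) ∷ h f (λ j → c∣f (suc j))
  h-spec : ∀ f c∣f → c · h f c∣f ≃ f
  h-spec []      _   = ≃-refl
  h-spec (a ∷ f) c∣f = ∷-cong (trans (ℤ.*-comm c _) (sym (_∣ᶻ_.equality (c∣f 0)))) (h-spec f (λ j → c∣f (suc j)))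

∣-coeff-const⊠ : ∀ c h j → c ∣ᶻ coeff (const c ⊠ h) j
∣-coeff-const⊠ c h j = divides (coeff h j) (trans (coeff-const⊠ c h j) (ℤ.*-comm c _))

const-cancelˡ : ∀ {c} → c ≢ 0ℤ → ∀ f g → const c ⊠ f ≃ const c ⊠ g → f ≃ g
const-cancelˡ {c} c≢0 f g eq = mk λ j → ℤ.*-cancelˡ-≡ c _ _ {{ℤ.≢-nonZero c≢0}}
  (trans (sym (coeff-const⊠ c f j)) (trans (coeff-≡ eq j) (coeff-const⊠ c g j)))

-- As M is monic, c divides M s only if it divides s. So nonzero integers are non-zero-divisors
-- modulo M.
monic-saturated : ∀ {k M c} → Monic k M → c ≢ 0ℤ → ∀ f s → const c ⊠ f ≃ M ⊠ s → ∃ λ s′ → f ≃ M ⊠ s′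
monic-saturated {k} {M} {c} mM c≢0 f s eq
  with s′ , s≃ ← ∣-coeffs⇒const⊠ c s (λ j → monic-∣ mM s 0
                   (λ i _ → ∣ᶻ-resp (coeff-≡ eq i) (∣-coeff-const⊠ c f i)) j z≤n)
  = s′ , const-cancelˡ c≢0 f (M ⊠ s′) (≃-trans eq (≃-trans (⊠-cong (≃-refl {M}) s≃) (swap M (const c) s′)))
  where
  swap : ∀ M c s → M ⊠ (c ⊠ s) ≃ c ⊠ (M ⊠ s)
  swap = solve-∀ ℤ[X]-acr

prime∤⇒coprime : ∀ {p k} → Prime p → ¬ p ∣ k → Coprime k p
prime∤⇒coprime p-prime p∤k (d∣k , d∣p) with prime⇒irreducible p-prime d∣p
... | inj₁ d≡1  = d≡1
... | inj₂ refl = ⊥-elim (p∤k d∣k)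

-- Comaximality and the polynomials X^n - 1

IsMonic : Poly → Set
IsMonic f = ∃ λ k → Monic k f

IsMonic-⊠ : ∀ {f g} → IsMonic f → IsMonic g → IsMonic (f ⊠ g)
IsMonic-⊠ (k , mf) (l , mg) = k ℕ.+ l , Monic-⊠ mf mg

IsMonic-∏ : ∀ {fs} → All IsMonic fs → IsMonic (∏ fs)
IsMonic-∏ []       = 0 , Monic-1
IsMonic-∏ (m ∷ ms) = IsMonic-⊠ m (IsMonic-∏ ms)

-- The Chinese remainder theorem modulo the ideal (π), with comaximality
-- relaxed to u P + v Q ∈ S for a set S of integers that can be cancelled.
module CRT (π : Poly) (S : ℤ → Set) where

  _∈⟨π,_⟩ : Poly → Poly → Set
  f ∈⟨π, P ⟩ = ∃₂ λ q r → f ≃ π ⊠ q ⊞ P ⊠ r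

  Comaximal : Poly → Poly → Set
  Comaximal P Q = ∃ λ c → S c × ∃₂ λ u v → u ⊠ P ⊞ v ⊠ Q ≃ const c

  module _ (S-1 : S 1ℤ) (S-* : ∀ {a b} → S a → S b → S (a *ᶻ b))
           (saturated : ∀ {a P} f → S a → IsMonic P → (const a ⊠ f) ∈⟨π, P ⟩ → f ∈⟨π, P ⟩) where

    Comaximal-1 : ∀ P → Comaximal P (const 1ℤ)
    Comaximal-1 P = 1ℤ , S-1 , [] , const 1ℤ , ⊠-identityˡ (const 1ℤ)

    Comaximal-⊠ : ∀ {P Q Q′} → Comaximal P Q → Comaximal P Q′ → Comaximal P (Q ⊠ Q′)
    Comaximal-⊠ {P} {Q} {Q′} (a , Sa , u , v , eq) (a′ , Sa′ , u′ , v′ , eq′) =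
      -- Product of the two relations: every term except v v′ Q Q′ contains P.
      a *ᶻ a′ , S-* Sa Sa′ , (u ⊠ (u′ ⊠ P ⊞ v′ ⊠ Q′) ⊞ v ⊠ Q ⊠ u′) , (v ⊠ v′) ,
      ≃-trans (expand P Q Q′ u v u′ v′) (≃-trans (⊠-cong eq eq′) (≃-sym (·≃const⊠ a (const a′))))
      where
      expand : ∀ P Q Q′ u v u′ v′ → (u ⊠ (u′ ⊠ P ⊞ v′ ⊠ Q′) ⊞ v ⊠ Q ⊠ u′) ⊠ P ⊞ v ⊠ v′ ⊠ (Q ⊠ Q′)
               ≃ (u ⊠ P ⊞ v ⊠ Q) ⊠ (u′ ⊠ P ⊞ v′ ⊠ Q′)
      expand = solve-∀ ℤ[X]-acr

    Comaximal-∏ : ∀ {P Qs} → All (Comaximal P) Qs → Comaximal P (∏ Qs)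
    Comaximal-∏ {P} []       = Comaximal-1 P
    Comaximal-∏     (c ∷ cs) = Comaximal-⊠ c (Comaximal-∏ cs)

    -- Write a f = u P f + v Q f and insert the membership modulo Q into the first term and that
    -- modulo P into the second: both become multiples of P Q modulo π. The scalar a is then
    -- cancelled.
    combine : ∀ {P Q f} → IsMonic (P ⊠ Q) → Comaximal P Q → f ∈⟨π, P ⟩ → f ∈⟨π, Q ⟩ → f ∈⟨π, P ⊠ Q ⟩
    combine {P} {Q} {f} mPQ (a , Sa , u , v , eq) (q , r , f≃) (q′ , r′ , f≃′) = saturated f Sa mPQ
      (u ⊠ P ⊠ q′ ⊞ v ⊠ Q ⊠ q , u ⊠ r′ ⊞ v ⊠ r , (begin
        const a ⊠ f                   ≈⟨ ⊠-cong eq (≃-refl {f}) ⟨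
        (u ⊠ P ⊞ v ⊠ Q) ⊠ f           ≈⟨ split u v P Q f ⟩
        u ⊠ P ⊠ f ⊞ v ⊠ Q ⊠ f         ≈⟨ ⊞-cong (⊠-cong (≃-refl {u ⊠ P}) f≃′) (⊠-cong (≃-refl {v ⊠ Q}) f≃) ⟩
        u ⊠ P ⊠ (π ⊠ q′ ⊞ Q ⊠ r′) ⊞ v ⊠ Q ⊠ (π ⊠ q ⊞ P ⊠ r)
                                      ≈⟨ expand P Q π u v q r q′ r′ ⟩
        π ⊠ (u ⊠ P ⊠ q′ ⊞ v ⊠ Q ⊠ q) ⊞ P ⊠ Q ⊠ (u ⊠ r′ ⊞ v ⊠ r) ∎))
      where
      open ≃-Reasoning
      split : ∀ u v P Q f → (u ⊠ P ⊞ v ⊠ Q) ⊠ f ≃ u ⊠ P ⊠ f ⊞ v ⊠ Q ⊠ f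
      split = solve-∀ ℤ[X]-acr
      expand : ∀ P Q π u v q r q′ r′ → u ⊠ P ⊠ (π ⊠ q′ ⊞ Q ⊠ r′) ⊞ v ⊠ Q ⊠ (π ⊠ q ⊞ P ⊠ r)
               ≃ π ⊠ (u ⊠ P ⊠ q′ ⊞ v ⊠ Q ⊠ q) ⊞ P ⊠ Q ⊠ (u ⊠ r′ ⊞ v ⊠ r)
      expand = solve-∀ ℤ[X]-acr

    crt : ∀ {Ps} f → All IsMonic Ps → AllPairs Comaximal Ps → All (f ∈⟨π,_⟩) Ps → f ∈⟨π, ∏ Ps ⟩
    crt f []       []       []       = [] , f ,
      ≃-sym (≃-trans (⊞-cong (⊠-zeroʳ π) (⊠-identityˡ f)) ≃-refl)
    crt f (m ∷ ms) (c ∷ cs) (i ∷ is) =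
      combine (IsMonic-⊠ m (IsMonic-∏ ms)) (Comaximal-∏ c) i (crt f ms cs is)

X^n-1 : ℕ → Poly
X^n-1 n = X^ n ⊟ X^ 0

-- 1 + X^N + ... + X^((c-1)N), which for N > 0 is the quotient (X^(cN) - 1)/(X^N - 1).
geo : ℕ → ℕ → Poly
geo zero    N = []
geo (suc c) N = X^ 0 ⊞ X^ N ⊠ geo c N

X^-+ : ∀ a b → X^ (a ℕ.+ b) ≃ X^ a ⊠ X^ b
X^-+ zero    b = ≃-sym (⊠-identityˡ (X^ b))
X^-+ (suc a) b = ≃-trans (∷-cong refl (X^-+ a b)) (≃-sym (0∷-⊠ (X^ a) (X^ b)))

X^n-1-⊠-geo : ∀ c N → X^n-1 N ⊠ geo c N ≃ X^n-1 (c ℕ.* N)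
X^n-1-⊠-geo zero    N = ≃-trans (⊠-zeroʳ (X^n-1 N)) (≃-sym (⊞-inverseʳ (X^ 0)))
X^n-1-⊠-geo (suc c) N = begin
  X^n-1 N ⊠ (X^ 0 ⊞ X^ N ⊠ geo c N)                      ≈⟨ expand (X^n-1 N) (X^ 0) (X^ N) (geo c N) ⟩
  X^ 0 ⊠ X^n-1 N ⊞ X^ N ⊠ (X^n-1 N ⊠ geo c N)            ≈⟨ ⊞-cong (⊠-identityˡ (X^n-1 N)) (⊠-cong (≃-refl {X^ N}) (X^n-1-⊠-geo c N)) ⟩
  X^n-1 N ⊞ X^ N ⊠ X^n-1 (c ℕ.* N)                       ≈⟨ telescope (X^ N) (X^ (c ℕ.* N)) (X^ 0) ⟩
  (X^ N ⊟ X^ N ⊠ X^ 0) ⊞ (X^ N ⊠ X^ (c ℕ.* N) ⊟ X^ 0)     ≈⟨ ⊞-cong cancel (⊞-cong (≃-sym (X^-+ N (c ℕ.* N))) ≃-refl) ⟩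
  X^n-1 (suc c ℕ.* N)                                    ∎
  where
  open ≃-Reasoning
  expand : ∀ D e x g → D ⊠ (e ⊞ x ⊠ g) ≃ e ⊠ D ⊞ x ⊠ (D ⊠ g)
  expand = solve-∀ ℤ[X]-acr
  telescope : ∀ x y e → (x ⊟ e) ⊞ x ⊠ (y ⊟ e) ≃ (x ⊟ x ⊠ e) ⊞ (x ⊠ y ⊟ e)
  telescope = solve-∀ ℤ[X]-acr
  cancel : X^ N ⊟ X^ N ⊠ X^ 0 ≃ []
  cancel = ≃-trans (⊞-cong (≃-refl {X^ N}) (·-cong (-ᶻ 1ℤ)
    (≃-trans (⊠-comm (X^ N) (X^ 0)) (⊠-identityˡ (X^ N))))) (⊞-inverseʳ (X^ N))

-- Each of the c powers of X^N is 1 modulo X^N - 1.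
geo-≡-const : ∀ c N → ∃ λ Q → geo c N ≃ const (+ c) ⊞ X^n-1 N ⊠ Q
geo-≡-const zero    N = [] , ≃-sym (≃-trans (⊞-cong 0∷[]≃[] (⊠-zeroʳ (X^n-1 N))) ≃-refl)
geo-≡-const (suc c) N with Q , eq ← geo-≡-const c N = const (+ c) ⊞ X^ N ⊠ Q , (begin
  X^ 0 ⊞ X^ N ⊠ geo c N                                   ≈⟨ ⊞-cong (≃-refl {X^ 0}) (⊠-cong (≃-refl {X^ N}) eq) ⟩
  X^ 0 ⊞ X^ N ⊠ (const (+ c) ⊞ X^n-1 N ⊠ Q)               ≈⟨ expand (X^ 0) (X^ N) (const (+ c)) Q ⟩
  (X^ 0 ⊞ X^ 0 ⊠ const (+ c)) ⊞ X^n-1 N ⊠ (const (+ c) ⊞ X^ N ⊠ Q)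
    ≈⟨ ⊞-cong (⊞-cong (≃-refl {X^ 0}) (⊠-identityˡ (const (+ c)))) (≃-refl {X^n-1 N ⊠ (const (+ c) ⊞ X^ N ⊠ Q)}) ⟩
  const (+ suc c) ⊞ X^n-1 N ⊠ (const (+ c) ⊞ X^ N ⊠ Q)    ∎)
  where
  open ≃-Reasoning
  expand : ∀ e x k Q → e ⊞ x ⊠ (k ⊞ (x ⊟ e) ⊠ Q) ≃ (e ⊞ e ⊠ k) ⊞ (x ⊟ e) ⊠ (k ⊞ x ⊠ Q)
  expand = solve-∀ ℤ[X]-acr

Monic-X^ : ∀ k → Monic k (X^ k)
Monic-X^ zero    = Monic-1
Monic-X^ (suc k) with monic ld ab ← Monic-X^ k = monic ld λ { (suc j) (s≤s k<j) → ab j k<j }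

Monic-⊞ : ∀ {k f g} → Monic k f → (∀ j → k ≤ j → coeff g j ≡ 0ℤ) → Monic k (f ⊞ g)
Monic-⊞ {k} {f} {g} mf g0 = monic
  (trans (coeff-⊞ f g k) (trans (cong₂ _+ᶻ_ (leading mf) (g0 k ℕ.≤-refl)) refl))
  (λ j k<j → trans (coeff-⊞ f g j) (cong₂ _+ᶻ_ (above mf j k<j) (g0 j (ℕ.<⇒≤ k<j))))

Monic-X^n-1 : ∀ {n} → 0 < n → Monic n (X^n-1 n)
Monic-X^n-1 {n} 0<n = Monic-⊞ (Monic-X^ n) λ { zero n≤0 → absurd (ℕ.<-≤-trans 0<n n≤0) ; (suc j) _ → refl }
  where
  absurd : 0 < 0 → _
  absurd ()

Monic-geo : ∀ c {N} → 0 < N → Monic (c ℕ.* N) (geo (suc c) N)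
Monic-geo zero    {N} 0<N = Monic-resp
  (≃-sym (≃-trans (⊞-cong (≃-refl {X^ 0}) (⊠-zeroʳ (X^ N))) ≃-refl)) Monic-1
Monic-geo (suc c) {N} 0<N = Monic-resp (⊞-comm (X^ N ⊠ geo (suc c) N) (X^ 0))
  (Monic-⊞ (Monic-⊠ (Monic-X^ N) (Monic-geo c 0<N))
    λ { zero le → absurd (ℕ.<-≤-trans 0<N (ℕ.≤-trans (ℕ.m≤m+n N _) le)) ; (suc j) _ → refl })
  where
  absurd : 0 < 0 → _
  absurd ()

-- If x a = d + y b, then (X^(xa) - 1) - X^d (X^(yb) - 1) = X^d - 1, and the two terms are multiples
-- of X^a - 1 and X^b - 1.
X^n-1-gcd : ∀ a b → ∃₂ λ U V → U ⊠ X^n-1 a ⊞ V ⊠ X^n-1 b ≃ X^n-1 (gcd a b)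
X^n-1-gcd a b = go (Bézout.identity (gcd-GCD a b))
  where
  d = gcd a b
  euclid : ∀ x y a b → d ℕ.+ y ℕ.* b ≡ x ℕ.* a →
           geo x a ⊠ X^n-1 a ⊞ ([] ⊟ X^ d ⊠ geo y b) ⊠ X^n-1 b ≃ X^n-1 d
  euclid x y a b eq = begin
    geo x a ⊠ X^n-1 a ⊞ ([] ⊟ X^ d ⊠ geo y b) ⊠ X^n-1 b
      ≈⟨ regroup (geo x a) (X^n-1 a) (X^ d) (geo y b) (X^n-1 b) ⟩
    X^n-1 a ⊠ geo x a ⊟ X^ d ⊠ (X^n-1 b ⊠ geo y b)
      ≈⟨ ⊞-cong (X^n-1-⊠-geo x a) (·-cong (-ᶻ 1ℤ) (⊠-cong (≃-refl {X^ d}) (X^n-1-⊠-geo y b))) ⟩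
    X^n-1 (x ℕ.* a) ⊟ X^ d ⊠ X^n-1 (y ℕ.* b)
      ≡⟨ cong (λ k → X^n-1 k ⊟ X^ d ⊠ X^n-1 (y ℕ.* b)) eq ⟨
    X^n-1 (d ℕ.+ y ℕ.* b) ⊟ X^ d ⊠ X^n-1 (y ℕ.* b)
      ≈⟨ ⊞-cong (⊞-cong (X^-+ d (y ℕ.* b)) (≃-refl {(-ᶻ 1ℤ) · X^ 0})) ≃-refl ⟩
    (X^ d ⊠ X^ (y ℕ.* b) ⊟ X^ 0) ⊟ X^ d ⊠ X^n-1 (y ℕ.* b)
      ≈⟨ cancel (X^ d) (X^ (y ℕ.* b)) (X^ 0) ⟩
    X^ 0 ⊠ X^ d ⊟ X^ 0
      ≈⟨ ⊞-cong (⊠-identityˡ (X^ d)) ≃-refl ⟩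
    X^n-1 d ∎
    where
    open ≃-Reasoning
    regroup : ∀ g A x h B → g ⊠ A ⊞ ([] ⊟ x ⊠ h) ⊠ B ≃ A ⊠ g ⊟ x ⊠ (B ⊠ h)
    regroup = solve-∀ ℤ[X]-acr
    cancel : ∀ x y e → (x ⊠ y ⊟ e) ⊟ x ⊠ (y ⊟ e) ≃ e ⊠ x ⊟ e
    cancel = solve-∀ ℤ[X]-acr
  go : Bézout.Identity d a b → ∃₂ λ U V → U ⊠ X^n-1 a ⊞ V ⊠ X^n-1 b ≃ X^n-1 d
  go (Bézout.+- x y eq) = geo x a , ([] ⊟ X^ d ⊠ geo y b) , euclid x y a b eq
  go (Bézout.-+ x y eq) = ([] ⊟ X^ d ⊠ geo x a) , geo y b , ≃-trans (⊞-comm (([] ⊟ X^ d ⊠ geo x a) ⊠ X^n-1 a) (geo y b ⊠ X^n-1 b)) (euclid y x b a eq)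

-- Cyclotomic polynomials

module _ {A : Set} where

  Unique-resp-↭ : ∀ {xs ys : List A} → xs ↭ ys → Unique xs → Unique ys
  Unique-resp-↭ xs↭ys = PermS.Unique-resp-↭ (setoid A) (↭⇒↭ₛ xs↭ys)

  ⊆⇒complement : ∀ (xs : List A) {ys} → Unique xs → (∀ {x} → x ∈ xs → x ∈ ys) → ∃ λ zs → ys ↭ xs ++ zs
  ⊆⇒complement []       {ys} _          _     = ys , Perm.↭-refl
  ⊆⇒complement (x ∷ xs) {ys} (x∉xs ∷ u) xs⊆ys
    with as , bs , refl ← ∈-∃++ (xs⊆ys (here refl))
    with zs , as++bs↭ ← ⊆⇒complement xs {as ++ bs} u (λ {y} y∈xs →
           Any.tail (All.lookup x∉xs y∈xs ∘ sym) (Perm.∈-resp-↭ (Perm.shift x as bs) (xs⊆ys (there y∈xs))))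
    = zs , ↭-trans (Perm.shift x as bs) (prep x as++bs↭)

  Unique-++-disjoint : ∀ (xs : List A) {ys} → Unique (xs ++ ys) → ∀ {x} → x ∈ xs → ¬ x ∈ ys
  Unique-++-disjoint (x ∷ xs) (x∉ ∷ u) (here refl) x∈ys = All.lookup x∉ (∈-++⁺ʳ xs x∈ys) refl
  Unique-++-disjoint (x ∷ xs) (x∉ ∷ u) (there x∈)  x∈ys = Unique-++-disjoint xs u x∈ x∈ys

  Unique-++-right : ∀ (xs : List A) {ys} → Unique (xs ++ ys) → Unique ys
  Unique-++-right []       u       = u
  Unique-++-right (x ∷ xs) (_ ∷ u) = Unique-++-right xs u

  Unique⇒AllPairs-map : ∀ {B : Set} {R : B → B → Set} {f : A → B} xs → Unique xs →
                        (∀ {x y} → x ∈ xs → y ∈ xs → x ≢ y → R (f x) (f y)) → AllPairs R (map f xs)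
  Unique⇒AllPairs-map []       _        _ = []
  Unique⇒AllPairs-map (x ∷ xs) (x∉ ∷ u) r =
    All.map⁺ (All.tabulate λ y∈ → r (here refl) (there y∈) (All.lookup x∉ y∈))
    ∷ Unique⇒AllPairs-map xs u (λ y∈ z∈ → r (there y∈) (there z∈))

  Unique-set⇒↭ : ∀ {xs ys : List A} → Unique xs → Unique ys →
                 (∀ {x} → x ∈ xs → x ∈ ys) → (∀ {x} → x ∈ ys → x ∈ xs) → xs ↭ ys
  Unique-set⇒↭ u v to from = ∼bag⇒↭ (unique∧set⇒bag u v (mk⇔ to from))

∏-++ : ∀ fs gs → ∏ (fs ++ gs) ≃ ∏ fs ⊠ ∏ gs
∏-++ []       gs = ≃-sym (⊠-identityˡ (∏ gs))
∏-++ (f ∷ fs) gs = ≃-trans (⊠-cong (≃-refl {f}) (∏-++ fs gs)) (≃-sym (⊠-assoc f (∏ fs) (∏ gs)))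

∏-↭ : ∀ {fs gs} → fs ↭ gs → ∏ fs ≃ ∏ gs
∏-↭ Perm.refl                      = ≃-refl
∏-↭ (Perm.prep f p)                = ⊠-cong (≃-refl {f}) (∏-↭ p)
∏-↭ (Perm.swap {fs} {gs} f g p)    =
  ≃-trans (⊠-cong (≃-refl {f}) (⊠-cong (≃-refl {g}) (∏-↭ p))) (exchange f g (∏ gs))
  where
  exchange : ∀ f g h → f ⊠ (g ⊠ h) ≃ g ⊠ (f ⊠ h)
  exchange = solve-∀ ℤ[X]-acr
∏-↭ (Perm.trans p q)               = ≃-trans (∏-↭ p) (∏-↭ q)

∏Φ : List ℕ → Poly
∏Φ ds = ∏ (map Φ ds)

∏Φ-↭ : ∀ {ds es} → ds ↭ es → ∏Φ ds ≃ ∏Φ es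
∏Φ-↭ p = ∏-↭ (Perm.map⁺ Φ p)

∏Φ-++ : ∀ ds es → ∏Φ (ds ++ es) ≃ ∏Φ ds ⊠ ∏Φ es
∏Φ-++ ds es = subst (λ fs → ∏ fs ≃ ∏Φ ds ⊠ ∏Φ es) (sym (map-++ Φ ds es)) (∏-++ (map Φ ds) (map Φ es))

Φ∣∏Φ : ∀ {d} ds → d ∈ ds → ∃ λ w → ∏Φ ds ≃ Φ d ⊠ w
Φ∣∏Φ {d} ds d∈ with as , bs , refl ← ∈-∃++ d∈ = ∏Φ (as ++ bs) , ∏Φ-↭ (Perm.shift d as bs)

∈-divisors⁺ : ∀ {n d} → 0 < n → d ∣ n → d ∈ divisors n
∈-divisors⁺ {n} {zero}  0<n d∣n = ⊥-elim (ℕ.<⇒≢ 0<n (sym (0∣⇒≡0 d∣n)))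
∈-divisors⁺ {n} {suc d} 0<n d∣n =
  ∈-filter⁺ (_∣? n) (∈-map⁺ suc (∈-upTo⁺ (∣⇒≤ {{>-nonZero 0<n}} d∣n))) d∣n

∈-divisors⁻ : ∀ {n d} → d ∈ divisors n → d ∣ n
∈-divisors⁻ {n} d∈ = proj₂ (∈-filter⁻ (_∣? n) {xs = range n} d∈)

divisors-unique : ∀ n → Unique (divisors n)
divisors-unique n = Unique.filter⁺ (_∣? n) (Unique.map⁺ ℕ.suc-injective (Unique.upTo⁺ n))

divisor-positive : ∀ {n d} → 0 < n → d ∣ n → 0 < d
divisor-positive {n} {zero}  0<n d∣n = ⊥-elim (ℕ.<⇒≢ 0<n (sym (0∣⇒≡0 d∣n)))
divisor-positive {n} {suc d} 0<n d∣n = s≤s z≤n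

-- The indices of the product in the definition of `Φ`, with the bound d < n forgotten.
properDivisors : ℕ → List ℕ
properDivisors n = map toℕ (filter (λ d → toℕ d ∣? n) (allFin n))

∈-properDivisors⁺ : ∀ {n d} → d < n → d ∣ n → d ∈ properDivisors n
∈-properDivisors⁺ {n} {d} d<n d∣n = subst (_∈ properDivisors n) (Fin.toℕ-fromℕ< d<n)
  (∈-map⁺ toℕ (∈-filter⁺ (λ d → toℕ d ∣? n) (∈-allFin (fromℕ< d<n))
    (subst (_∣ n) (sym (Fin.toℕ-fromℕ< d<n)) d∣n)))

∈-properDivisors⁻ : ∀ {n d} → d ∈ properDivisors n → d < n × d ∣ n
∈-properDivisors⁻ {n} d∈ with i , i∈ , refl ← ∈-map⁻ toℕ d∈ =
  Fin.toℕ<n i , proj₂ (∈-filter⁻ (λ d → toℕ d ∣? n) {xs = allFin n} i∈)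

properDivisors-unique : ∀ n → Unique (properDivisors n)
properDivisors-unique n =
  Unique.map⁺ Fin.toℕ-injective (Unique.filter⁺ (λ d → toℕ d ∣? n) (Unique.allFin⁺ n))

n∷properDivisors : ∀ {n} → 0 < n → n ∷ properDivisors n ↭ divisors n
n∷properDivisors {n} 0<n = Unique-set⇒↭
  (All.tabulate (λ d∈ n≡d → ℕ.<⇒≢ (proj₁ (∈-properDivisors⁻ d∈)) (sym n≡d)) ∷ properDivisors-unique n)
  (divisors-unique n) to from
  where
  to : ∀ {d} → d ∈ n ∷ properDivisors n → d ∈ divisors n
  to (here refl) = ∈-divisors⁺ 0<n ∣-refl
  to (there d∈)  = ∈-divisors⁺ 0<n (proj₂ (∈-properDivisors⁻ d∈))
  from : ∀ {d} → d ∈ divisors n → d ∈ n ∷ properDivisors n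
  from {d} d∈ with ℕ.m≤n⇒m<n∨m≡n (∣⇒≤ {{>-nonZero 0<n}} (∈-divisors⁻ d∈))
  ... | inj₁ d<n  = there (∈-properDivisors⁺ d<n (∈-divisors⁻ d∈))
  ... | inj₂ refl = here refl

-- Well-founded recursion does not unfold by computation. Unfolding requires the body to respect
-- pointwise equality of its recursive argument, which `map-cong` supplies.
Φ-unfold : ∀ n → Φ n ≡ X^n-1 n ÷ ∏Φ (properDivisors n)
Φ-unfold n = trans
  (FixPoint.unfold-wfRec <-wellFounded (λ _ → Poly)
    (λ n Φ< → X^n-1 n ÷ ∏ (map (λ d → Φ< (Fin.toℕ<n d)) (filter (λ d → toℕ d ∣? n) (allFin n))))
    (λ n eq → cong (λ fs → X^n-1 n ÷ ∏ fs)
      (map-cong (λ d → eq (Fin.toℕ<n d)) (filter (λ d → toℕ d ∣? n) (allFin n)))) {n})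
  (cong (λ fs → X^n-1 n ÷ ∏ fs) (map-∘ {g = Φ} {f = toℕ} (filter (λ d → toℕ d ∣? n) (allFin n))))

-- The codomain basis, whose length is known to be n, is counted block by block.
sum-φ-divisors : ∀ n → sum (map φ (divisors n)) ≡ n
sum-φ-divisors n = trans (sym (length-blocks (divisors n))) (length-codomainBasis n)
  where
  length-blocks : ∀ ds → length (concat (map (λ d → map (inSummand d ∘ X^) (upTo (φ d))) ds)) ≡ sum (map φ ds)
  length-blocks []       = refl
  length-blocks (d ∷ ds) = trans (length-++ (map (inSummand d ∘ X^) (upTo (φ d))))
    (cong₂ ℕ._+_ (trans (length-map _ (upTo (φ d))) (length-upTo (φ d))) (length-blocks ds))

-- The two facts go through one strong induction: the division defining `Φ n` is exact because the
-- smaller `Φ d` are monic and pairwise comaximal up to nonzero integers, and comaximality rests on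
-- their product formulas.
record IsCyclotomic (n : ℕ) : Set where
  field
    Monic-Φ     : Monic (φ n) (Φ n)
    ∏Φ-divisors : ∏Φ (divisors n) ≃ X^n-1 n
open IsCyclotomic public

Φ∣X^n-1 : ∀ {d n} → IsCyclotomic n → 0 < n → d ∣ n → ∃ λ w → X^n-1 n ≃ Φ d ⊠ w
Φ∣X^n-1 {d} {n} cn 0<n d∣n with w , eq ← Φ∣∏Φ (divisors n) (∈-divisors⁺ 0<n d∣n) =
  w , ≃-trans (≃-sym (∏Φ-divisors cn)) eq

module _ {n N} (cn : IsCyclotomic n) (cN : IsCyclotomic N) (0<n : 0 < n) (N∣n : N ∣ n) where

  -- The divisors of n are those of N together with a list zs; the factors over the divisors of N
  -- multiply to X^N - 1.
  X^n-1-quotient : ∃ λ zs → Unique zs × (∀ {z} → z ∈ zs → z ∣ n × ¬ z ∣ N) ×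
                   (∀ {z} → z ∣ n → ¬ z ∣ N → z ∈ zs) × X^n-1 n ≃ X^n-1 N ⊠ ∏Φ zs
  X^n-1-quotient
    with zs , split ← ⊆⇒complement (divisors N) {divisors n} (divisors-unique N)
                    (λ d∈ → ∈-divisors⁺ 0<n (∣-trans (∈-divisors⁻ d∈) N∣n))
    = zs , Unique-++-right (divisors N) u , to , from , eq
    where
    u : Unique (divisors N ++ zs)
    u = Unique-resp-↭ split (divisors-unique n)
    to : ∀ {z} → z ∈ zs → z ∣ n × ¬ z ∣ N
    to z∈ = ∈-divisors⁻ (Perm.∈-resp-↭ (↭-sym split) (∈-++⁺ʳ (divisors N) z∈)) ,
      λ z∣N → Unique-++-disjoint (divisors N) u (∈-divisors⁺ (divisor-positive 0<n N∣n) z∣N) z∈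
    from : ∀ {z} → z ∣ n → ¬ z ∣ N → z ∈ zs
    from z∣n z∤N with ∈-++⁻ (divisors N) (Perm.∈-resp-↭ split (∈-divisors⁺ 0<n z∣n))
    ... | inj₁ z∈ = ⊥-elim (z∤N (∈-divisors⁻ z∈))
    ... | inj₂ z∈ = z∈
    eq : X^n-1 n ≃ X^n-1 N ⊠ ∏Φ zs
    eq = ≃-trans (≃-sym (∏Φ-divisors cn)) (≃-trans (∏Φ-↭ split) (≃-trans (∏Φ-++ (divisors N) zs)
      (⊠-cong (∏Φ-divisors cN) (≃-refl {∏Φ zs}))))

  Φ-cofactor : ∀ {d} → d ∣ n → ¬ d ∣ N → ∃ λ w → X^n-1 n ≃ X^n-1 N ⊠ (Φ d ⊠ w)
  Φ-cofactor d∣n d∤N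
    with zs , _ , _ , from , eq ← X^n-1-quotient
    with w , eq′ ← Φ∣∏Φ zs (from d∣n d∤N)
    = w , ≃-trans eq (⊠-cong (≃-refl {X^n-1 N}) eq′)

-- The scalars c that arise in u Φ a + v Φ b = c.
PairScalar : ℕ → ℕ → ℕ → Set
PairScalar a b c = c ≡ 1 ⊎ b ≡ c ℕ.* a ⊎ a ≡ c ℕ.* b

module _ {a b} (ca : IsCyclotomic a) (cb : IsCyclotomic b) (0<a : 0 < a) (0<b : 0 < b) where

  -- With g = gcd a b, neither a nor b divides g, so Φ_a divides (X^a - 1)/(X^g - 1) and Φ_b divides
  -- (X^b - 1)/(X^g - 1). Dividing the Bézout relation for X^g - 1 by X^g - 1 leaves 1.
  Φ-comaximal-∤ : IsCyclotomic (gcd a b) → ¬ a ∣ b → ¬ b ∣ a →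
                  ∃₂ λ u v → u ⊠ Φ a ⊞ v ⊠ Φ b ≃ const 1ℤ
  Φ-comaximal-∤ cg a∤b b∤a
    with U , V , bezout ← X^n-1-gcd a b
    with w , eq ← Φ-cofactor ca cg 0<a (gcd[m,n]∣m a b) {a} ∣-refl (λ a∣g → a∤b (∣-trans a∣g (gcd[m,n]∣n a b)))
    with w′ , eq′ ← Φ-cofactor cb cg 0<b (gcd[m,n]∣n a b) {b} ∣-refl (λ b∣g → b∤a (∣-trans b∣g (gcd[m,n]∣m a b)))
    = U ⊠ w , V ⊠ w′ , ⊠-cancelˡ (Monic-X^n-1 (divisor-positive 0<a (gcd[m,n]∣m a b))) _ (const 1ℤ) (begin
        G ⊠ (U ⊠ w ⊠ Φ a ⊞ V ⊠ w′ ⊠ Φ b)                ≈⟨ regroup G U w (Φ a) V w′ (Φ b) ⟩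
        U ⊠ (G ⊠ (Φ a ⊠ w)) ⊞ V ⊠ (G ⊠ (Φ b ⊠ w′))      ≈⟨ ⊞-cong (⊠-cong (≃-refl {U}) eq) (⊠-cong (≃-refl {V}) eq′) ⟨
        U ⊠ X^n-1 a ⊞ V ⊠ X^n-1 b                       ≈⟨ bezout ⟩
        G                                               ≈⟨ ⊠-identityˡ G ⟨
        const 1ℤ ⊠ G                                    ≈⟨ ⊠-comm (const 1ℤ) G ⟩
        G ⊠ const 1ℤ                                    ∎)
    where
    open ≃-Reasoning
    G = X^n-1 (gcd a b)
    regroup : ∀ G U w A V w′ B → G ⊠ (U ⊠ w ⊠ A ⊞ V ⊠ w′ ⊠ B) ≃ U ⊠ (G ⊠ (A ⊠ w)) ⊞ V ⊠ (G ⊠ (B ⊠ w′))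
    regroup = solve-∀ ℤ[X]-acr

  -- Φ_b divides (X^b - 1)/(X^a - 1), which is c modulo X^a - 1, and Φ_a divides X^a - 1.
  Φ-comaximal-∣ : ∀ c → b ≡ c ℕ.* a → ¬ b ∣ a → ∃₂ λ u v → u ⊠ Φ a ⊞ v ⊠ Φ b ≃ const (+ c)
  Φ-comaximal-∣ c b≡ b∤a
    with w , eq ← Φ-cofactor cb ca 0<b (divides c b≡) {b} ∣-refl b∤a
    with y , a≃ ← Φ∣X^n-1 {a} ca 0<a ∣-refl
    with Q , geo≃ ← geo-≡-const c a
    = ([] ⊟ y ⊠ Q) , w , (begin
        ([] ⊟ y ⊠ Q) ⊠ Φ a ⊞ w ⊠ Φ b              ≈⟨ regroup y Q (Φ a) w (Φ b) ⟩
        Φ b ⊠ w ⊟ (Φ a ⊠ y) ⊠ Q                   ≈⟨ ⊞-cong (≃-sym geo≃Φ) (·-cong (-ᶻ 1ℤ) (⊠-cong (≃-sym a≃) (≃-refl {Q}))) ⟩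
        geo c a ⊟ X^n-1 a ⊠ Q                     ≈⟨ ⊞-cong geo≃ (≃-refl {(-ᶻ 1ℤ) · (X^n-1 a ⊠ Q)}) ⟩
        (const (+ c) ⊞ X^n-1 a ⊠ Q) ⊟ X^n-1 a ⊠ Q ≈⟨ cancel (const (+ c)) (X^n-1 a ⊠ Q) ⟩
        const (+ c)                               ∎)
    where
    open ≃-Reasoning
    geo≃Φ : geo c a ≃ Φ b ⊠ w
    geo≃Φ = ⊠-cancelˡ (Monic-X^n-1 0<a) (geo c a) (Φ b ⊠ w)
      (≃-trans (X^n-1-⊠-geo c a) (subst (λ k → X^n-1 k ≃ X^n-1 a ⊠ (Φ b ⊠ w)) b≡ eq))
    regroup : ∀ y Q A w B → ([] ⊟ y ⊠ Q) ⊠ A ⊞ w ⊠ B ≃ B ⊠ w ⊟ (A ⊠ y) ⊠ Q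
    regroup = solve-∀ ℤ[X]-acr
    cancel : ∀ c z → (c ⊞ z) ⊟ z ≃ c
    cancel = solve-∀ ℤ[X]-acr

∣-antisym-≢ : ∀ {a b} → a ≢ b → a ∣ b → ¬ b ∣ a
∣-antisym-≢ a≢b a∣b b∣a = a≢b (∣-antisym a∣b b∣a)

Φ-comaximal : ∀ {a b} → IsCyclotomic a → IsCyclotomic b → IsCyclotomic (gcd a b) → 0 < a → 0 < b → a ≢ b →
              ∃ λ c → PairScalar a b c × ∃₂ λ u v → u ⊠ Φ a ⊞ v ⊠ Φ b ≃ const (+ c)
Φ-comaximal {a} {b} ca cb cg 0<a 0<b a≢b = go (a ∣? b) (b ∣? a)
  where
  go : Dec (a ∣ b) → Dec (b ∣ a) → ∃ λ c → PairScalar a b c × ∃₂ λ u v → u ⊠ Φ a ⊞ v ⊠ Φ b ≃ const (+ c)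
  go (yes (divides c b≡)) _ =
    c , inj₂ (inj₁ b≡) , Φ-comaximal-∣ ca cb 0<a 0<b c b≡ (∣-antisym-≢ a≢b (divides c b≡))
  go (no _) (yes (divides c a≡)) =
    let u , v , eq = Φ-comaximal-∣ cb ca 0<b 0<a c a≡ (∣-antisym-≢ (a≢b ∘ sym) (divides c a≡)) in
    c , inj₂ (inj₂ a≡) , v , u , ≃-trans (⊞-comm (v ⊠ Φ a) (u ⊠ Φ b)) eq
  go (no a∤b) (no b∤a) = 1 , inj₁ refl , Φ-comaximal-∤ ca cb 0<a 0<b cg a∤b b∤a

PairScalar-≢0 : ∀ {a b c} → 0 < a → 0 < b → PairScalar a b c → c ≢ 0
PairScalar-≢0 0<a 0<b (inj₁ refl)        ()
PairScalar-≢0 0<a 0<b (inj₂ (inj₁ refl)) refl = ℕ.<-irrefl refl 0<b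
PairScalar-≢0 0<a 0<b (inj₂ (inj₂ refl)) refl = ℕ.<-irrefl refl 0<a

module _ {n} (0<n : 0 < n) (ih : ∀ {d} → d < n → 0 < d → IsCyclotomic d) where

  private
    -- With π = 0, membership is divisibility by P, and nonzero scalars cancel since P is monic.
    open CRT [] (_≢ 0ℤ)
    D = properDivisors n

    D-positive : ∀ {d} → d ∈ D → 0 < d
    D-positive d∈ = divisor-positive 0<n (proj₂ (∈-properDivisors⁻ d∈))

    D-cyclotomic : ∀ {d} → d ∈ D → IsCyclotomic d
    D-cyclotomic d∈ = ih (proj₁ (∈-properDivisors⁻ d∈)) (D-positive d∈)

    monics : All IsMonic (map Φ D)
    monics = All.map⁺ (All.tabulate λ {d} d∈ → φ d , Monic-Φ (D-cyclotomic d∈))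

    comaximal : ∀ {d e} → d ∈ D → e ∈ D → d ≢ e → Comaximal (Φ d) (Φ e)
    comaximal {d} {e} d∈ e∈ d≢e =
      let c , pair , u , v , eq = Φ-comaximal (D-cyclotomic d∈) (D-cyclotomic e∈)
             (ih (ℕ.≤-<-trans (∣⇒≤ {{>-nonZero (D-positive d∈)}} (gcd[m,n]∣m d e)) (proj₁ (∈-properDivisors⁻ d∈)))
                 (divisor-positive (D-positive d∈) (gcd[m,n]∣m d e)))
             (D-positive d∈) (D-positive e∈) d≢e in
      + c , (λ c≡0 → PairScalar-≢0 (D-positive d∈) (D-positive e∈) pair (ℤ.+-injective c≡0)) , u , v , eq

    divides-X^n-1 : All (X^n-1 n ∈⟨π,_⟩) (map Φ D)
    divides-X^n-1 = All.map⁺ (All.tabulate λ {d} d∈ → member d∈ (∈-properDivisors⁻ d∈))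
      where
      member : ∀ {d} → d ∈ D → d < n × d ∣ n → X^n-1 n ∈⟨π, Φ d ⟩
      member {d} d∈ (d<n , divides k n≡)
        = let w , eq = Φ∣X^n-1 {d} (D-cyclotomic d∈) (D-positive d∈) ∣-refl in
          [] , w ⊠ geo k d , ≃-trans
            (subst (λ m → X^n-1 m ≃ X^n-1 d ⊠ geo k d) (sym n≡) (≃-sym (X^n-1-⊠-geo k d)))
            (≃-trans (⊠-cong eq (≃-refl {geo k d})) (⊠-assoc (Φ d) w (geo k d)))

    saturated : ∀ {a P} f → a ≢ 0ℤ → IsMonic P → (const a ⊠ f) ∈⟨π, P ⟩ → f ∈⟨π, P ⟩
    saturated f a≢0 (_ , mP) (_ , r , eq) = [] , monic-saturated mP a≢0 f r eq

    ∏Φ-D∣ : X^n-1 n ∈⟨π, ∏Φ D ⟩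
    ∏Φ-D∣ = crt (λ ()) (λ a≢0 b≢0 ab≡0 → case-zero a≢0 b≢0 (ℤ.i*j≡0⇒i≡0∨j≡0 _ ab≡0)) saturated
              (X^n-1 n) monics (Unique⇒AllPairs-map D (properDivisors-unique n) comaximal) divides-X^n-1
      where
      case-zero : ∀ {a b : ℤ} → a ≢ 0ℤ → b ≢ 0ℤ → ¬ (a ≡ 0ℤ ⊎ b ≡ 0ℤ)
      case-zero a≢0 b≢0 (inj₁ a≡0) = a≢0 a≡0
      case-zero a≢0 b≢0 (inj₂ b≡0) = b≢0 b≡0

    Monic-∏Φ : ∀ ds → (∀ {d} → d ∈ ds → Monic (φ d) (Φ d)) → Monic (sum (map φ ds)) (∏Φ ds)
    Monic-∏Φ []       _ = Monic-1
    Monic-∏Φ (d ∷ ds) m = Monic-⊠ (m (here refl)) (Monic-∏Φ ds (m ∘ there))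

  isCyclotomic-step : IsCyclotomic n
  isCyclotomic-step = record
    { Monic-Φ     = Monic-resp (≃-sym Φ≃r) (subst (λ l → Monic l r) l≡φn mr)
    ; ∏Φ-divisors = ≃-trans (≃-sym (∏Φ-↭ (n∷properDivisors 0<n)))
        (≃-trans (⊠-cong Φ≃r (≃-refl {∏Φ D})) (≃-trans (⊠-comm r (∏Φ D)) (≃-sym eq)))
    }
    where
    r = proj₁ (proj₂ ∏Φ-D∣)
    eq : X^n-1 n ≃ ∏Φ D ⊠ r
    eq = proj₂ (proj₂ ∏Φ-D∣)
    mD : Monic (sum (map φ D)) (∏Φ D)
    mD = Monic-∏Φ D λ d∈ → Monic-Φ (D-cyclotomic d∈)
    Φ≃r : Φ n ≃ r
    Φ≃r = subst (_≃ r) (sym (Φ-unfold n)) (÷-exact (X^n-1 n) r mD eq)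
    quotient : ∃ λ l → n ≡ sum (map φ D) ℕ.+ l × Monic l r
    quotient = Monic-quotient r mD (Monic-resp eq (Monic-X^n-1 0<n))
    l = proj₁ quotient
    mr = proj₂ (proj₂ quotient)
    -- The degree of the quotient is n minus the sum of φ d over the proper divisors, which is φ n
    -- as the sum over all divisors is n.
    l≡φn : l ≡ φ n
    l≡φn = ℕ.+-cancelʳ-≡ (sum (map φ D)) l (φ n) (begin
      l ℕ.+ sum (map φ D)       ≡⟨ ℕ.+-comm l _ ⟩
      sum (map φ D) ℕ.+ l       ≡⟨ proj₁ (proj₂ quotient) ⟨
      n                         ≡⟨ sum-φ-divisors n ⟨
      sum (map φ (divisors n))  ≡⟨ sum-↭ (Perm.map⁺ φ (n∷properDivisors 0<n)) ⟨
      φ n ℕ.+ sum (map φ D)     ∎)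
      where open ≡-Reasoning

isCyclotomic : ∀ {n} → 0 < n → IsCyclotomic n
isCyclotomic {n} = <-rec (λ n → 0 < n → IsCyclotomic n)
  (λ n ih 0<n → isCyclotomic-step 0<n (λ d<n → ih d<n)) n

-- Polynomials in (p^t) + (Φ d) for all d ∣ n

_∈⟨_,_⟩ : Poly → ℕ → Poly → Set
f ∈⟨ c , P ⟩ = CRT._∈⟨π,_⟩ (const (+ c)) (λ _ → ℤ) f P

-- m p^s, by recursion so that the step from s to s + 1 is definitionally a factor p, the form in
-- which `X^n-1-⊠-geo` applies.
scaledPower : ℕ → ℕ → ℕ → ℕ
scaledPower p m zero    = m
scaledPower p m (suc s) = p ℕ.* scaledPower p m s

-- m p^(α - t), or 0 once t exceeds α.
codegree : ℕ → ℕ → ℕ → ℕ → ℕ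
codegree p m α       zero    = scaledPower p m α
codegree p m zero    (suc t) = 0
codegree p m (suc α) (suc t) = codegree p m α t

-- The indices s, α number the powers of the prime p = 1 + c, so that the
-- polynomials X^(m p^s) - 1 and their successive quotients can be handled
-- without division.
module _ (c m : ℕ) (p-prime : Prime (suc c)) (p∤m : ¬ suc c ∣ m) (0<m : 0 < m) where

  private
    p = suc c

  private
    e : ℕ → ℕ
    e = scaledPower p m

    0<e : ∀ s → 0 < e s
    0<e zero    = 0<m
    0<e (suc s) = ℕ.<-≤-trans (0<e s) (ℕ.m≤m+n (e s) _)

    e∣e : ∀ {s} α → s ≤ α → e s ∣ e α
    e∣e {s} α s≤α with ℕ.m≤n⇒m<n∨m≡n s≤α
    e∣e zero    s≤α | inj₁ ()
    e∣e (suc α) s≤α | inj₁ (s≤s s≤α′) = ∣-trans (e∣e α s≤α′) (n∣m*n p)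
    ... | inj₂ refl = ∣-refl

  G : ℕ → Poly
  G zero    = X^n-1 m
  G (suc s) = geo p (e s)

  degG : ℕ → ℕ
  degG zero    = m
  degG (suc s) = c ℕ.* e s

  Monic-G : ∀ s → Monic (degG s) (G s)
  Monic-G zero    = Monic-X^n-1 0<m
  Monic-G (suc s) = Monic-geo c (0<e s)

  G∣X^n-1 : ∀ {s} α → s ≤ α → ∃ λ w → X^n-1 (e α) ≃ G s ⊠ w
  G∣X^n-1 {s} α s≤α with ℕ.m≤n⇒m<n∨m≡n s≤α
  G∣X^n-1 zero    s≤α | inj₁ ()
  G∣X^n-1 {s} (suc α) s≤α | inj₁ (s≤s s≤α′) with w , eq ← G∣X^n-1 {s} α s≤α′ =
    w ⊠ geo p (e α) , ≃-trans (≃-sym (X^n-1-⊠-geo p (e α)))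
      (≃-trans (⊠-cong eq (≃-refl {geo p (e α)})) (⊠-assoc (G s) w (geo p (e α))))
  G∣X^n-1 zero    s≤α | inj₂ refl = const 1ℤ ,
    ≃-sym (≃-trans (⊠-comm (X^n-1 m) (const 1ℤ)) (⊠-identityˡ (X^n-1 m)))
  G∣X^n-1 (suc α) s≤α | inj₂ refl = X^n-1 (e α) ,
    ≃-trans (≃-sym (X^n-1-⊠-geo p (e α))) (⊠-comm (X^n-1 (e α)) (geo p (e α)))

  -- All indices in zs have the same p-part, hence the last clause.
  G-factors : ∀ s → ∃ λ zs → Unique zs × (∀ {z} → z ∈ zs → z ∣ e s) × ∏Φ zs ≃ G s ×
              (∀ {z} k → z ∈ zs → k ℕ.* z ∈ zs → ¬ p ∣ k)
  G-factors zero = divisors m , divisors-unique m , ∈-divisors⁻ , ∏Φ-divisors (isCyclotomic 0<m) ,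
    λ {z} k z∈ kz∈ p∣k → p∤m (∣-trans p∣k (∣-trans (m∣m*n z) (∈-divisors⁻ kz∈)))
  G-factors (suc s) =
    let zs , u , to , _ , eq = X^n-1-quotient {e (suc s)} {e s} (isCyclotomic (0<e (suc s)))
                                 (isCyclotomic (0<e s)) (0<e (suc s)) (n∣m*n p)
    in zs , u , proj₁ ∘ to ,
      ⊠-cancelˡ (Monic-X^n-1 (0<e s)) (∏Φ zs) (G (suc s))
        (≃-trans (≃-sym eq) (≃-sym (X^n-1-⊠-geo p (e s)))) ,
      ratio-∤ (proj₂ ∘ to) (proj₁ ∘ to)
    where
    ratio-∤ : ∀ {zs} → (∀ {z} → z ∈ zs → ¬ z ∣ e s) → (∀ {z} → z ∈ zs → z ∣ e (suc s)) →
              ∀ {z} k → z ∈ zs → k ℕ.* z ∈ zs → ¬ p ∣ k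
    -- If k = k′ p, then k′ p z ∣ p `e s` gives k′ z ∣ `e s`, so z ∣ `e s`, which is excluded.
    ratio-∤ ∤e ∣pe {z} k z∈ kz∈ (divides k′ refl) = ∤e z∈ (∣-trans (n∣m*n k′)
      (*-cancelˡ-∣ p (subst (_∣ p ℕ.* e s) shuffle (∣pe kz∈))))
      where
      shuffle : k′ ℕ.* p ℕ.* z ≡ p ℕ.* (k′ ℕ.* z)
      shuffle = trans (cong (ℕ._* z) (ℕ.*-comm k′ p)) (ℕ.*-assoc p k′ z)

  PrimeToP : ℤ → Set
  PrimeToP x = ∃ λ k → x ≡ + k × ¬ p ∣ k

  inverse-mod-p : ∀ k → ¬ p ∣ k → ∃₂ λ x y → x *ᶻ + k +ᶻ y *ᶻ + p ≡ 1ℤ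
  inverse-mod-p k p∤k = go (coprime-Bézout (prime∤⇒coprime p-prime p∤k))
    where
    cast : ∀ x y a b → 1 ℕ.+ y ℕ.* b ≡ x ℕ.* a → 1ℤ +ᶻ + y *ᶻ + b ≡ + x *ᶻ + a
    cast x y a b eq = trans (cong (1ℤ +ᶻ_) (sym (ℤ.pos-* y b))) (trans (cong (λ z → + z) eq) (ℤ.pos-* x a))
    cancel₁ : ∀ u v → (u +ᶻ v) +ᶻ -ᶻ v ≡ u
    cancel₁ = ℤSolver.solve-∀
    neg₁ : ∀ u v w → w +ᶻ -ᶻ u *ᶻ v ≡ w +ᶻ -ᶻ (u *ᶻ v)
    neg₁ = ℤSolver.solve-∀
    go : Bézout.Identity 1 k p → ∃₂ λ x y → x *ᶻ + k +ᶻ y *ᶻ + p ≡ 1ℤ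
    go (Bézout.+- x y eq) = + x , -ᶻ + y ,
      trans (neg₁ (+ y) (+ p) (+ x *ᶻ + k)) (trans (cong (_+ᶻ -ᶻ (+ y *ᶻ + p)) (sym (cast x y k p eq)))
        (cancel₁ 1ℤ (+ y *ᶻ + p)))
    go (Bézout.-+ x y eq) = -ᶻ + x , + y ,
      trans (ℤ.+-comm (-ᶻ + x *ᶻ + k) _) (trans (neg₁ (+ x) (+ k) (+ y *ᶻ + p))
        (trans (cong (_+ᶻ -ᶻ (+ x *ᶻ + k)) (sym (cast y x p k eq))) (cancel₁ 1ℤ (+ x *ᶻ + k))))

  -- The relations for p and for p^t are multiplied: every term of the product except y y′ p^(t+1)
  -- contains k.
  inverse-mod-p^ : ∀ t k → ¬ p ∣ k → ∃₂ λ x y → x *ᶻ + k +ᶻ y *ᶻ + (p ℕ.^ t) ≡ 1ℤ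
  inverse-mod-p^ zero    k p∤k = 0ℤ , 1ℤ , refl
  inverse-mod-p^ (suc t) k p∤k
    with x , y , eq ← inverse-mod-p k p∤k | x′ , y′ , eq′ ← inverse-mod-p^ t k p∤k
    = x″ x y x′ y′ , y *ᶻ y′ , trans (cong (λ z → x″ x y x′ y′ *ᶻ + k +ᶻ y *ᶻ y′ *ᶻ z) (ℤ.pos-* p (p ℕ.^ t)))
        (trans (expand x y x′ y′ (+ k) (+ p) (+ (p ℕ.^ t))) (cong₂ _*ᶻ_ eq eq′))
    where
    x″ : (x y x′ y′ : ℤ) → ℤ
    x″ x y x′ y′ = x *ᶻ (x′ *ᶻ + k +ᶻ y′ *ᶻ + (p ℕ.^ t)) +ᶻ y *ᶻ + p *ᶻ x′
    expand : ∀ x y x′ y′ k p q → (x *ᶻ (x′ *ᶻ k +ᶻ y′ *ᶻ q) +ᶻ y *ᶻ p *ᶻ x′) *ᶻ k +ᶻ y *ᶻ y′ *ᶻ (p *ᶻ q)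
             ≡ (x *ᶻ k +ᶻ y *ᶻ p) *ᶻ (x′ *ᶻ k +ᶻ y′ *ᶻ q)
    expand = ℤSolver.solve-∀

  module _ (t : ℕ) where

    private
      open CRT (const (+ (p ℕ.^ t))) PrimeToP
      π = const (+ (p ℕ.^ t))

      1-prime : PrimeToP 1ℤ
      1-prime = 1 , refl , λ p∣1 → ¬prime[1] (subst Prime (∣1⇒≡1 p∣1) p-prime)

      *-prime : ∀ {a b} → PrimeToP a → PrimeToP b → PrimeToP (a *ᶻ b)
      *-prime (k , refl , p∤k) (l , refl , p∤l) = k ℕ.* l , sym (ℤ.pos-* k l) , p∤kl
        where
        p∤kl : ¬ p ∣ k ℕ.* l
        p∤kl p∣kl with euclidsLemma k l p-prime p∣kl
        ... | inj₁ p∣k = p∤k p∣k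
        ... | inj₂ p∣l = p∤l p∣l

      saturated : ∀ {a P} f → PrimeToP a → IsMonic P → (const a ⊠ f) ∈⟨π, P ⟩ → f ∈⟨π, P ⟩
      saturated {a} {P} f (k , refl , p∤k) _ (q , r , eq) =
        -- From x k + y p^t = 1 follows f = x (k f) + p^t (y f), where k f lies in the ideal by
        -- assumption.
        let x , y , xy = inverse-mod-p^ t k p∤k in
        (const x ⊠ q ⊞ const y ⊠ f) , const x ⊠ r , (begin
          f                                                     ≈⟨ ⊠-identityˡ f ⟨
          const 1ℤ ⊠ f                                          ≈⟨ ⊠-cong (const-cong xy) (≃-refl {f}) ⟨
          const (x *ᶻ + k +ᶻ y *ᶻ + (p ℕ.^ t)) ⊠ f              ≈⟨ ⊠-cong (⊞-cong (·≃const⊠ x (const (+ k))) (·≃const⊠ y π)) (≃-refl {f}) ⟩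
          (const x ⊠ const (+ k) ⊞ const y ⊠ π) ⊠ f             ≈⟨ split (const x) (const (+ k)) (const y) π f ⟩
          const x ⊠ (const (+ k) ⊠ f) ⊞ π ⊠ (const y ⊠ f)       ≈⟨ ⊞-cong (⊠-cong (≃-refl {const x}) eq) (≃-refl {π ⊠ (const y ⊠ f)}) ⟩
          const x ⊠ (π ⊠ q ⊞ P ⊠ r) ⊞ π ⊠ (const y ⊠ f)         ≈⟨ collect (const x) π q P r (const y) f ⟩
          π ⊠ (const x ⊠ q ⊞ const y ⊠ f) ⊞ P ⊠ (const x ⊠ r)   ∎)
        where
        open ≃-Reasoning
        const-cong : ∀ {a b} → a ≡ b → const a ≃ const b
        const-cong refl = ≃-refl
        split : ∀ x k y π f → (x ⊠ k ⊞ y ⊠ π) ⊠ f ≃ x ⊠ (k ⊠ f) ⊞ π ⊠ (y ⊠ f)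
        split = solve-∀ ℤ[X]-acr
        collect : ∀ x π q P r y f → x ⊠ (π ⊠ q ⊞ P ⊠ r) ⊞ π ⊠ (y ⊠ f) ≃ π ⊠ (x ⊠ q ⊞ y ⊠ f) ⊞ P ⊠ (x ⊠ r)
        collect = solve-∀ ℤ[X]-acr

    -- Chinese remainder theorem over the factors Φ_z of G_s. Their comaximality scalars are 1 or
    -- quotients of two indices with equal p-part, hence invertible modulo p^t.
    ∈⟨p^t,G⟩ : ∀ s f → (∀ {d} → d ∣ e s → f ∈⟨ p ℕ.^ t , Φ d ⟩) → f ∈⟨ p ℕ.^ t , G s ⟩
    ∈⟨p^t,G⟩ s f f∈ =
      let q , r , eq = crt 1-prime *-prime saturated f (monics zs zs∣) (Unique⇒AllPairs-map zs u comaximal) (members zs zs∣) in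
      q , r , ≃-trans eq (⊞-cong (≃-refl {π ⊠ q}) (⊠-cong ∏≃G (≃-refl {r})))
      where
      zs = proj₁ (G-factors s)
      u = proj₁ (proj₂ (G-factors s))
      zs∣ : ∀ {z} → z ∈ zs → z ∣ e s
      zs∣ = proj₁ (proj₂ (proj₂ (G-factors s)))
      ∏≃G = proj₁ (proj₂ (proj₂ (proj₂ (G-factors s))))
      ratio-∤ : ∀ {z} k → z ∈ zs → k ℕ.* z ∈ zs → ¬ p ∣ k
      ratio-∤ = proj₂ (proj₂ (proj₂ (proj₂ (G-factors s))))
      monics : ∀ zs → (∀ {z} → z ∈ zs → z ∣ e s) → All IsMonic (map Φ zs)
      monics zs zs∣ = All.map⁺ (All.tabulate λ {z} z∈ →
        φ z , Monic-Φ (isCyclotomic (divisor-positive (0<e s) (zs∣ z∈))))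
      members : ∀ zs → (∀ {z} → z ∈ zs → z ∣ e s) → All (f ∈⟨π,_⟩) (map Φ zs)
      members zs zs∣ = All.map⁺ (All.tabulate λ z∈ → f∈ (zs∣ z∈))
      prime-scalar : ∀ {a b k} → a ∈ zs → b ∈ zs → PairScalar a b k → ¬ p ∣ k
      prime-scalar a∈ b∈ (inj₁ refl) p∣1 = ¬prime[1] (subst Prime (∣1⇒≡1 p∣1) p-prime)
      prime-scalar a∈ b∈ (inj₂ (inj₁ refl)) = ratio-∤ _ a∈ b∈
      prime-scalar a∈ b∈ (inj₂ (inj₂ refl)) = ratio-∤ _ b∈ a∈
      comaximal : ∀ {a b} → a ∈ zs → b ∈ zs → a ≢ b → Comaximal (Φ a) (Φ b)
      comaximal {a} {b} a∈ b∈ a≢b =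
        let 0<a = divisor-positive (0<e s) (zs∣ a∈)
            0<b = divisor-positive (0<e s) (zs∣ b∈)
            k , pair , u , v , eq = Φ-comaximal (isCyclotomic 0<a) (isCyclotomic 0<b)
              (isCyclotomic (divisor-positive 0<a (gcd[m,n]∣m a b))) 0<a 0<b a≢b
        in + k , (k , refl , prime-scalar a∈ b∈ pair) , u , v , eq

  private
    const-p^ : ∀ t → const (+ (p ℕ.^ suc t)) ≃ const (+ p) ⊠ const (+ (p ℕ.^ t))
    const-p^ t = ≃-trans (∷-cong (ℤ.pos-* p (p ℕ.^ t)) ≃-refl) (·≃const⊠ (+ p) (const (+ (p ℕ.^ t))))

    -- G_(α+1) is p modulo X^(m p^α) - 1, and G_s divides that polynomial.
    G≡p : ∀ {s} α → s ≤ α → ∃ λ Q → G (suc α) ≃ const (+ p) ⊞ G s ⊠ Q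
    G≡p {s} α s≤α =
      let Q , eq = geo-≡-const p (e α)
          w , eq′ = G∣X^n-1 α s≤α
      in w ⊠ Q , ≃-trans eq (⊞-cong (≃-refl {const (+ p)})
           (≃-trans (⊠-cong eq′ (≃-refl {Q})) (⊠-assoc (G s) w Q)))

    -- Since G (suc α) ≡ p modulo G s, one factor p can be cancelled.
    cofactor∈ : ∀ {s} α t {f q r} → s ≤ α → f ≃ const (+ (p ℕ.^ suc t)) ⊠ q ⊞ G (suc α) ⊠ r →
                f ∈⟨ p ℕ.^ suc t , G s ⟩ → r ∈⟨ p ℕ.^ t , G s ⟩
    cofactor∈ {s} α t {f} {q} {r} s≤α f≃ (qₛ , rₛ , f≃ₛ) =
      let Q , G≃ = G≡p α s≤α
          -- Equating the two expressions for f and inserting G_(α+1) = p + G_s Q gives p (r - p^t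
          -- (qₛ - q)) = G_s (rₛ - Q r); then p is cancelled modulo G_s.
          s′ , eq = monic-saturated {c = + p} (Monic-G s) (λ ()) (r ⊟ πₜ ⊠ (qₛ ⊟ q)) (rₛ ⊟ Q ⊠ r)
                      (cancelled Q G≃)
      in (qₛ ⊟ q) , s′ , ≃-trans (restore r (πₜ ⊠ (qₛ ⊟ q))) (⊞-cong (≃-refl {πₜ ⊠ (qₛ ⊟ q)}) eq)
      where
      open ≃-Reasoning
      πₜ = const (+ (p ℕ.^ t))
      P = const (+ p)
      restore : ∀ r z → r ≃ z ⊞ (r ⊟ z)
      restore = solve-∀ ℤ[X]-acr
      regroup : ∀ P π q qₛ r Gs Q → P ⊠ (r ⊟ π ⊠ (qₛ ⊟ q)) ≃
                ((P ⊠ π) ⊠ q ⊞ (P ⊞ Gs ⊠ Q) ⊠ r) ⊟ (P ⊠ π) ⊠ qₛ ⊟ Gs ⊠ (Q ⊠ r)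
      regroup = solve-∀ ℤ[X]-acr
      collect : ∀ x Gs rₛ y → (x ⊞ Gs ⊠ rₛ) ⊟ x ⊟ Gs ⊠ y ≃ Gs ⊠ (rₛ ⊟ y)
      collect = solve-∀ ℤ[X]-acr
      cancelled : ∀ Q → G (suc α) ≃ P ⊞ G s ⊠ Q → P ⊠ (r ⊟ πₜ ⊠ (qₛ ⊟ q)) ≃ G s ⊠ (rₛ ⊟ Q ⊠ r)
      cancelled Q G≃ = begin
        P ⊠ (r ⊟ πₜ ⊠ (qₛ ⊟ q))
          ≈⟨ regroup P πₜ q qₛ r (G s) Q ⟩
        ((P ⊠ πₜ) ⊠ q ⊞ (P ⊞ G s ⊠ Q) ⊠ r) ⊟ (P ⊠ πₜ) ⊠ qₛ ⊟ G s ⊠ (Q ⊠ r)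
          ≈⟨ ⊞-cong (⊞-cong (⊞-cong (⊠-cong (const-p^ t) (≃-refl {q})) (⊠-cong G≃ (≃-refl {r})))
               (≃-refl {(-ᶻ 1ℤ) · ((P ⊠ πₜ) ⊠ qₛ)})) (≃-refl {(-ᶻ 1ℤ) · (G s ⊠ (Q ⊠ r))}) ⟨
        (const (+ (p ℕ.^ suc t)) ⊠ q ⊞ G (suc α) ⊠ r) ⊟ (P ⊠ πₜ) ⊠ qₛ ⊟ G s ⊠ (Q ⊠ r)
          ≈⟨ ⊞-cong (⊞-cong (≃-trans (≃-sym f≃) (≃-trans f≃ₛ (⊞-cong (⊠-cong (const-p^ t) (≃-refl {qₛ})) (≃-refl {G s ⊠ rₛ}))))
               (≃-refl {(-ᶻ 1ℤ) · ((P ⊠ πₜ) ⊠ qₛ)})) (≃-refl {(-ᶻ 1ℤ) · (G s ⊠ (Q ⊠ r))}) ⟩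
        ((P ⊠ πₜ) ⊠ qₛ ⊞ G s ⊠ rₛ) ⊟ (P ⊠ πₜ) ⊠ qₛ ⊟ G s ⊠ (Q ⊠ r)
          ≈⟨ collect ((P ⊠ πₜ) ⊠ qₛ) (G s) rₛ (Q ⊠ r) ⟩
        G s ⊠ (rₛ ⊟ Q ⊠ r) ∎

  -- K is the product of the t topmost G. For t = α + 1 the product reaches down to G_0, so that K
  -- is X^n - 1, of full degree n = m p^α; this matches the value 0 of `codegree`.
  p-adic-factor : ∀ α t f → t ≤ suc α → (∀ s → s ≤ α → f ∈⟨ p ℕ.^ t , G s ⟩) →
                  ∃₂ λ K k → Monic k K × k ℕ.+ codegree p m α t ≡ e α × f ∈⟨ p , K ⟩
  p-adic-factor α zero f _ _ = const 1ℤ , 0 , Monic-1 , refl , [] , f ,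
    ≃-sym (≃-trans (⊞-cong (⊠-zeroʳ (const (+ p))) (⊠-identityˡ f)) ≃-refl)
  p-adic-factor zero (suc zero) f _ f∈ = let q , r , eq = f∈ 0 z≤n in
    G 0 , m , Monic-G 0 , ℕ.+-identityʳ m , q , r ,
    ≃-trans eq (⊞-cong (⊠-cong p^1 (≃-refl {q})) (≃-refl {G 0 ⊠ r}))
    where
    p^1 : const (+ (p ℕ.^ 1)) ≃ const (+ p)
    p^1 = ∷-cong (cong +_ (ℕ.*-identityʳ p)) (≃-refl {[]})
  p-adic-factor zero (suc (suc t)) f (s≤s ()) _
  p-adic-factor (suc α) (suc t) f (s≤s t≤) f∈ =
    let q , r , eq = f∈ (suc α) ℕ.≤-refl
        K , k , mK , k+N , q′ , r′ , eq′ = p-adic-factor α t r t≤ λ s s≤α →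
          cofactor∈ α t s≤α eq (f∈ s (ℕ.m≤n⇒m≤1+n s≤α))
    in G (suc α) ⊠ K , degG (suc α) ℕ.+ k , Monic-⊠ (Monic-G (suc α)) mK , degrees k k+N ,
       (const (+ (p ℕ.^ t)) ⊠ q ⊞ G (suc α) ⊠ q′) , r′ , (begin
         f                                                       ≈⟨ eq ⟩
         const (+ (p ℕ.^ suc t)) ⊠ q ⊞ G (suc α) ⊠ r             ≈⟨ ⊞-cong (⊠-cong (const-p^ t) (≃-refl {q})) (⊠-cong (≃-refl {G (suc α)}) eq′) ⟩
         (const (+ p) ⊠ const (+ (p ℕ.^ t))) ⊠ q ⊞ G (suc α) ⊠ (const (+ p) ⊠ q′ ⊞ K ⊠ r′)
           ≈⟨ regroup (const (+ p)) (const (+ (p ℕ.^ t))) q (G (suc α)) q′ K r′ ⟩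
         const (+ p) ⊠ (const (+ (p ℕ.^ t)) ⊠ q ⊞ G (suc α) ⊠ q′) ⊞ (G (suc α) ⊠ K) ⊠ r′ ∎)
    where
    open ≃-Reasoning
    regroup : ∀ P π q G q′ K r′ → (P ⊠ π) ⊠ q ⊞ G ⊠ (P ⊠ q′ ⊞ K ⊠ r′) ≃ P ⊠ (π ⊠ q ⊞ G ⊠ q′) ⊞ (G ⊠ K) ⊠ r′
    regroup = solve-∀ ℤ[X]-acr
    degrees : ∀ k → k ℕ.+ codegree p m α t ≡ e α → c ℕ.* e α ℕ.+ k ℕ.+ codegree p m α t ≡ p ℕ.* e α
    degrees k eq = trans (ℕ.+-assoc (c ℕ.* e α) k _) (trans (cong (c ℕ.* e α ℕ.+_) eq) (ℕ.+-comm (c ℕ.* e α) (e α)))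

  -- Modulo p, f = K r with K monic of degree k, so r vanishes modulo p once the coefficients of f
  -- from k on do. For f of degree below n this bounds the dimension from above: f modulo p is
  -- determined by its coefficients at k, ..., n - 1, which are `codegree` many.
  top-coeffs-determine : ∀ α t f → t ≤ suc α → (∀ {d} → d ∣ e α → f ∈⟨ p ℕ.^ t , Φ d ⟩) →
                         ∀ k → k ℕ.+ codegree p m α t ≡ e α →
                         (∀ j → k ≤ j → + p ∣ᶻ coeff f j) → ∀ j → + p ∣ᶻ coeff f j
  top-coeffs-determine α t f t≤ f∈ k k+N p∣top j =
    let K , k′ , mK , k′+N , q , r , eq = p-adic-factor α t f t≤ λ s s≤α →
          ∈⟨p^t,G⟩ t s f λ d∣ → f∈ (∣-trans d∣ (e∣e α s≤α))
        k≡k′ = ℕ.+-cancelʳ-≡ (codegree p m α t) k k′ (trans k+N (sym k′+N))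
        p∣ = λ j → ∣-coeff-const⊠ (+ p) q j
        p∣Kr = λ j k+0≤j → ∣m+n∣m⇒∣n (∣ᶻ-resp (trans (coeff-≡ eq j) (coeff-⊞ (const (+ p) ⊠ q) (K ⊠ r) j))
                 (p∣top j (subst (_≤ j) (trans (ℕ.+-identityʳ k′) (sym k≡k′)) k+0≤j))) (p∣ j)
        p∣r = λ i → monic-∣ mK r 0 p∣Kr i z≤n
    in ∣ᶻ-resp (sym (trans (coeff-≡ eq j) (coeff-⊞ (const (+ p) ⊠ q) (K ⊠ r) j)))
         (∣m∣n⇒∣m+n (p∣ j) (∣-coeff-⊠ K r p∣r j))

-- Multiples of (X^n - 1)/(X^N - 1)

geo∈ : ∀ q {N d} → 0 < N → 0 < q → d ∣ q ℕ.* N → geo q N ∈⟨ q , Φ d ⟩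
geo∈ q {N} {d} 0<N 0<q d∣n = go (d ∣? N)
  where
  0<n : 0 < q ℕ.* N
  0<n = ℕ.*-mono-≤ 0<q 0<N
  go : Dec (d ∣ N) → geo q N ∈⟨ q , Φ d ⟩
  go (yes d∣N) =
    let Q , eq = geo-≡-const q N
        w , eq′ = Φ∣X^n-1 (isCyclotomic 0<N) 0<N d∣N
    in const 1ℤ , w ⊠ Q , ≃-trans eq (⊞-cong
         (≃-trans (≃-sym (⊠-identityˡ (const (+ q)))) (⊠-comm (const 1ℤ) (const (+ q))))
         (≃-trans (⊠-cong eq′ (≃-refl {Q})) (⊠-assoc (Φ d) w Q)))
  go (no d∤N) =
    let w , eq = Φ-cofactor (isCyclotomic 0<n) (isCyclotomic 0<N) 0<n (n∣m*n q) d∣n d∤N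
    in [] , w , ≃-trans
         (⊠-cancelˡ (Monic-X^n-1 0<N) (geo q N) (Φ d ⊠ w) (≃-trans (X^n-1-⊠-geo q N) eq))
         (≃-sym (⊞-cong (⊠-zeroʳ (const (+ q))) (≃-refl {Φ d ⊠ w})))

multiple-∈ : ∀ {q P f} g → f ∈⟨ q , P ⟩ → (g ⊠ f) ∈⟨ q , P ⟩
multiple-∈ {q} {P} {f} g (u , v , eq) =
  g ⊠ u , g ⊠ v , ≃-trans (⊠-cong (≃-refl {g}) eq) (expand g (const (+ q)) u P v)
  where
  expand : ∀ g c u P v → g ⊠ (c ⊠ u ⊞ P ⊠ v) ≃ c ⊠ (g ⊠ u) ⊞ P ⊠ (g ⊠ v)
  expand = solve-∀ ℤ[X]-acr

coeff-X^⊠-< : ∀ N f {j} → j < N → coeff (X^ N ⊠ f) j ≡ 0ℤ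
coeff-X^⊠-< (suc N) f {zero}  _         = coeff-≡ (0∷-⊠ (X^ N) f) 0
coeff-X^⊠-< (suc N) f {suc j} (s≤s j<N) = trans (coeff-≡ (0∷-⊠ (X^ N) f) (suc j)) (coeff-X^⊠-< N f j<N)

coeff-X^⊠-+ : ∀ N f j → coeff (X^ N ⊠ f) (N ℕ.+ j) ≡ coeff f j
coeff-X^⊠-+ zero    f j = coeff-≡ (⊠-identityˡ f) j
coeff-X^⊠-+ (suc N) f j = trans (coeff-≡ (0∷-⊠ (X^ N) f) (suc (N ℕ.+ j))) (coeff-X^⊠-+ N f j)

⊠-geo-suc : ∀ f c N → f ⊠ geo (suc c) N ≃ f ⊞ X^ N ⊠ (f ⊠ geo c N)
⊠-geo-suc f c N = ≃-trans (expand f (X^ 0) (X^ N) (geo c N))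
  (⊞-cong (⊠-identityˡ f) (≃-refl {X^ N ⊠ (f ⊠ geo c N)}))
  where
  expand : ∀ f e x g → f ⊠ (e ⊞ x ⊠ g) ≃ e ⊠ f ⊞ x ⊠ (f ⊠ g)
  expand = solve-∀ ℤ[X]-acr

-- The summands after the first are shifted by at least N. Hence f of degree below N can be read off
-- from its multiple, also modulo p.
coeff-⊠-geo-low : ∀ f c {N j} → j < N → coeff (f ⊠ geo (suc c) N) j ≡ coeff f j
coeff-⊠-geo-low f c {N} {j} j<N = begin
  coeff (f ⊠ geo (suc c) N) j                       ≡⟨ coeff-≡ (⊠-geo-suc f c N) j ⟩
  coeff (f ⊞ X^ N ⊠ (f ⊠ geo c N)) j                ≡⟨ coeff-⊞ f _ j ⟩
  coeff f j +ᶻ coeff (X^ N ⊠ (f ⊠ geo c N)) j       ≡⟨ cong (coeff f j +ᶻ_) (coeff-X^⊠-< N (f ⊠ geo c N) j<N) ⟩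
  coeff f j +ᶻ 0ℤ                                   ≡⟨ ℤ.+-identityʳ _ ⟩
  coeff f j                                         ∎
  where open ≡-Reasoning

coeff-⊠-geo-high : ∀ f c {N} → (∀ j → N ≤ j → coeff f j ≡ 0ℤ) →
                   ∀ j → c ℕ.* N ≤ j → coeff (f ⊠ geo c N) j ≡ 0ℤ
coeff-⊠-geo-high f zero    f0 j _  = coeff-≡ (⊠-zeroʳ f) j
coeff-⊠-geo-high f (suc c) {N} f0 j le = begin
  coeff (f ⊠ geo (suc c) N) j                       ≡⟨ coeff-≡ (⊠-geo-suc f c N) j ⟩
  coeff (f ⊞ X^ N ⊠ (f ⊠ geo c N)) j                ≡⟨ coeff-⊞ f _ j ⟩
  coeff f j +ᶻ coeff (X^ N ⊠ (f ⊠ geo c N)) j       ≡⟨ cong₂ _+ᶻ_ (f0 j N≤j) shifted ⟩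
  0ℤ                                                ∎
  where
  open ≡-Reasoning
  N≤j : N ≤ j
  N≤j = ℕ.≤-trans (ℕ.m≤m+n N _) le
  i = j ℕ.∸ N
  j≡ : N ℕ.+ i ≡ j
  j≡ = ℕ.m+[n∸m]≡n N≤j
  shifted : coeff (X^ N ⊠ (f ⊠ geo c N)) j ≡ 0ℤ
  shifted = trans (cong (coeff (X^ N ⊠ (f ⊠ geo c N))) (sym j≡))
    (trans (coeff-X^⊠-+ N (f ⊠ geo c N) i)
      (coeff-⊠-geo-high f c f0 i (ℕ.+-cancelˡ-≤ N _ _ (ℕ.≤-trans le (ℕ.≤-reflexive (sym j≡))))))

-- Smith normal form modulo prime powers

Vectorᶻ : ℕ → Set
Vectorᶻ n = Fin n → ℤ

infixl 6 _⊖_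
_⊖_ : ∀ {n} → Vectorᶻ n → Vectorᶻ n → Vectorᶻ n
(v ⊖ w) i = v i -ᶻ w i

∑-zero : ∀ {n} (f : Vectorᶻ n) → (∀ i → f i ≡ 0ℤ) → ∑ℤ f ≡ 0ℤ
∑-zero {zero}  f f0 = refl
∑-zero {suc n} f f0 = cong₂ _+ᶻ_ (f0 zero) (∑-zero (f ∘ suc) (f0 ∘ suc))

∑-single : ∀ {n} (f : Vectorᶻ n) j → (∀ i → i ≢ j → f i ≡ 0ℤ) → ∑ℤ f ≡ f j
∑-single {suc n} f zero    f0 = trans (cong (f zero +ᶻ_) (∑-zero (f ∘ suc) λ i → f0 (suc i) (λ ()))) (ℤ.+-identityʳ _)
∑-single {suc n} f (suc j) f0 =
  trans (cong₂ _+ᶻ_ (f0 zero (λ ())) (∑-single (f ∘ suc) j λ i i≢j → f0 (suc i) (i≢j ∘ Fin.suc-injective)))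
    (ℤ.+-identityˡ _)

∣-∑ : ∀ {c n} (f : Vectorᶻ n) → (∀ i → c ∣ᶻ f i) → c ∣ᶻ ∑ℤ f
∣-∑ {n = zero}  f c∣ = 0ᶻ∣ _
∣-∑ {n = suc n} f c∣ = ∣m∣n⇒∣m+n (c∣ zero) (∣-∑ (f ∘ suc) (c∣ ∘ suc))

infixr 7 _⊛_
_⊛_ : ∀ {m n} → Matrix m n → Vectorᶻ n → Vectorᶻ m
(A ⊛ v) i = ∑ℤ λ k → A i k *ᶻ v k

⊛-congˡ : ∀ {m n} {A B : Matrix m n} → A ≋ B → ∀ v i → (A ⊛ v) i ≡ (B ⊛ v) i
⊛-congˡ A≋B v i = sum-cong-≗ λ k → cong (_*ᶻ v k) (A≋B i k)

⊛-congʳ : ∀ {m n} (A : Matrix m n) {v w} → (∀ k → v k ≡ w k) → ∀ i → (A ⊛ v) i ≡ (A ⊛ w) i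
⊛-congʳ A v≡w i = sum-cong-≗ λ k → cong (A i k *ᶻ_) (v≡w k)

⊛-assoc : ∀ {l m n} (A : Matrix l m) (B : Matrix m n) v i → ((A ⊗ B) ⊛ v) i ≡ (A ⊛ B ⊛ v) i
⊛-assoc A B v i = begin
  (∑ℤ λ k → (∑ℤ λ j → A i j *ᶻ B j k) *ᶻ v k)     ≡⟨ sum-cong-≗ (λ k → *-distribʳ-sum (v k) (λ j → A i j *ᶻ B j k)) ⟩
  (∑ℤ λ k → ∑ℤ λ j → A i j *ᶻ B j k *ᶻ v k)       ≡⟨ ∑-comm (λ k j → A i j *ᶻ B j k *ᶻ v k) ⟩
  (∑ℤ λ j → ∑ℤ λ k → A i j *ᶻ B j k *ᶻ v k)       ≡⟨ sum-cong-≗ (λ j → sum-cong-≗ (λ k → ℤ.*-assoc (A i j) (B j k) (v k))) ⟩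
  (∑ℤ λ j → ∑ℤ λ k → A i j *ᶻ (B j k *ᶻ v k))     ≡⟨ sum-cong-≗ (λ j → *-distribˡ-sum (A i j) (λ k → B j k *ᶻ v k)) ⟨
  (∑ℤ λ j → A i j *ᶻ (∑ℤ λ k → B j k *ᶻ v k))     ∎
  where open ≡-Reasoning

⊛-diag : ∀ {n} (a : Vectorᶻ n) v i → (diag a ⊛ v) i ≡ a i *ᶻ v i
⊛-diag a v i = trans (∑-single (λ k → diag a i k *ᶻ v k) i off) (cong (_*ᶻ v i) on)
  where
  on : diag a i i ≡ a i
  on = cong (λ b → if b then a i else 0ℤ) (dec-true (toℕ i ℕ.≟ toℕ i) refl)
  off : ∀ k → k ≢ i → diag a i k *ᶻ v k ≡ 0ℤ
  off k k≢i = cong (λ b → (if b then a i else 0ℤ) *ᶻ v k)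
    (dec-false (toℕ i ℕ.≟ toℕ k) (k≢i ∘ Fin.toℕ-injective ∘ sym))

⊛-⊖ : ∀ {m n} (A : Matrix m n) v w i → (A ⊛ (v ⊖ w)) i ≡ (A ⊛ v ⊖ A ⊛ w) i
⊛-⊖ A v w i = begin
  (∑ℤ λ k → A i k *ᶻ (v k -ᶻ w k))                                  ≡⟨ sum-cong-≗ (λ k → expand (A i k) (v k) (w k)) ⟩
  (∑ℤ λ k → A i k *ᶻ v k +ᶻ (-ᶻ 1ℤ) *ᶻ (A i k *ᶻ w k))              ≡⟨ ∑-distrib-+ (λ k → A i k *ᶻ v k) (λ k → (-ᶻ 1ℤ) *ᶻ (A i k *ᶻ w k)) ⟩
  (A ⊛ v) i +ᶻ (∑ℤ λ k → (-ᶻ 1ℤ) *ᶻ (A i k *ᶻ w k))                ≡⟨ cong ((A ⊛ v) i +ᶻ_) (*-distribˡ-sum (-ᶻ 1ℤ) (λ k → A i k *ᶻ w k)) ⟨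
  (A ⊛ v) i +ᶻ (-ᶻ 1ℤ) *ᶻ (A ⊛ w) i                                 ≡⟨ cong ((A ⊛ v) i +ᶻ_) (ℤ.-1*i≡-i ((A ⊛ w) i)) ⟩
  (A ⊛ v ⊖ A ⊛ w) i                                                 ∎
  where
  open ≡-Reasoning
  expand : ∀ a x y → a *ᶻ (x -ᶻ y) ≡ a *ᶻ x +ᶻ (-ᶻ 1ℤ) *ᶻ (a *ᶻ y)
  expand = ℤSolver.solve-∀

∣-⊛ : ∀ {c m n} (A : Matrix m n) v → (∀ k → c ∣ᶻ v k) → ∀ i → c ∣ᶻ (A ⊛ v) i
∣-⊛ A v c∣v i = ∣-∑ _ λ k → ∣n⇒∣m*n (A i k) (c∣v k)

-- Stated with differences because `kernel-mod` subtracts two vectors of equal image.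
Linear : ∀ {m n} → (Vectorᶻ m → Vectorᶻ n) → Set
Linear F = ∀ v w i → F (v ⊖ w) i ≡ (F v ⊖ F w) i

funToFin-cong : ∀ {m n} {f g : Fin m → Fin n} → (∀ i → f i ≡ g i) → funToFin f ≡ funToFin g
funToFin-cong {zero}  f≗g = refl
funToFin-cong {suc m} f≗g = cong₂ Fin.combine (f≗g zero) (funToFin-cong (f≗g ∘ suc))

-- Of the q ^ m vectors with entries in [0, q), two have the same image modulo q.
kernel-mod : ∀ {q k m} → 1 < q → k < m → (F : Vectorᶻ m → Vectorᶻ k) → Linear F →
             ∃ λ v → (∀ i → + q ∣ᶻ F v i) × ∃ λ l → ¬ + q ∣ᶻ v l
kernel-mod {q} {k} {m} 1<q k<m F F-linear =
  let x , y , x<y , eq = Fin.pigeonhole (ℕ.^-monoʳ-< q 1<q k<m) (λ x → funToFin (residues (digits x)))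
  in digits x ⊖ digits y , in-kernel x y eq , nonzero x y (Fin.<⇒≢ x<y)
  where
  instance
    q≢0 : NonZero q
    q≢0 = >-nonZero (ℕ.<-trans (s≤s z≤n) 1<q)
  digits : Fin (q ℕ.^ m) → Vectorᶻ m
  digits x l = + toℕ (finToFun x l)
  residues : Vectorᶻ m → Fin k → Fin q
  residues v i = fromℕ< (n%ℕd<d (F v i) q)
  congruent : ∀ a b → a %ℕ q ≡ b %ℕ q → + q ∣ᶻ a -ᶻ b
  congruent a b eq = divides (a /ℕ q -ᶻ b /ℕ q) (begin
    a -ᶻ b                                                   ≡⟨ cong₂ _-ᶻ_ (a≡a%ℕn+[a/ℕn]*n a q) (a≡a%ℕn+[a/ℕn]*n b q) ⟩
    (+ (a %ℕ q) +ᶻ a /ℕ q *ᶻ + q) -ᶻ (+ (b %ℕ q) +ᶻ b /ℕ q *ᶻ + q)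
      ≡⟨ cong (λ r → (+ r +ᶻ a /ℕ q *ᶻ + q) -ᶻ (+ (b %ℕ q) +ᶻ b /ℕ q *ᶻ + q)) eq ⟩
    (+ (b %ℕ q) +ᶻ a /ℕ q *ᶻ + q) -ᶻ (+ (b %ℕ q) +ᶻ b /ℕ q *ᶻ + q)
      ≡⟨ collect (+ (b %ℕ q)) (a /ℕ q) (b /ℕ q) (+ q) ⟩
    (a /ℕ q -ᶻ b /ℕ q) *ᶻ + q ∎)
    where
    open ≡-Reasoning
    collect : ∀ r s t q → (r +ᶻ s *ᶻ q) -ᶻ (r +ᶻ t *ᶻ q) ≡ (s -ᶻ t) *ᶻ q
    collect = ℤSolver.solve-∀
  in-kernel : ∀ x y → funToFin (residues (digits x)) ≡ funToFin (residues (digits y)) →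
              ∀ i → + q ∣ᶻ F (digits x ⊖ digits y) i
  in-kernel x y eq i = ∣ᶻ-resp (sym (F-linear (digits x) (digits y) i)) (congruent (F (digits x) i) (F (digits y) i)
    (subst₂ _≡_ (Fin.toℕ-fromℕ< _) (Fin.toℕ-fromℕ< _) (cong toℕ (subst₂ _≡_
      (Fin.finToFun-funToFin (residues (digits x)) i) (Fin.finToFun-funToFin (residues (digits y)) i)
      (cong (λ z → finToFun z i) eq)))))
  nonzero : ∀ x y → x ≢ y → ∃ λ l → ¬ + q ∣ᶻ (digits x ⊖ digits y) l
  nonzero x y x≢y = let l , digit≢ = Fin.¬∀⟶∃¬ m _ (λ l → finToFun x l Fin.≟ finToFun y l) (x≢y ∘ all-equal)
                    in l , digit≢ ∘ too-close (finToFun x l) (finToFun y l)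
    where
    all-equal : (∀ l → finToFun x l ≡ finToFun y l) → x ≡ y
    all-equal eq = trans (sym (Fin.funToFin-finToFin {m} x)) (trans (funToFin-cong eq) (Fin.funToFin-finToFin {m} y))
    small : ∀ {d} → d < q → q ∣ d → d ≡ 0
    small {zero}  _   _   = refl
    small {suc d} d<q q∣d = ⊥-elim (ℕ.<⇒≱ d<q (∣⇒≤ q∣d))
    -- Both digits lie in [0, q), so their difference is less than q in absolute value and is
    -- divisible by q only if it is 0.
    too-close : ∀ a b → + q ∣ᶻ + toℕ a -ᶻ + toℕ b → a ≡ b
    too-close a b q∣ = Fin.toℕ-injective (ℤ.+-injective (ℤ.i-j≡0⇒i≡j (+ toℕ a) (+ toℕ b)
      (ℤ.∣i∣≡0⇒i≡0 (small (ℕ.≤-<-trans (subst (_≤ toℕ a ℕ.⊔ toℕ b) (cong ℤ.∣_∣ (sym (ℤ.m-n≡m⊖n (toℕ a) (toℕ b)))) (ℤ.∣m⊝n∣≤m⊔n (toℕ a) (toℕ b)))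
        (ℕ.⊔-pres-<m (Fin.toℕ<n a) (Fin.toℕ<n b))) (∣⇒∣ᵤ q∣)))))

entry : ∀ {n} → Vectorᶻ n → ℕ → ℤ
entry v k = coeff (tabulate v) k

entry-toℕ : ∀ {n} (v : Vectorᶻ n) i → entry v (toℕ i) ≡ v i
entry-toℕ v zero    = refl
entry-toℕ v (suc i) = entry-toℕ (v ∘ suc) i

entry-≥ : ∀ {n} (v : Vectorᶻ n) k → n ≤ k → entry v k ≡ 0ℤ
entry-≥ {zero}  v k       n≤k       = refl
entry-≥ {suc n} v (suc k) (s≤s n≤k) = entry-≥ (v ∘ suc) k n≤k

entry-cong : ∀ {n} {v w : Vectorᶻ n} → (∀ i → v i ≡ w i) → ∀ k → entry v k ≡ entry w k
entry-cong {zero}  v≗w k       = refl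
entry-cong {suc n} v≗w zero    = v≗w zero
entry-cong {suc n} v≗w (suc k) = entry-cong (v≗w ∘ suc) k

entry-⊖ : ∀ {n} (v w : Vectorᶻ n) k → entry (v ⊖ w) k ≡ entry v k -ᶻ entry w k
entry-⊖ {zero}  v w k       = refl
entry-⊖ {suc n} v w zero    = refl
entry-⊖ {suc n} v w (suc k) = entry-⊖ (v ∘ suc) (w ∘ suc) k

-- i zeros followed by w, cut off or filled up with zeros to length n; the type is thus free of
-- arithmetic on lengths.
pad : ∀ {s n} → ℕ → Vectorᶻ s → Vectorᶻ n
pad i w j = shift i (entry w) (toℕ j)
  where
  shift : ℕ → (ℕ → ℤ) → ℕ → ℤ
  shift zero    f k       = f k
  shift (suc i) f zero    = 0ℤ
  shift (suc i) f (suc k) = shift i f k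

pad-< : ∀ {s n} i (w : Vectorᶻ s) (j : Fin n) → toℕ j < i → pad i w j ≡ 0ℤ
pad-< (suc i) w zero    _         = refl
pad-< (suc i) w (suc j) (s≤s j<i) = pad-< i w j j<i

pad-≥ : ∀ {s n} i (w : Vectorᶻ s) (j : Fin n) l → toℕ j ≡ i ℕ.+ l → pad i w j ≡ entry w l
pad-≥ zero    w j       l refl = refl
pad-≥ (suc i) w (suc j) l eq   = pad-≥ i w j l (ℕ.suc-injective eq)

pad-⊖ : ∀ {s n} i (v w : Vectorᶻ s) (j : Fin n) → pad i (v ⊖ w) j ≡ pad i v j -ᶻ pad i w j
pad-⊖ zero    v w j       = entry-⊖ v w (toℕ j)
pad-⊖ (suc i) v w zero    = refl
pad-⊖ (suc i) v w (suc j) = pad-⊖ i v w j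

prime-power-∣ : ∀ {p} t a x → Prime p → ¬ p ℕ.^ t ∣ a → p ℕ.^ t ∣ a ℕ.* x → p ∣ x
prime-power-∣ {p} t a x p-prime p^t∤a p^t∣ax with p ∣? x
... | yes p∣x = p∣x
... | no p∤x = ⊥-elim (p^t∤a (coprime-divisor (coprime t) (subst (p ℕ.^ t ∣_) (ℕ.*-comm a x) p^t∣ax)))
  where
  coprime-power : ∀ t {d} → d ∣ p ℕ.^ t → ¬ p ∣ d → d ≡ 1
  coprime-power zero    d∣1 p∤d = ∣1⇒≡1 d∣1
  coprime-power (suc t) d∣  p∤d = coprime-power t (coprime-divisor (prime∤⇒coprime p-prime p∤d) d∣) p∤d
  coprime : ∀ t → Coprime (p ℕ.^ t) x
  coprime t (d∣p^t , d∣x) = coprime-power t d∣p^t λ p∣d → p∤x (∣-trans p∣d d∣x)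

prime-power-∣ᶻ : ∀ {p} t a x → Prime p → ¬ p ℕ.^ t ∣ a → + (p ℕ.^ t) ∣ᶻ + a *ᶻ x → + p ∣ᶻ x
prime-power-∣ᶻ {p} t a x p-prime p^t∤a p^t∣ax = ∣ᵤ⇒∣ (prime-power-∣ t a ℤ.∣ x ∣ p-prime p^t∤a
  (subst (p ℕ.^ t ∣_) (ℤ.abs-* (+ a) x) (∣⇒∣ᵤ p^t∣ax)))

module _ {n} {A : Matrix n n} {e : Fin n → ℕ} (ed : ElementaryDivisors A e) where

  open ElementaryDivisors ed

  private
    left⁻¹ = proj₁ left-unimodular
    right⁻¹ = proj₁ right-unimodular

    inverse-⊛ : ∀ (U V : Matrix n n) → U ⊗ V ≋ diag (λ _ → 1ℤ) → ∀ v i → (U ⊛ V ⊛ v) i ≡ v i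
    inverse-⊛ U V UV≋1 v i = trans (sym (⊛-assoc U V v i)) (trans (⊛-congˡ UV≋1 v i)
      (trans (⊛-diag (λ _ → 1ℤ) v i) (ℤ.*-identityˡ (v i))))

    ∣-⊛-cancel : ∀ {c} (U V : Matrix n n) → V ⊗ U ≋ diag (λ _ → 1ℤ) → ∀ v →
                 (∀ i → c ∣ᶻ (U ⊛ v) i) → ∀ i → c ∣ᶻ v i
    ∣-⊛-cancel U V VU≋1 v c∣ i = ∣ᶻ-resp (inverse-⊛ V U VU≋1 v i) (∣-⊛ V (U ⊛ v) c∣ i)

    smith-⊛ : ∀ v i → (left ⊛ A ⊛ right ⊛ v) i ≡ + e i *ᶻ v i
    smith-⊛ v i = begin
      (left ⊛ A ⊛ right ⊛ v) i      ≡⟨ ⊛-assoc left A (right ⊛ v) i ⟨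
      ((left ⊗ A) ⊛ right ⊛ v) i    ≡⟨ ⊛-assoc (left ⊗ A) right v i ⟨
      ((left ⊗ A ⊗ right) ⊛ v) i    ≡⟨ ⊛-congˡ smith v i ⟩
      (diag (λ i → + e i) ⊛ v) i    ≡⟨ ⊛-diag (λ i → + e i) v i ⟩
      + e i *ᶻ v i                  ∎
      where open ≡-Reasoning

  -- The images under right of the vectors supported from position i on are
  -- killed by A modulo c, and there are too many of them.
  ∣-elementaryDivisor⇒ : ∀ {c q} N → 1 < q →
    (∀ x → (∀ i → + c ∣ᶻ (A ⊛ x) i) → (∀ j → n ≤ toℕ j ℕ.+ N → + q ∣ᶻ x j) → ∀ j → + q ∣ᶻ x j) →
    ∀ i → c ∣ e i → n ≤ toℕ i ℕ.+ N
  ∣-elementaryDivisor⇒ {c} {q} N 1<q determined i c∣eᵢ = ℕ.≮⇒≥ λ i+N<n →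
    -- The n - i positions from i on outnumber N, so some w that is nonzero modulo q has an image x
    -- whose last N entries vanish modulo q.
    let w , top , l , q∤w = kernel-mod 1<q (N<s i+N<n) topEntries linear
        x = right ⊛ pad (toℕ i) w
        q∣x = determined x (killed w) (top-∣ w top)
        -- `right` is invertible over ℤ, so divisibility by q passes back from x to the padded w.
        q∣pad = ∣-⊛-cancel right right⁻¹ (proj₂ (proj₂ right-unimodular)) (pad (toℕ i) w) q∣x
    in q∤w (∣ᶻ-resp (trans (pad-≥ (toℕ i) w (embed l) (toℕ l) (Fin.toℕ-fromℕ< (embed< l))) (entry-toℕ w l))
         (q∣pad (embed l)))
    where
    s = n ℕ.∸ toℕ i
    i+s≡n : toℕ i ℕ.+ s ≡ n
    i+s≡n = ℕ.m+[n∸m]≡n (ℕ.<⇒≤ (Fin.toℕ<n i))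
    N<s : toℕ i ℕ.+ N < n → N < s
    N<s i+N<n = ℕ.+-cancelˡ-< (toℕ i) N s (subst (toℕ i ℕ.+ N <_) (sym i+s≡n) i+N<n)
    embed< : (l : Fin s) → toℕ i ℕ.+ toℕ l < n
    embed< l = subst (toℕ i ℕ.+ toℕ l <_) i+s≡n (ℕ.+-monoʳ-< (toℕ i) (Fin.toℕ<n l))
    embed : Fin s → Fin n
    embed l = fromℕ< (embed< l)
    topEntries : Vectorᶻ s → Vectorᶻ N
    topEntries w a = entry (right ⊛ pad (toℕ i) w) (n ℕ.∸ N ℕ.+ toℕ a)
    linear : Linear topEntries
    linear v w a = trans (entry-cong (λ j → trans (⊛-congʳ right (pad-⊖ (toℕ i) v w) j)
        (⊛-⊖ right (pad (toℕ i) v) (pad (toℕ i) w) j)) k)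
      (entry-⊖ (right ⊛ pad (toℕ i) v) (right ⊛ pad (toℕ i) w) k)
      where k = n ℕ.∸ N ℕ.+ toℕ a
    killed : ∀ w j → + c ∣ᶻ (A ⊛ right ⊛ pad (toℕ i) w) j
    killed w = ∣-⊛-cancel left left⁻¹ (proj₂ (proj₂ left-unimodular)) _ λ j →
      ∣ᶻ-resp (sym (smith-⊛ (pad (toℕ i) w) j)) (entry-killed j)
      where
      entry-killed : ∀ j → + c ∣ᶻ + e j *ᶻ pad (toℕ i) w j
      entry-killed j with toℕ j ℕ.<? toℕ i
      ... | yes j<i = ∣n⇒∣m*n (+ e j) (≡0⇒∣ᶻ (pad-< (toℕ i) w j j<i))
      ... | no j≮i  = ∣m⇒∣m*n {m = + e j} (pad (toℕ i) w j) (∣ᵤ⇒∣ (∣-trans c∣eᵢ (chain i j (ℕ.≮⇒≥ j≮i))))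
    top-∣ : ∀ w → (∀ a → + q ∣ᶻ topEntries w a) → ∀ j → n ≤ toℕ j ℕ.+ N → + q ∣ᶻ (right ⊛ pad (toℕ i) w) j
    top-∣ w top j n≤j+N = ∣ᶻ-resp
      (trans (cong (entry x) (trans (cong (n ℕ.∸ N ℕ.+_) (Fin.toℕ-fromℕ< a<N)) (ℕ.m+[n∸m]≡n n∸N≤j))) (entry-toℕ x j))
      (top (fromℕ< a<N))
      where
      x = right ⊛ pad (toℕ i) w
      n∸N≤j : n ℕ.∸ N ≤ toℕ j
      n∸N≤j = ℕ.m≤n+o⇒m∸n≤o n N (subst (n ≤_) (ℕ.+-comm (toℕ j) N) n≤j+N)
      a<N : toℕ j ℕ.∸ (n ℕ.∸ N) < N
      a<N = ℕ.+-cancelˡ-< (n ℕ.∸ N) _ N (subst (_< n ℕ.∸ N ℕ.+ N) (sym (ℕ.m+[n∸m]≡n n∸N≤j))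
        (ℕ.<-≤-trans (Fin.toℕ<n j) (subst (n ≤_) (ℕ.+-comm N (n ℕ.∸ N)) (ℕ.m≤n+m∸n n N))))

  -- The Smith coordinates of F w at the positions j with p^t ∤ e j are
  -- divisible by p, which leaves too little room for the others.
  ⇒∣-elementaryDivisor : ∀ {p} t N → Prime p → 1 < p → (F : Vectorᶻ N → Vectorᶻ n) → Linear F →
    (∀ w i → + (p ℕ.^ t) ∣ᶻ (A ⊛ F w) i) → (∀ w → (∀ j → + p ∣ᶻ F w j) → ∀ l → + p ∣ᶻ w l) →
    ∀ i → n ≤ toℕ i ℕ.+ N → p ℕ.^ t ∣ e i
  ⇒∣-elementaryDivisor {p} t N p-prime 1<p F F-linear killed injective i n≤i+N = go (p ℕ.^ t ∣? e i)
    where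
    s = n ℕ.∸ suc (toℕ i)
    coordinates : Vectorᶻ N → Vectorᶻ n
    coordinates w = right⁻¹ ⊛ F w
    upperEntries : Vectorᶻ N → Vectorᶻ s
    upperEntries w a = entry (coordinates w) (suc (toℕ i) ℕ.+ toℕ a)
    linear : Linear upperEntries
    linear v w a = trans (entry-cong (λ j → trans (⊛-congʳ right⁻¹ (F-linear v w) j)
        (⊛-⊖ right⁻¹ (F v) (F w) j)) k)
      (entry-⊖ (coordinates v) (coordinates w) k)
      where k = suc (toℕ i) ℕ.+ toℕ a
    s<N : s < N
    s<N = ℕ.+-cancelˡ-< (toℕ i) s N (ℕ.<-≤-trans
      (ℕ.≤-reflexive (trans (sym (ℕ.+-suc (toℕ i) s)) (trans (ℕ.+-suc (toℕ i) s) (ℕ.m+[n∸m]≡n (Fin.toℕ<n i))))) n≤i+N)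
    go : Dec (p ℕ.^ t ∣ e i) → p ℕ.^ t ∣ e i
    go (yes p^t∣e) = p^t∣e
    go (no p^t∤e)  =
      -- Only the s = n - i - 1 coordinates beyond i can be nonzero modulo p, and s < N. A w for
      -- which these vanish too has F w divisible by p, against `injective`.
      let w , upper , l , p∤w = kernel-mod 1<p s<N upperEntries linear
      in ⊥-elim (p∤w (injective w (λ j → ∣ᶻ-resp (inverse-⊛ right right⁻¹ (proj₁ (proj₂ right-unimodular)) (F w) j)
           (∣-⊛ right (coordinates w) (coordinates-∣ w upper) j)) l))
      where
      coordinates-∣ : ∀ w → (∀ a → + p ∣ᶻ upperEntries w a) → ∀ j → + p ∣ᶻ coordinates w j
      coordinates-∣ w upper j with toℕ j ℕ.≤? toℕ i
      -- As e j divides e i, p^t does not divide e j; but p^t divides e j times the coordinate.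
      ... | yes j≤i = prime-power-∣ᶻ t (e j) (coordinates w j) p-prime (λ p^t∣eⱼ → p^t∤e (∣-trans p^t∣eⱼ (chain j i j≤i)))
              (∣ᶻ-resp (trans (⊛-congʳ left (⊛-congʳ A (λ k → sym (inverse-⊛ right right⁻¹ (proj₁ (proj₂ right-unimodular)) (F w) k))) j)
                (smith-⊛ (coordinates w) j)) (∣-⊛ left (A ⊛ F w) (killed w) j))
      ... | no j≰i = ∣ᶻ-resp
              (trans (cong (entry (coordinates w)) (trans (cong (suc (toℕ i) ℕ.+_) (Fin.toℕ-fromℕ< a<s)) j≡)) (entry-toℕ (coordinates w) j))
              (upper (fromℕ< a<s))
        where
        j≡ : suc (toℕ i) ℕ.+ (toℕ j ℕ.∸ suc (toℕ i)) ≡ toℕ j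
        j≡ = ℕ.m+[n∸m]≡n (ℕ.≰⇒> j≰i)
        a<s : toℕ j ℕ.∸ suc (toℕ i) < s
        a<s = ℕ.∸-monoˡ-< (Fin.toℕ<n j) (ℕ.≰⇒> j≰i)

-- The matrix of Ψ

coeff-X^-≢ : ∀ a k → k ≢ a → coeff (X^ a) k ≡ 0ℤ
coeff-X^-≢ zero    zero    k≢a = ⊥-elim (k≢a refl)
coeff-X^-≢ zero    (suc k) k≢a = refl
coeff-X^-≢ (suc a) zero    k≢a = refl
coeff-X^-≢ (suc a) (suc k) k≢a = coeff-X^-≢ a k (k≢a ∘ cong suc)

-- Entry (d , a) stands for the basis vector X^a of the summand ℤ[X]/(Φ d).
exponentsOver : ℕ → List (ℕ × ℕ)
exponentsOver d = map (d ,_) (upTo (φ d))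

basisKeys : ℕ → List (ℕ × ℕ)
basisKeys n = concat (map exponentsOver (divisors n))

basisVector : ℕ × ℕ → ⨁
basisVector (d , a) = inSummand d (X^ a)

codomainBasis-keys : ∀ n → codomainBasis n ≡ map basisVector (basisKeys n)
codomainBasis-keys n = go (divisors n)
  where
  open ≡-Reasoning
  go : ∀ ds → concat (map (λ d → map (inSummand d ∘ X^) (upTo (φ d))) ds) ≡
              map basisVector (concat (map exponentsOver ds))
  go []       = refl
  go (d ∷ ds) = trans (cong₂ _++_ (map-∘ (upTo (φ d))) (go ds))
    (sym (map-++ basisVector (exponentsOver d) (concat (map exponentsOver ds))))

basisKeys-unique : ∀ n → Unique (basisKeys n)
basisKeys-unique n = Unique.concat⁺
  (All.map⁺ (All.tabulate λ {d} _ → Unique.map⁺ (cong proj₂) (Unique.upTo⁺ (φ d))))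
  (AllPairs.map⁺ (AllPairs.map disjoint (divisors-unique n)))
  where
  disjoint : ∀ {d e} → d ≢ e → ∀ {x} → x ∈ exponentsOver d × x ∈ exponentsOver e → _
  disjoint d≢e (x∈ , y∈)
    with _ , _ , refl ← ∈-map⁻ _ x∈ | _ , _ , eq ← ∈-map⁻ _ y∈ = d≢e (cong proj₁ eq)

∈-basisKeys⁻ : ∀ {n d a} → (d , a) ∈ basisKeys n → d ∣ n × a < φ d
∈-basisKeys⁻ {n} k∈
  with _ , k∈d , d∈ ← ∈-concat⁻′ (map exponentsOver (divisors n)) k∈
  with d , d∈D , refl ← ∈-map⁻ exponentsOver d∈
  with a , a∈ , refl ← ∈-map⁻ (d ,_) k∈d
  = ∈-divisors⁻ d∈D , ∈-upTo⁻ a∈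

lookup-cast-map : ∀ {A B : Set} {n} (f : A → B) xs {ys} → ys ≡ map f xs →
                  (eq : n ≡ length ys) (eq′ : n ≡ length xs) → ∀ i →
                  lookup ys (Fin.cast eq i) ≡ f (lookup xs (Fin.cast eq′ i))
lookup-cast-map f []       refl eq () zero
lookup-cast-map f (x ∷ xs) refl eq eq′ zero    = refl
lookup-cast-map f (x ∷ xs) refl eq eq′ (suc i) =
  lookup-cast-map f xs refl (ℕ.suc-injective eq) (ℕ.suc-injective eq′) i

module _ (n : ℕ) where

  private
    length-keys : n ≡ length (basisKeys n)
    length-keys = trans (sym (length-codomainBasis n))
      (trans (cong length (codomainBasis-keys n)) (length-map basisVector (basisKeys n)))

    key : Fin n → ℕ × ℕ
    key i = lookup (basisKeys n) (Fin.cast length-keys i)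

    summand exponent : Fin n → ℕ
    summand i = proj₁ (key i)
    exponent i = proj₂ (key i)

    basis-key : ∀ i → basis n i ≡ basisVector (key i)
    basis-key = lookup-cast-map basisVector (basisKeys n) (codomainBasis-keys n)
      (sym (length-codomainBasis n)) length-keys

    key-injective : ∀ {i j} → key i ≡ key j → i ≡ j
    key-injective {i} {j} eq = Fin.toℕ-injective (trans (sym (Fin.toℕ-cast length-keys i))
      (trans (cong toℕ (lookup-injective (basisKeys-unique n) _ _ eq)) (Fin.toℕ-cast length-keys j)))
      where
      lookup-injective : ∀ {A : Set} {xs : List A} → Unique xs → ∀ i j → lookup xs i ≡ lookup xs j → i ≡ j
      lookup-injective (x∉ AllPairs.∷ u) zero    zero    eq = refl
      lookup-injective (x∉ AllPairs.∷ u) zero    (suc j) eq = ⊥-elim (All.lookup x∉ (∈-lookup j) eq)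
      lookup-injective (x∉ AllPairs.∷ u) (suc i) zero    eq = ⊥-elim (All.lookup x∉ (∈-lookup i) (sym eq))
      lookup-injective (x∉ AllPairs.∷ u) (suc i) (suc j) eq = cong suc (lookup-injective u i j eq)

    key-spec : ∀ i → summand i ∣ n × exponent i < φ (summand i)
    key-spec i = ∈-basisKeys⁻ (∈-lookup (Fin.cast length-keys i))

    coeff-basis-≡ : ∀ i → coeff (basis n i (summand i)) (exponent i) ≡ 1ℤ
    coeff-basis-≡ i = trans (cong (λ F → coeff (F (summand i)) (exponent i)) (basis-key i))
      (trans (cong (λ b → coeff (if b then X^ (exponent i) else []) (exponent i)) (dec-true (summand i ℕ.≟ summand i) refl))
        (leading (Monic-X^ (exponent i))))

    coeff-basis-≢ : ∀ i d k → (d , k) ≢ key i → coeff (basis n i d) k ≡ 0ℤ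
    coeff-basis-≢ i d k dk≢ = trans (cong (λ F → coeff (F d) k) (basis-key i)) (go (d ℕ.≟ summand i))
      where
      go : (d? : Dec (d ≡ summand i)) → coeff (if does d? then X^ (exponent i) else []) k ≡ 0ℤ
      go (yes refl) = coeff-X^-≢ (exponent i) k (dk≢ ∘ cong (d ,_))
      go (no _)     = refl

  combination : Vectorᶻ n → ⨁
  combination w = ∑⨁ λ i d → w i · basis n i d

  coeff-combination : ∀ w d k → coeff (combination w d) k ≡ ∑ℤ λ i → w i *ᶻ coeff (basis n i d) k
  coeff-combination w d k = trans (coeff-∑⨁ (λ i d → w i · basis n i d)) (sum-cong-≗ λ i → coeff-· (w i) (basis n i d) k)
    where
    coeff-∑⨁ : ∀ {n} (F : Fin n → ⨁) → coeff (∑⨁ F d) k ≡ ∑ℤ λ i → coeff (F i d) k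
    coeff-∑⨁ {zero}  F = refl
    coeff-∑⨁ {suc n} F = trans (coeff-⊞ (F zero d) _ k) (cong (coeff (F zero d) k +ᶻ_) (coeff-∑⨁ (F ∘ suc)))

  -- Linear independence of the basis modulo c. The component at d has degree below φ d, the degree
  -- of the monic Φ_d, so lying in (c) + (Φ_d) makes all its coefficients divisible by c, and the w
  -- i are among the coefficients of these components.
  combination-∈⇒∣ : ∀ {c} w → 0 < n → (∀ {d} → d ∣ n → combination w d ∈⟨ c , Φ d ⟩) → ∀ i → + c ∣ᶻ w i
  combination-∈⇒∣ {c} w 0<n w∈ i = ∣ᶻ-resp coeff-at-key (coeff-∣ (exponent i))
    where
    open ≡-Reasoning
    d = summand i
    W = combination w d
    coeff-at-key : coeff W (exponent i) ≡ w i
    coeff-at-key = begin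
      coeff W (exponent i)                                ≡⟨ coeff-combination w d (exponent i) ⟩
      (∑ℤ λ j → w j *ᶻ coeff (basis n j d) (exponent i))  ≡⟨ ∑-single _ i (λ j j≢i →
        trans (cong (w j *ᶻ_) (coeff-basis-≢ j d (exponent i) (j≢i ∘ sym ∘ key-injective))) (ℤ.*-zeroʳ (w j))) ⟩
      w i *ᶻ coeff (basis n i d) (exponent i)             ≡⟨ cong (w i *ᶻ_) (coeff-basis-≡ i) ⟩
      w i *ᶻ 1ℤ                                           ≡⟨ ℤ.*-identityʳ (w i) ⟩
      w i                                                 ∎
    above-φ : ∀ k → φ d ≤ k → coeff W k ≡ 0ℤ
    above-φ k φ≤k = trans (coeff-combination w d k) (∑-zero _ λ j →
      trans (cong (w j *ᶻ_) (coeff-basis-≢ j d k λ eq → ℕ.<⇒≱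
        (subst (λ (d , a) → a < φ d) (sym eq) (proj₂ (key-spec j))) φ≤k)) (ℤ.*-zeroʳ (w j)))
    d∣n = proj₁ (key-spec i)
    q = proj₁ (w∈ d∣n)
    r = proj₁ (proj₂ (w∈ d∣n))
    split : ∀ k → coeff W k ≡ coeff (const (+ c) ⊠ q) k +ᶻ coeff (Φ d ⊠ r) k
    split k = trans (coeff-≡ (proj₂ (proj₂ (w∈ d∣n))) k) (coeff-⊞ (const (+ c) ⊠ q) (Φ d ⊠ r) k)
    r-∣ : ∀ k → + c ∣ᶻ coeff r k
    r-∣ k = monic-∣ (Monic-Φ (isCyclotomic (divisor-positive 0<n d∣n))) r 0
      (λ j φ≤j → ∣m+n∣m⇒∣n (∣ᶻ-resp (split j) (≡0⇒∣ᶻ (above-φ j (subst (_≤ j) (ℕ.+-identityʳ (φ d)) φ≤j))))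
        (∣-coeff-const⊠ (+ c) q j)) k z≤n
    coeff-∣ : ∀ k → + c ∣ᶻ coeff W k
    coeff-∣ k = ∣ᶻ-resp (sym (split k)) (∣m∣n⇒∣m+n (∣-coeff-const⊠ (+ c) q k) (∣-coeff-⊠ (Φ d) r r-∣ k))

∑X^ : ∀ {n} (x : Vectorᶻ n) k → entry x k ≡ ∑ℤ λ j → x j *ᶻ coeff (X^ (toℕ j)) k
∑X^ {zero}  x k       = refl
∑X^ {suc n} x zero    = sym (trans (cong₂ _+ᶻ_ (ℤ.*-identityʳ (x zero)) (∑-zero (λ j → x (suc j) *ᶻ 0ℤ) λ j → ℤ.*-zeroʳ (x (suc j))))
  (ℤ.+-identityʳ _))
∑X^ {suc n} x (suc k) = trans (∑X^ (x ∘ suc) k) (sym (trans (cong (_+ᶻ ∑ℤ (λ j → x (suc j) *ᶻ coeff (X^ (toℕ j)) k)) (ℤ.*-zeroʳ (x zero)))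
  (ℤ.+-identityˡ _)))

∑ᴾ : ∀ {n} → Vectorᶻ n → (Fin n → Poly) → Poly
∑ᴾ x q = Vector.foldr _⊞_ [] λ j → x j · q j

coeff-∑ᴾ-⊠ : ∀ {n} (x : Vectorᶻ n) q P k → coeff (∑ᴾ x q ⊠ P) k ≡ ∑ℤ λ j → x j *ᶻ coeff (q j ⊠ P) k
coeff-∑ᴾ-⊠ {zero}  x q P k = refl
coeff-∑ᴾ-⊠ {suc n} x q P k = begin
  coeff ((x zero · q zero ⊞ rest) ⊠ P) k                     ≡⟨ coeff-≡ (⊠-distribʳ-⊞ P (x zero · q zero) rest) k ⟩
  coeff ((x zero · q zero) ⊠ P ⊞ rest ⊠ P) k                 ≡⟨ coeff-⊞ ((x zero · q zero) ⊠ P) (rest ⊠ P) k ⟩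
  coeff ((x zero · q zero) ⊠ P) k +ᶻ coeff (rest ⊠ P) k      ≡⟨ cong₂ _+ᶻ_
    (trans (coeff-≡ (·-⊠ (x zero) (q zero) P) k) (coeff-· (x zero) (q zero ⊠ P) k)) (coeff-∑ᴾ-⊠ (x ∘ suc) (q ∘ suc) P k) ⟩
  (∑ℤ λ j → x j *ᶻ coeff (q j ⊠ P) k)                        ∎
  where
  open ≡-Reasoning
  rest = ∑ᴾ (x ∘ suc) (q ∘ suc)

module _ {n} (A : Matrix n n) (isMatrix : IsMatrixOfΨ n A) where

  -- Extends the defining property of the matrix linearly from the powers X^j to the polynomial with
  -- coefficient vector x; Q collects the multiples of Φ_d.
  image-combination : ∀ x {d} → d ∣ n → ∃ λ Q → tabulate x ≃ combination n (A ⊛ x) d ⊞ Q ⊠ Φ d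
  image-combination x {d} d∣n = ∑ᴾ x q , mk λ k → begin
    entry x k                                                          ≡⟨ ∑X^ x k ⟩
    (∑ℤ λ j → x j *ᶻ coeff (X^ (toℕ j)) k)                             ≡⟨ sum-cong-≗ (λ j → expand j k) ⟩
    (∑ℤ λ j → x j *ᶻ (∑ℤ λ i → A i j *ᶻ b i k) +ᶻ x j *ᶻ coeff (q j ⊠ Φ d) k)
      ≡⟨ ∑-distrib-+ (λ j → x j *ᶻ (∑ℤ λ i → A i j *ᶻ b i k)) (λ j → x j *ᶻ coeff (q j ⊠ Φ d) k) ⟩
    (∑ℤ λ j → x j *ᶻ (∑ℤ λ i → A i j *ᶻ b i k)) +ᶻ (∑ℤ λ j → x j *ᶻ coeff (q j ⊠ Φ d) k)
      ≡⟨ cong₂ _+ᶻ_ (exchange k) (sym (coeff-∑ᴾ-⊠ x q (Φ d) k)) ⟩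
    coeff (combination n (A ⊛ x) d) k +ᶻ coeff (∑ᴾ x q ⊠ Φ d) k        ≡⟨ coeff-⊞ (combination n (A ⊛ x) d) (∑ᴾ x q ⊠ Φ d) k ⟨
    coeff (combination n (A ⊛ x) d ⊞ ∑ᴾ x q ⊠ Φ d) k                   ∎
    where
    open ≡-Reasoning
    q : Fin n → Poly
    q j = proj₁ (isMatrix j d d∣n)
    b : Fin n → ℕ → ℤ
    b i k = coeff (basis n i d) k
    expand : ∀ j k → x j *ᶻ coeff (X^ (toℕ j)) k ≡ x j *ᶻ (∑ℤ λ i → A i j *ᶻ b i k) +ᶻ x j *ᶻ coeff (q j ⊠ Φ d) k
    expand j k = trans (cong (x j *ᶻ_) (trans (proj₂ (isMatrix j d d∣n) k)
        (trans (coeff-⊞ (combination n (λ i → A i j) d) (q j ⊠ Φ d) k)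
          (cong (_+ᶻ coeff (q j ⊠ Φ d) k) (coeff-combination n (λ i → A i j) d k)))))
      (ℤ.*-distribˡ-+ (x j) (∑ℤ λ i → A i j *ᶻ b i k) (coeff (q j ⊠ Φ d) k))
    shuffle : ∀ x a b → x *ᶻ (a *ᶻ b) ≡ a *ᶻ x *ᶻ b
    shuffle = ℤSolver.solve-∀
    exchange : ∀ k → (∑ℤ λ j → x j *ᶻ (∑ℤ λ i → A i j *ᶻ b i k)) ≡ coeff (combination n (A ⊛ x) d) k
    exchange k = begin
      (∑ℤ λ j → x j *ᶻ (∑ℤ λ i → A i j *ᶻ b i k))   ≡⟨ sum-cong-≗ (λ j → *-distribˡ-sum (x j) (λ i → A i j *ᶻ b i k)) ⟩
      (∑ℤ λ j → ∑ℤ λ i → x j *ᶻ (A i j *ᶻ b i k))   ≡⟨ ∑-comm (λ j i → x j *ᶻ (A i j *ᶻ b i k)) ⟩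
      (∑ℤ λ i → ∑ℤ λ j → x j *ᶻ (A i j *ᶻ b i k))   ≡⟨ sum-cong-≗ (λ i → sum-cong-≗ (λ j → shuffle (x j) (A i j) (b i k))) ⟩
      (∑ℤ λ i → ∑ℤ λ j → A i j *ᶻ x j *ᶻ b i k)     ≡⟨ sum-cong-≗ (λ i → *-distribʳ-sum (b i k) (λ j → A i j *ᶻ x j)) ⟨
      (∑ℤ λ i → (A ⊛ x) i *ᶻ b i k)                 ≡⟨ coeff-combination n (A ⊛ x) d k ⟨
      coeff (combination n (A ⊛ x) d) k             ∎

  -- With its converse `∈⇒killed`, translates between A x ≡ 0 modulo c and the condition on ideals,
  -- so that the Smith form and the arithmetic of ℤ[X] can be joined.
  killed⇒∈ : ∀ {c} x → (∀ i → + c ∣ᶻ (A ⊛ x) i) → ∀ {d} → d ∣ n → tabulate x ∈⟨ c , Φ d ⟩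
  killed⇒∈ {c} x c∣ {d} d∣n =
    let Q , eq = image-combination x d∣n
        h , eq′ = ∣-coeffs⇒const⊠ (+ c) (combination n (A ⊛ x) d) λ k →
          ∣ᶻ-resp (sym (coeff-combination n (A ⊛ x) d k)) (∣-∑ _ λ i → ∣m⇒∣m*n (coeff (basis n i d) k) (c∣ i))
    in h , Q , ≃-trans eq (⊞-cong eq′ (⊠-comm Q (Φ d)))

  ∈⇒killed : ∀ {c} x → 0 < n → (∀ {d} → d ∣ n → tabulate x ∈⟨ c , Φ d ⟩) → ∀ i → + c ∣ᶻ (A ⊛ x) i
  ∈⇒killed {c} x 0<n x∈ = combination-∈⇒∣ n (A ⊛ x) 0<n λ {d} d∣n →
    let Q , eq = image-combination x d∣n
        q , r , eq′ = x∈ d∣n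
    in q , (r ⊟ Q) , ≃-trans (isolate (combination n (A ⊛ x) d) Q (Φ d))
         (≃-trans (⊞-cong (≃-trans (≃-sym eq) eq′) (≃-refl {(-ᶻ 1ℤ) · (Q ⊠ Φ d)})) (collect (const (+ c) ⊠ q) (Φ d) r Q))
    where
    isolate : ∀ W Q P → W ≃ (W ⊞ Q ⊠ P) ⊟ Q ⊠ P
    isolate = solve-∀ ℤ[X]-acr
    collect : ∀ z P r Q → (z ⊞ P ⊠ r) ⊟ Q ⊠ P ≃ z ⊞ P ⊠ (r ⊟ Q)
    collect = solve-∀ ℤ[X]-acr

-- Divisibility of the elementary divisors by prime powers

prime>1 : ∀ {p} → Prime p → 1 < p
prime>1 {p} p-prime = nonTrivial⇒n>1 p {{prime⇒nonTrivial p-prime}}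

^-∣ : ∀ p {s t} → s ≤ t → p ℕ.^ s ∣ p ℕ.^ t
^-∣ p {s} {t} s≤t = divides (p ℕ.^ (t ℕ.∸ s))
  (trans (cong (p ℕ.^_) (sym (ℕ.m∸n+n≡m s≤t))) (ℕ.^-distribˡ-+-* p (t ℕ.∸ s) s))

tabulate-coeff : ∀ {n} f → (∀ j → n ≤ j → coeff f j ≡ 0ℤ) → tabulate {n = n} (λ j → coeff f (toℕ j)) ≃ f
tabulate-coeff {n} f f0 = mk λ k → go k (k ℕ.<? n)
  where
  x : Vectorᶻ n
  x j = coeff f (toℕ j)
  go : ∀ k → Dec (k < n) → entry x k ≡ coeff f k
  go k (yes k<n) = trans (cong (entry x) (sym (Fin.toℕ-fromℕ< k<n)))
    (trans (entry-toℕ x (fromℕ< k<n)) (cong (coeff f) (Fin.toℕ-fromℕ< k<n)))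
  go k (no k≮n)  = trans (entry-≥ x k (ℕ.≮⇒≥ k≮n)) (sym (f0 k (ℕ.≮⇒≥ k≮n)))

-- For n = q N, this is w repeated q times.
periodic : ∀ {N} n → ℕ → Vectorᶻ N → Vectorᶻ n
periodic {N} n q w j = coeff (tabulate w ⊠ geo q N) (toℕ j)

periodic-linear : ∀ {N} n q → Linear (periodic {N} n q)
periodic-linear {N} n q v w j = begin
  coeff (tabulate (v ⊖ w) ⊠ g) k                       ≡⟨ coeff-≡ (⊠-cong tabulate-⊖ (≃-refl {g})) k ⟩
  coeff ((tabulate v ⊟ tabulate w) ⊠ g) k              ≡⟨ coeff-≡ (expand (tabulate v) (tabulate w) g) k ⟩
  coeff (tabulate v ⊠ g ⊟ tabulate w ⊠ g) k            ≡⟨ coeff-⊟ (tabulate v ⊠ g) (tabulate w ⊠ g) k ⟩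
  coeff (tabulate v ⊠ g) k -ᶻ coeff (tabulate w ⊠ g) k ∎
  where
  open ≡-Reasoning
  g = geo q N
  k = toℕ j
  coeff-⊟ : ∀ f g k → coeff (f ⊟ g) k ≡ coeff f k -ᶻ coeff g k
  coeff-⊟ f g k = trans (coeff-⊞ f ((-ᶻ 1ℤ) · g) k) (cong (coeff f k +ᶻ_) (trans (coeff-· (-ᶻ 1ℤ) g k) (ℤ.-1*i≡-i (coeff g k))))
  tabulate-⊖ : tabulate (v ⊖ w) ≃ tabulate v ⊟ tabulate w
  tabulate-⊖ = mk λ k → trans (entry-⊖ v w k) (sym (coeff-⊟ (tabulate v) (tabulate w) k))
  expand : ∀ f h g → (f ⊟ h) ⊠ g ≃ f ⊠ g ⊟ h ⊠ g
  expand = solve-∀ ℤ[X]-acr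

scaledPower-≡ : ∀ p m α → scaledPower p m α ≡ p ℕ.^ α ℕ.* m
scaledPower-≡ p m zero    = sym (ℕ.+-identityʳ m)
scaledPower-≡ p m (suc α) = trans (cong (p ℕ.*_) (scaledPower-≡ p m α)) (sym (ℕ.*-assoc p (p ℕ.^ α) m))

codegree-≡ : ∀ p m α t → t ≤ α → p ℕ.^ t ℕ.* codegree p m α t ≡ scaledPower p m α
codegree-≡ p m α       zero    _         = ℕ.+-identityʳ _
codegree-≡ p m (suc α) (suc t) (s≤s t≤α) =
  trans (ℕ.*-assoc p (p ℕ.^ t) _) (cong (p ℕ.*_) (codegree-≡ p m α t t≤α))

codegree-suc : ∀ p m α → codegree p m α (suc α) ≡ 0
codegree-suc p m zero    = refl
codegree-suc p m (suc α) = codegree-suc p m α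

codegree-≤ : ∀ p m α t → 1 < p → codegree p m α t ≤ scaledPower p m α
codegree-≤ p m α       zero    _   = ℕ.≤-refl
codegree-≤ p m zero    (suc t) _   = z≤n
codegree-≤ p m (suc α) (suc t) 1<p = ℕ.≤-trans (codegree-≤ p m α t 1<p)
  (ℕ.m≤n*m (scaledPower p m α) p {{>-nonZero (ℕ.<-trans (s≤s z≤n) 1<p)}})

p-part : ∀ {p} → 1 < p → ∀ {n} → 0 < n → ∃₂ λ α m → n ≡ scaledPower p m α × ¬ p ∣ m × 0 < m
p-part {p} 1<p {n} = <-rec (λ n → 0 < n → ∃₂ λ α m → n ≡ scaledPower p m α × ¬ p ∣ m × 0 < m) step n
  where
  step : ∀ n → (∀ {k} → k < n → 0 < k → ∃₂ λ α m → k ≡ scaledPower p m α × ¬ p ∣ m × 0 < m) →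
         0 < n → ∃₂ λ α m → n ≡ scaledPower p m α × ¬ p ∣ m × 0 < m
  step n ih 0<n with p ∣? n
  ... | no p∤n = 0 , n , refl , p∤n , 0<n
  ... | yes (divides zero refl) = ⊥-elim (ℕ.<-irrefl refl 0<n)
  ... | yes (divides k@(suc _) n≡kp)
    with α , m , k≡ , p∤m , 0<m ← ih (subst (k <_) (sym n≡kp) (ℕ.m<m*n k p 1<p)) (s≤s z≤n)
    = suc α , m , trans n≡kp (trans (ℕ.*-comm k p) (cong (p ℕ.*_) k≡)) , p∤m , 0<m

module _ {n} (0<n : 0 < n) (A : Matrix n n) (isMatrix : IsMatrixOfΨ n A)
         {e : Fin n → ℕ} (ed : ElementaryDivisors A e) where

  prime-power-∣-elementaryDivisor : ∀ {p} t N → Prime p → p ℕ.^ t ℕ.* N ≡ n → ∀ i → n ≤ toℕ i ℕ.+ N → p ℕ.^ t ∣ e i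
  prime-power-∣-elementaryDivisor {p} t N p-prime qN≡n = ⇒∣-elementaryDivisor ed t N p-prime (prime>1 p-prime) (periodic n q)
    (periodic-linear n q) killed (λ w → injective q 0<q qN≡n w)
    where
    q = p ℕ.^ t
    0<q : 0 < q
    0<q = ℕ.m^n>0 p {{>-nonZero (ℕ.<-trans (s≤s z≤n) (prime>1 p-prime))}} t
    0<N : 0 < N
    0<N = ℕ.n≢0⇒n>0 λ { refl → ℕ.<⇒≢ 0<n (trans (sym (ℕ.*-zeroʳ q)) qN≡n) }
    killed : ∀ w i → + q ∣ᶻ (A ⊛ periodic n q w) i
    killed w = ∈⇒killed A isMatrix (periodic n q w) 0<n λ {d} d∣n →
      let u , v , eq = multiple-∈ {q} {Φ d} {geo q N} (tabulate w) (geo∈ q 0<N 0<q (subst (d ∣_) (sym qN≡n) d∣n))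
      in u , v , ≃-trans (tabulate-coeff (tabulate w ⊠ geo q N) (λ j n≤j →
           coeff-⊠-geo-high (tabulate w) q (entry-≥ w) j (subst (_≤ j) (sym qN≡n) n≤j))) eq
    -- As q > 0, at least one copy of w is present, and the one in the positions below N is w
    -- itself.
    injective : ∀ q → 0 < q → q ℕ.* N ≡ n → ∀ w → (∀ j → + p ∣ᶻ periodic n q w j) → ∀ l → + p ∣ᶻ w l
    injective (suc c) _ qN≡n w p∣ l = ∣ᶻ-resp
      (trans (cong (coeff (tabulate w ⊠ geo (suc c) N)) (Fin.toℕ-fromℕ< l<n))
        (trans (coeff-⊠-geo-low (tabulate w) c (Fin.toℕ<n l)) (entry-toℕ w l)))
      (p∣ (fromℕ< l<n))
      where
      l<n : toℕ l < n
      l<n = ℕ.<-≤-trans (Fin.toℕ<n l) (subst (N ≤_) qN≡n (ℕ.m≤m+n N (c ℕ.* N)))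

  private
    -- The exponent t = α + 1 is included on purpose: there `codegree` is 0 and n ≤ i is absurd, so
    -- no power of p beyond p^α divides any e i.
    upper : ∀ {p} α m t → Prime p → ¬ p ∣ m → 0 < m → n ≡ scaledPower p m α → t ≤ suc α →
            ∀ i → p ℕ.^ t ∣ e i → n ≤ toℕ i ℕ.+ codegree p m α t
    upper {zero}      α m t p-prime = ⊥-elim (¬prime[0] p-prime)
    upper {p@(suc c)} α m t p-prime p∤m 0<m n≡ t≤ =
      ∣-elementaryDivisor⇒ ed N (prime>1 p-prime) determined
      where
      N = codegree p m α t
      N≤n : N ≤ n
      N≤n = subst (N ≤_) (sym n≡) (codegree-≤ p m α t (prime>1 p-prime))
      determined : ∀ x → (∀ i → + (p ℕ.^ t) ∣ᶻ (A ⊛ x) i) → (∀ j → n ≤ toℕ j ℕ.+ N → + p ∣ᶻ x j) → ∀ j → + p ∣ᶻ x j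
      determined x killed top j = ∣ᶻ-resp (entry-toℕ x j) (top-coeffs-determine c m p-prime p∤m 0<m α t (tabulate x) t≤
        (λ {d} d∣ → killed⇒∈ A isMatrix x killed (subst (d ∣_) (sym n≡) d∣))
        (n ℕ.∸ N) (trans (ℕ.m∸n+n≡m N≤n) n≡) top-entries (toℕ j))
        where
        top-entries : ∀ k → n ℕ.∸ N ≤ k → + p ∣ᶻ entry x k
        top-entries k n∸N≤k = go (k ℕ.<? n)
          where
          go : Dec (k < n) → + p ∣ᶻ entry x k
          go (no k≮n)  = ≡0⇒∣ᶻ (entry-≥ x k (ℕ.≮⇒≥ k≮n))
          go (yes k<n) = ∣ᶻ-resp (trans (sym (entry-toℕ x (fromℕ< k<n))) (cong (entry x) (Fin.toℕ-fromℕ< k<n)))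
            (top (fromℕ< k<n) (ℕ.≤-trans (ℕ.m≤n+m∸n n N)
              (subst (λ z → N ℕ.+ (n ℕ.∸ N) ≤ z ℕ.+ N) (sym (Fin.toℕ-fromℕ< k<n))
                (ℕ.≤-trans (ℕ.≤-reflexive (ℕ.+-comm N _)) (ℕ.+-monoˡ-≤ N n∸N≤k)))))

  prime-power-∣-elementaryDivisor⇒ : ∀ {p} t → Prime p → ∀ i → p ℕ.^ t ∣ e i →
                                     ∃ λ N → p ℕ.^ t ℕ.* N ≡ n × n ≤ toℕ i ℕ.+ N
  prime-power-∣-elementaryDivisor⇒ {p} t p-prime i p^t∣e = go (p-part (prime>1 p-prime) 0<n)
    where
    go : (∃₂ λ α m → n ≡ scaledPower p m α × ¬ p ∣ m × 0 < m) → ∃ λ N → p ℕ.^ t ℕ.* N ≡ n × n ≤ toℕ i ℕ.+ N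
    go (α , m , n≡ , p∤m , 0<m) with t ℕ.≤? α
    ... | yes t≤α = codegree p m α t , trans (codegree-≡ p m α t t≤α) (sym n≡) ,
                    upper α m t p-prime p∤m 0<m n≡ (ℕ.m≤n⇒m≤1+n t≤α) i p^t∣e
    ... | no t≰α  = ⊥-elim (ℕ.<⇒≱ (Fin.toℕ<n i) (subst (n ≤_)
                      (trans (cong (toℕ i ℕ.+_) (codegree-suc p m α)) (ℕ.+-identityʳ (toℕ i)))
                      (upper α m (suc α) p-prime p∤m 0<m n≡ ℕ.≤-refl i (∣-trans (^-∣ p (ℕ.≰⇒> t≰α)) p^t∣e))))

-- Ratios of consecutive elementary divisors

prime-∣-prime : ∀ {p q} → Prime p → Prime q → p ∣ q → p ≡ q
prime-∣-prime p-prime q-prime p∣q with prime⇒irreducible q-prime p∣q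
... | inj₁ refl = ⊥-elim (¬prime[1] p-prime)
... | inj₂ p≡q  = p≡q

prime-∣-^ : ∀ {p} x t → Prime p → p ∣ x ℕ.^ t → p ∣ x
prime-∣-^ x zero    p-prime p∣1 = ⊥-elim (¬prime[1] (subst Prime (∣1⇒≡1 p∣1) p-prime))
prime-∣-^ x (suc t) p-prime p∣ with euclidsLemma x (x ℕ.^ t) p-prime p∣
... | inj₁ p∣x  = p∣x
... | inj₂ p∣xᵗ = prime-∣-^ x t p-prime p∣xᵗ

prime-divisor : ∀ n → 0 < n → n ≢ 1 → ∃ λ p → Prime p × p ∣ n
prime-divisor n 0<n n≢1 = go (PrimeFactorisation.factors f) (PrimeFactorisation.isFactorisation f) (PrimeFactorisation.factorsPrime f)
  where
  f = factorise n {{>-nonZero 0<n}}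
  go : ∀ ps → n ≡ product ps → All Prime ps → ∃ λ p → Prime p × p ∣ n
  go []       n≡1 _          = ⊥-elim (n≢1 n≡1)
  go (p ∷ ps) n≡  (p-prime ∷ _) = p , p-prime , subst (p ∣_) (sym n≡) (m∣m*n (product ps))

n<2^n : ∀ n → n < 2 ℕ.^ n
n<2^n zero    = s≤s z≤n
n<2^n (suc n) = ℕ.+-mono-≤-< (ℕ.≤-trans (s≤s z≤n) (n<2^n n)) (subst (n <_) (sym (ℕ.+-identityʳ _)) (n<2^n n))

-- What the rest of the argument retains of the matrix: p^t ∣ e i exactly when p^t ∣ n and i ≥ n -
-- n/p^t, with i counted from 0. The quotient appears as N with p^t N = n to avoid division and
-- truncated subtraction.
record HasProfile (n : ℕ) (e : Fin n → ℕ) : Set where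
  field
    chain   : ∀ i j → toℕ i ≤ toℕ j → e i ∣ e j
    at-most : ∀ {p} t → Prime p → ∀ i → p ℕ.^ t ∣ e i → ∃ λ N → p ℕ.^ t ℕ.* N ≡ n × n ≤ toℕ i ℕ.+ N
    at-least : ∀ {p} t N → Prime p → p ℕ.^ t ℕ.* N ≡ n → ∀ i → n ≤ toℕ i ℕ.+ N → p ℕ.^ t ∣ e i

-- The (0-based) index j = n - n / p^t, at which a factor p enters.
Jump : ∀ {n} → Fin n → ℕ → ℕ → Set
Jump {n} j p t = 1 ≤ t × ∃ λ N → p ℕ.^ t ℕ.* N ≡ n × toℕ j ℕ.+ N ≡ n

module _ {n} (0<n : 0 < n) {e : Fin n → ℕ} (profile : HasProfile n e) where

  open HasProfile profile

  e≢0 : ∀ i → e i ≢ 0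
  e≢0 i eᵢ≡0 =
    -- 0 is divisible by 2^n, which would then have to divide n < 2^n.
    let N , eq , _ = at-most n prime[2] i (subst (2 ℕ.^ n ∣_) (sym eᵢ≡0) ((2 ℕ.^ n) ∣0))
    in ℕ.<⇒≱ (n<2^n n) (∣⇒≤ {{>-nonZero 0<n}} (subst (2 ℕ.^ n ∣_) eq (m∣m*n N)))

  withe₀≢0 : ∀ k → NonZero (withe₀ e k)
  withe₀≢0 zero    = _
  withe₀≢0 (suc i) = ≢-nonZero (e≢0 i)

cofactor-unique : ∀ {q N N′ n} → 0 < n → q ℕ.* N ≡ n → q ℕ.* N′ ≡ n → N ≡ N′
cofactor-unique {zero}  0<n refl eq′ = ⊥-elim (ℕ.<-irrefl refl 0<n)
cofactor-unique {suc q} 0<n eq   eq′ = ℕ.*-cancelˡ-≡ _ _ (suc q) (trans eq (sym eq′))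

-- The index determines N = n - j, and N determines the prime power n / N. So thresholds of
-- different prime powers never coincide.
same-jump : ∀ {n p q s t} {j : Fin n} → 0 < n → Jump j p s → Jump j q t → p ℕ.^ s ≡ q ℕ.^ t
same-jump {n} {p} {q} {s} {t} {j} 0<n (_ , N , eq , j+N) (_ , N′ , eq′ , j+N′) =
  ℕ.*-cancelʳ-≡ (p ℕ.^ s) (q ℕ.^ t) N {{≢-nonZero λ { refl → ℕ.<⇒≢ 0<n (trans (sym (ℕ.*-zeroʳ (p ℕ.^ s))) eq) }}}
    (trans eq (trans (sym eq′) (cong (q ℕ.^ t ℕ.*_) (ℕ.+-cancelˡ-≡ (toℕ j) N′ N (trans j+N′ (sym j+N))))))

prev : ∀ {n} → (Fin n → ℕ) → Fin n → ℕ
prev e j = withe₀ e (inject₁ j)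

prev-∣ : ∀ {n} {e : Fin n → ℕ} → HasProfile n e → ∀ j → prev e j ∣ e j
prev-∣ profile zero    = 1∣ _
prev-∣ profile (suc i) = HasProfile.chain profile (inject₁ i) (suc i)
  (ℕ.≤-trans (ℕ.≤-reflexive (Fin.toℕ-inject₁ i)) (ℕ.n≤1+n (toℕ i)))

-- Contrapositive of `at-least` at the preceding index. At index 0 the predecessor is e_0 = 1, and N
-- ≤ n holds anyway.
prev-∤⇒≤ : ∀ {n} {e : Fin n → ℕ} → 0 < n → HasProfile n e → ∀ {p} t N → Prime p → p ℕ.^ t ℕ.* N ≡ n →
           ∀ j → ¬ p ℕ.^ t ∣ prev e j → toℕ j ℕ.+ N ≤ n
prev-∤⇒≤ 0<n profile {p} t N p-prime eq zero    p∤ = subst (N ≤_) eq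
  (ℕ.m≤n*m N (p ℕ.^ t) {{ℕ.m^n≢0 p t {{prime⇒nonZero p-prime}}}})
prev-∤⇒≤ {n} 0<n profile {p} t N p-prime eq (suc i) p∤ = ℕ.≰⇒> λ n≤i+N →
  p∤ (HasProfile.at-least profile t N p-prime eq (inject₁ i) (subst (λ k → n ≤ k ℕ.+ N) (sym (Fin.toℕ-inject₁ i)) n≤i+N))

-- The preceding index falls one short of the threshold. At index 0 the predecessor is 1, which p^t
-- does not divide because t ≥ 1.
prev-∤ : ∀ {n} {e : Fin n → ℕ} → 0 < n → HasProfile n e → ∀ {p} t N → Prime p → 1 ≤ t → p ℕ.^ t ℕ.* N ≡ n →
         ∀ j → toℕ j ℕ.+ N ≡ n → ¬ p ℕ.^ t ∣ prev e j
prev-∤ 0<n profile {p} (suc t) N p-prime 1≤t eq zero j+N≡n p^t∣1 =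
  ¬prime[1] (subst Prime (ℕ.m*n≡1⇒m≡1 p (p ℕ.^ t) (∣1⇒≡1 p^t∣1)) p-prime)
prev-∤ {n} 0<n profile {p} t N p-prime 1≤t eq (suc i) j+N≡n p^t∣ =
  let N′ , eq′ , n≤ = HasProfile.at-most profile t p-prime (inject₁ i) p^t∣
  in ℕ.<⇒≱ (ℕ.≤-reflexive j+N≡n) (subst₂ (λ k M → n ≤ k ℕ.+ M) (Fin.toℕ-inject₁ i) (cofactor-unique {p ℕ.^ t} 0<n eq′ eq) n≤)

module _ {n} (0<n : 0 < n) {e : Fin n → ℕ} (profile : HasProfile n e) (j : Fin n) where

  open HasProfile profile

  private
    ρ = ratio e (withe₀≢0 0<n profile) j

    ρ*prev : ρ ℕ.* prev e j ≡ e j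
    ρ*prev = m/n*n≡m {{withe₀≢0 0<n profile (inject₁ j)}} (prev-∣ profile j)

    ρ≢0 : ρ ≢ 0
    ρ≢0 ρ≡0 = e≢0 0<n profile j (trans (sym ρ*prev) (cong (ℕ._* prev e j) ρ≡0))

    jump : ∀ {p} t → Prime p → 1 ≤ t → p ℕ.^ t ∣ e j → ¬ p ℕ.^ t ∣ prev e j → Jump j p t
    jump t p-prime 1≤t p^t∣ p^t∤ =
      let N , eq , n≤ = at-most t p-prime j p^t∣
      in 1≤t , N , eq , ℕ.≤-antisym (prev-∤⇒≤ 0<n profile t N p-prime eq j p^t∤) n≤

    -- Let v be the p-adic valuation of the predecessor. Then p^(v+1), ..., p^(v+s) all divide e j
    -- but not the predecessor, so all of them have their threshold at j.
    jumps : ∀ {p} s → Prime p → p ℕ.^ s ∣ ρ → 1 ≤ s → ∃ λ v → ∀ r → 1 ≤ r → r ≤ s → Jump j p (r ℕ.+ v)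
    jumps {p} s p-prime p^s∣ρ 1≤s =
      let v , m , prev≡ , p∤m , _ = p-part (prime>1 p-prime) (ℕ.n≢0⇒n>0 (≢-nonZero⁻¹ _ {{withe₀≢0 0<n profile (inject₁ j)}}))
          prev≡′ = trans prev≡ (scaledPower-≡ p m v)
      in v , λ r 1≤r r≤s → jump (r ℕ.+ v) p-prime (ℕ.≤-trans 1≤r (ℕ.m≤m+n r v))
           (subst₂ _∣_ (sym (ℕ.^-distribˡ-+-* p r v)) ρ*prev
             (*-pres-∣ (∣-trans (^-∣ p r≤s) p^s∣ρ) (subst (p ℕ.^ v ∣_) (sym prev≡′) (m∣m*n m))))
           (λ p^∣ → p∤m (cancel r v m 1≤r (subst (p ℕ.^ (r ℕ.+ v) ∣_) prev≡′ p^∣)))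
      where
      cancel : ∀ r v m → 1 ≤ r → p ℕ.^ (r ℕ.+ v) ∣ p ℕ.^ v ℕ.* m → p ∣ m
      cancel (suc r) v m 1≤r p^∣ = ∣-trans (m∣m*n (p ℕ.^ r)) (*-cancelˡ-∣ (p ℕ.^ v) {{ℕ.m^n≢0 p v {{prime⇒nonZero p-prime}}}}
        (subst (_∣ p ℕ.^ v ℕ.* m) (trans (cong (p ℕ.^_) (ℕ.+-comm (suc r) v)) (ℕ.^-distribˡ-+-* p v (suc r))) p^∣))

  ∣-ratio⇒jump : ∀ {p} → Prime p → p ∣ ρ → ∃ λ t → Jump j p t
  ∣-ratio⇒jump {p} p-prime p∣ρ =
    let v , js = jumps 1 p-prime (subst (_∣ ρ) (sym (ℕ.^-identityʳ p)) p∣ρ) ℕ.≤-refl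
    in suc v , js 1 ℕ.≤-refl ℕ.≤-refl

  -- p^t divides e j, the product of the predecessor and the ratio, but not the predecessor itself.
  jump⇒∣-ratio : ∀ {p} t → Prime p → Jump j p t → p ∣ ρ
  jump⇒∣-ratio {p} t p-prime (1≤t , N , eq , j+N≡n) = prime-power-∣ t (prev e j) ρ p-prime
    (prev-∤ 0<n profile t N p-prime 1≤t eq j j+N≡n)
    (subst (p ℕ.^ t ∣_) (trans (sym ρ*prev) (ℕ.*-comm ρ (prev e j)))
      (at-least t N p-prime eq j (ℕ.≤-reflexive (sym j+N≡n))))

  -- Write the ratio as k p. A prime q ∣ k would also have a threshold at j, so a power of q equals
  -- p^t and q = p. Then p^2 divides the ratio, which places the thresholds of two different powers
  -- of p at j.
  jump⇒ratio≡ : ∀ {p} t → Prime p → Jump j p t → ρ ≡ p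
  jump⇒ratio≡ {p} t p-prime J = go (jump⇒∣-ratio t p-prime J)
    where
    go : p ∣ ρ → ρ ≡ p
    go (divides k ρ≡kp) with k ℕ.≟ 1
    ... | yes refl = trans ρ≡kp (ℕ.*-identityˡ p)
    ... | no k≢1 =
      let q , q-prime , q∣k = prime-divisor k (ℕ.n≢0⇒n>0 λ { refl → ρ≢0 ρ≡kp }) k≢1
          t′ , J′ = ∣-ratio⇒jump q-prime (subst (q ∣_) (sym ρ≡kp) (∣-trans q∣k (m∣m*n p)))
          q≡p = prime-∣-prime q-prime p-prime (prime-∣-^ p t q-prime
            (subst (q ∣_) (same-jump {n} {q} {p} {t′} {t} {j} 0<n J′ J) (∣-trans (subst (_∣ q ℕ.^ 1) (ℕ.^-identityʳ q) ∣-refl) (^-∣ q (proj₁ J′)))))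
          p²∣ρ = subst₂ _∣_ (cong (p ℕ.*_) (sym (ℕ.*-identityʳ p))) (trans (ℕ.*-comm p k) (sym ρ≡kp))
            (*-monoʳ-∣ p (subst (_∣ k) q≡p q∣k))
          v , js = jumps 2 p-prime p²∣ρ (s≤s z≤n)
      in ⊥-elim (ℕ.<⇒≢ (ℕ.^-monoʳ-< p (prime>1 p-prime) (ℕ.n<1+n (suc v)))
           (same-jump {n} {p} {p} {suc v} {suc (suc v)} {j} 0<n (js 1 ℕ.≤-refl (s≤s z≤n)) (js 2 (s≤s z≤n) ℕ.≤-refl)))

  no-jump⇒ratio≡1 : (∀ {p} t → Prime p → ¬ Jump j p t) → ρ ≡ 1
  no-jump⇒ratio≡1 none with ρ ℕ.≟ 1
  ... | yes ρ≡1 = ρ≡1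
  ... | no ρ≢1 =
    let q , q-prime , q∣ρ = prime-divisor ρ (ℕ.n≢0⇒n>0 ρ≢0) ρ≢1
        t , J = ∣-ratio⇒jump q-prime q∣ρ
    in ⊥-elim (none t q-prime J)

-- The prime factorisation of n and the list of ratios

∣-product⇒∣-factor : ∀ {q r} (p α : Fin r → ℕ) → Prime q → (∀ i → Prime (p i)) →
                     q ∣ product (tabulate (λ i → p i ℕ.^ α i)) → ∃ λ i → q ≡ p i
∣-product⇒∣-factor {q} {zero}  p α q-prime p-prime q∣1 = ⊥-elim (¬prime[1] (subst Prime (∣1⇒≡1 q∣1) q-prime))
∣-product⇒∣-factor {q} {suc r} p α q-prime p-prime q∣ with euclidsLemma (p zero ℕ.^ α zero) _ q-prime q∣
... | inj₁ q∣p₀ = zero , prime-∣-prime q-prime (p-prime zero) (prime-∣-^ (p zero) (α zero) q-prime q∣p₀)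
... | inj₂ q∣ps = let i , q≡ = ∣-product⇒∣-factor (p ∘ suc) (α ∘ suc) q-prime (p-prime ∘ suc) q∣ps in suc i , q≡

power-∣-product : ∀ {r} (p α : Fin r → ℕ) i → p i ℕ.^ α i ∣ product (tabulate (λ i → p i ℕ.^ α i))
power-∣-product p α zero    = m∣m*n _
power-∣-product p α (suc i) = ∣-trans (power-∣-product (p ∘ suc) (α ∘ suc) i) (n∣m*n (p zero ℕ.^ α zero))

-- For the first prime, cancelling p_0^(α_0) from a higher power leaves p_0 dividing a product of
-- powers of other primes. For a later prime, p_0^(α_0) is prime to it and can be stripped off.
power-∣-product⇒≤ : ∀ {r} (p α : Fin r → ℕ) → (∀ i → Prime (p i)) → Injective _≡_ _≡_ p →
                    ∀ i t → p i ℕ.^ t ∣ product (tabulate (λ i → p i ℕ.^ α i)) → t ≤ α i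
power-∣-product⇒≤ {suc r} p α p-prime p-injective zero t p^t∣ = ℕ.≮⇒≥ λ α<t →
  let i , p₀≡ = ∣-product⇒∣-factor (p ∘ suc) (α ∘ suc) (p-prime zero) (p-prime ∘ suc)
        (*-cancelˡ-∣ (p zero ℕ.^ α zero) {{ℕ.m^n≢0 (p zero) (α zero) {{prime⇒nonZero (p-prime zero)}}}}
          (subst (_∣ product (tabulate (λ i → p i ℕ.^ α i))) (ℕ.*-comm (p zero) (p zero ℕ.^ α zero))
            (∣-trans (^-∣ (p zero) α<t) p^t∣)))
  in Fin.0≢1+n (p-injective p₀≡)
power-∣-product⇒≤ {suc r} p α p-prime p-injective (suc i) t p^t∣ =
  power-∣-product⇒≤ (p ∘ suc) (α ∘ suc) (p-prime ∘ suc) (Fin.suc-injective ∘ p-injective) i t (strip t p^t∣)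
  where
  rest = product (tabulate (λ i → p (suc i) ℕ.^ α (suc i)))
  pᵢ∤p₀^α : ¬ p (suc i) ∣ p zero ℕ.^ α zero
  pᵢ∤p₀^α pᵢ∣ = Fin.0≢1+n (sym (p-injective (prime-∣-prime (p-prime (suc i)) (p-prime zero)
    (prime-∣-^ (p zero) (α zero) (p-prime (suc i)) pᵢ∣))))
  strip : ∀ t → p (suc i) ℕ.^ t ∣ p zero ℕ.^ α zero ℕ.* rest → p (suc i) ℕ.^ t ∣ rest
  strip t d with p (suc i) ℕ.^ t ∣? rest
  ... | yes p^t∣rest = p^t∣rest
  ... | no p^t∤rest  = ⊥-elim (pᵢ∤p₀^α (prime-power-∣ t rest (p zero ℕ.^ α zero) (p-prime (suc i)) p^t∤rest
          (subst (p (suc i) ℕ.^ t ∣_) (ℕ.*-comm (p zero ℕ.^ α zero) rest) d)))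

module _ {n r} (0<n : 0 < n) (p α : Fin r → ℕ) (p-prime : ∀ i → Prime (p i)) (p-injective : Injective _≡_ _≡_ p)
         (n≡ : n ≡ product (tabulate (λ i → p i ℕ.^ α i))) {e : Fin n → ℕ} (profile : HasProfile n e) where

  private
    ρ : Fin n → ℕ
    ρ = ratio e (withe₀≢0 0<n profile)

    power-∣ : ∀ i {t} → t ≤ α i → p i ℕ.^ t ∣ n
    power-∣ i t≤ = subst (_ ∣_) (sym n≡) (∣-trans (^-∣ (p i) t≤) (power-∣-product p α i))

    quot : ∀ i (t : ℕ) → ℕ
    quot i t = n / p i ^ t [ p-prime i ]

    quot-≡ : ∀ i {t N} → p i ℕ.^ t ℕ.* N ≡ n → quot i t ≡ N
    quot-≡ i {t} {N} eq = trans (cong (λ m → m / p i ^ t [ p-prime i ]) (trans (sym eq) (ℕ.*-comm (p i ℕ.^ t) N)))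
      (m*n/n≡m N (p i ℕ.^ t) {{ℕ.m^n≢0 (p i) t {{prime⇒nonZero (p-prime i)}}}})

    quot-spec : ∀ i {t} → t ≤ α i → p i ℕ.^ t ℕ.* quot i t ≡ n
    quot-spec i {t} t≤ = trans (ℕ.*-comm (p i ℕ.^ t) _)
      (m/n*n≡m {{ℕ.m^n≢0 (p i) t {{prime⇒nonZero (p-prime i)}}}} (power-∣ i t≤))

    jump-exponent : ∀ {j i t} → Jump j (p i) t → t ≤ α i
    jump-exponent {j} {i} {t} (_ , N , eq , _) =
      power-∣-product⇒≤ p α p-prime p-injective i t (subst (p i ℕ.^ t ∣_) (trans eq n≡) (m∣m*n N))

    jump-prime : ∀ {j q t} → Prime q → Jump j q t → ∃ λ i → q ≡ p i
    jump-prime {j} {q} {t} q-prime (1≤t , N , eq , _) = ∣-product⇒∣-factor p α q-prime p-prime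
      (subst (q ∣_) (trans eq n≡) (∣-trans (subst (_∣ q ℕ.^ t) (ℕ.^-identityʳ q) (^-∣ q 1≤t)) (m∣m*n N)))

    N≤n : ∀ {q N} → Prime q → ∀ t → q ℕ.^ t ℕ.* N ≡ n → N ≤ n
    N≤n {q} {N} q-prime t eq = subst (N ≤_) eq (ℕ.m≤n*m N (q ℕ.^ t) {{ℕ.m^n≢0 q t {{prime⇒nonZero q-prime}}}})

    -- j counts from 0, so the index of the elementary divisor is `suc (toℕ j)`, whence the + 1.
    jump-index : ∀ {j : Fin n} {i t N} → p i ℕ.^ t ℕ.* N ≡ n → toℕ j ℕ.+ N ≡ n → suc (toℕ j) ≡ n ℕ.∸ quot i t ℕ.+ 1
    jump-index {j} {i} {t} {N} eq j+N≡n = trans (sym (ℕ.+-comm (toℕ j) 1)) (cong (ℕ._+ 1)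
      (trans (sym (ℕ.m+n∸n≡m (toℕ j) N)) (cong₂ ℕ._∸_ j+N≡n (sym (quot-≡ i {t} {N} eq)))))

    index-jump : ∀ {j : Fin n} {i t} → 1 ≤ t → t ≤ α i → suc (toℕ j) ≡ n ℕ.∸ quot i t ℕ.+ 1 → Jump j (p i) t
    index-jump {j} {i} {t} 1≤t t≤ eq = 1≤t , quot i t , quot-spec i t≤ ,
      trans (cong (ℕ._+ quot i t) (ℕ.suc-injective (trans eq (ℕ.+-comm _ 1)))) (ℕ.m∸n+n≡m (N≤n (p-prime i) t (quot-spec i t≤)))

  ratio≡prime⇔ : ∀ j i → ρ j ≡ p i ⇔ ∃ λ t → 1 ≤ t × t ≤ α i × suc (toℕ j) ≡ n ℕ.∸ quot i t ℕ.+ 1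
  ratio≡prime⇔ j i = mk⇔ to from
    where
    to : ρ j ≡ p i → ∃ λ t → 1 ≤ t × t ≤ α i × suc (toℕ j) ≡ n ℕ.∸ quot i t ℕ.+ 1
    to ρ≡p =
      let t , J = ∣-ratio⇒jump 0<n profile j (p-prime i) (subst (p i ∣_) (sym ρ≡p) ∣-refl)
          1≤t , N , eq , j+N≡n = J
      in t , 1≤t , jump-exponent {j} {i} {t} J , jump-index {j} {i} {t} {N} eq j+N≡n
    from : (∃ λ t → 1 ≤ t × t ≤ α i × suc (toℕ j) ≡ n ℕ.∸ quot i t ℕ.+ 1) → ρ j ≡ p i
    from (t , 1≤t , t≤ , eq) = jump⇒ratio≡ 0<n profile j t (p-prime i) (index-jump {j} {i} 1≤t t≤ eq)

  private
    position< : ∀ i (t : Fin (α i)) → n ℕ.∸ quot i (suc (toℕ t)) < n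
    position< i t = ℕ.∸-monoʳ-< {o = 0} (ℕ.n≢0⇒n>0 λ q≡0 → ℕ.<⇒≢ 0<n (trans (sym (ℕ.*-zeroʳ (p i ℕ.^ suc (toℕ t))))
        (trans (cong (p i ℕ.^ suc (toℕ t) ℕ.*_) (sym q≡0)) (quot-spec i (Fin.toℕ<n t)))))
      (N≤n (p-prime i) (suc (toℕ t)) (quot-spec i (Fin.toℕ<n t)))

    -- t counts from 0, so this is the threshold of the power of p i with exponent t + 1.
    position : ∀ i → Fin (α i) → Fin n
    position i t = fromℕ< (position< i t)

    position-jump : ∀ i t → Jump (position i t) (p i) (suc (toℕ t))
    position-jump i t = s≤s z≤n , quot i (suc (toℕ t)) , quot-spec i (Fin.toℕ<n t) ,
      trans (cong (ℕ._+ quot i (suc (toℕ t))) (Fin.toℕ-fromℕ< (position< i t)))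
        (ℕ.m∸n+n≡m (N≤n (p-prime i) (suc (toℕ t)) (quot-spec i (Fin.toℕ<n t))))

    position-ratio : ∀ i t → ρ (position i t) ≡ p i
    position-ratio i t = jump⇒ratio≡ 0<n profile (position i t) (suc (toℕ t)) (p-prime i) (position-jump i t)

    jump⇒position : ∀ {j i t} → Jump j (p i) (suc t) → ∃ λ t′ → j ≡ position i t′
    jump⇒position {j} {i} {t} J@(_ , N , eq , j+N≡n) = t′ , Fin.toℕ-injective (ℕ.+-cancelʳ-≡ N _ _ (trans j+N≡n (sym (trans
        (cong (toℕ (position i t′) ℕ.+_) (cofactor-unique {p i ℕ.^ suc t} 0<n eq
          (trans (cong (λ s → p i ℕ.^ suc s ℕ.* N′) (sym (Fin.toℕ-fromℕ< t<α))) eq′))) j′+N′≡n))))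
      where
      t<α = jump-exponent {j} {i} {suc t} J
      t′ = fromℕ< t<α
      N′ = proj₁ (proj₂ (position-jump i t′))
      eq′ = proj₁ (proj₂ (proj₂ (position-jump i t′)))
      j′+N′≡n = proj₂ (proj₂ (proj₂ (position-jump i t′)))

    position-injective : ∀ i {t t′} → position i t ≡ position i t′ → t ≡ t′
    position-injective i {t} {t′} eq = Fin.toℕ-injective (ℕ.suc-injective (^-injective
      (same-jump {n} {p i} {p i} {suc (toℕ t)} {suc (toℕ t′)} {position i t} 0<n (position-jump i t)
        (subst (λ j → Jump j (p i) (suc (toℕ t′))) (sym eq) (position-jump i t′)))))
      where
      ^-injective : ∀ {s t} → p i ℕ.^ s ≡ p i ℕ.^ t → s ≡ t
      ^-injective {s} {t} eq with ℕ.<-cmp s t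
      ... | tri< s<t _ _ = ⊥-elim (ℕ.<⇒≢ (ℕ.^-monoʳ-< (p i) (prime>1 (p-prime i)) s<t) eq)
      ... | tri≈ _ s≡t _ = s≡t
      ... | tri> _ _ t<s = ⊥-elim (ℕ.<⇒≢ (ℕ.^-monoʳ-< (p i) (prime>1 (p-prime i)) t<s) (sym eq))

    positions : List (Fin n)
    positions = concat (tabulate λ i → tabulate (position i))

    positions-unique : Unique positions
    positions-unique = Unique.concat⁺
      (All.tabulate⁺ λ i → Unique.tabulate⁺ (position-injective i))
      (AllPairs.tabulate⁺ disjoint)
      where
      disjoint : ∀ {i i′} → i ≢ i′ → ∀ {x} → x ∈ tabulate (position i) × x ∈ tabulate (position i′) → _
      disjoint {i} {i′} i≢i′ (x∈ , x∈′) =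
        let t , x≡ = ∈-tabulate⁻ {f = position i} x∈
            t′ , x≡′ = ∈-tabulate⁻ {f = position i′} x∈′
        in i≢i′ (p-injective (trans (sym (position-ratio i t)) (trans (cong ρ (trans (sym x≡) x≡′)) (position-ratio i′ t′))))

    ρ-positions : map ρ positions ≡ concat (tabulate (λ i → replicate (α i) (p i)))
    ρ-positions = trans (sym (concat-map (tabulate λ i → tabulate (position i))))
      (cong concat (trans (map-tabulate (λ i → tabulate (position i)) (map ρ)) (tabulate-cong λ i →
        trans (map-tabulate (position i) ρ) (constant (position-ratio i)))))
      where
      constant : ∀ {k x} {f : Fin k → ℕ} → (∀ t → f t ≡ x) → tabulate f ≡ replicate k x
      constant {zero}  f≡x = refl
      constant {suc k} f≡x = cong₂ _∷_ (f≡x zero) (constant (f≡x ∘ suc))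

    length-positions : length positions ≡ sum (tabulate α)
    length-positions = go α (λ i → tabulate (position i)) (λ i → length-tabulate (position i))
      where
      go : ∀ {r} (α : Fin r → ℕ) (F : Fin r → List (Fin n)) → (∀ i → length (F i) ≡ α i) →
           length (concat (tabulate F)) ≡ sum (tabulate α)
      go {zero}  α F eq = refl
      go {suc r} α F eq = trans (length-++ (F zero)) (cong₂ ℕ._+_ (eq zero) (go (α ∘ suc) (F ∘ suc) (eq ∘ suc)))

  -- The indices split into the thresholds, pairwise distinct and Σ α_i in number, and the others.
  -- Any prime power with a threshold divides n, hence is a power of some p i and already listed; so
  -- the ratio at every other index is 1.
  ratios-↭ : tabulate ρ ↭ concat (tabulate (λ i → replicate (α i) (p i))) ++ replicate (n ℕ.∸ sum (tabulate α)) 1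
  ratios-↭ = ↭-trans (↭-reflexive (sym (map-tabulate (λ j → j) ρ))) (↭-trans (Perm.map⁺ ρ split)
    (↭-reflexive (trans (map-++ ρ positions others) (cong₂ _++_ ρ-positions ρ-others))))
    where
    complement : ∃ λ zs → allFin n ↭ positions ++ zs
    complement = ⊆⇒complement positions positions-unique (λ {x} _ → ∈-allFin x)
    others = proj₁ complement
    split = proj₂ complement
    others∉ : ∀ {z} → z ∈ others → ¬ z ∈ positions
    others∉ z∈ z∈′ = Unique-++-disjoint positions (Unique-resp-↭ split (Unique.allFin⁺ n)) z∈′ z∈
    none : ∀ {z} → z ∈ others → ∀ {q} t → Prime q → ¬ Jump z q t
    none z∈ {q} zero q-prime (() , _)
    none {z} z∈ {q} (suc t) q-prime J =
      let i , q≡ = jump-prime {z} {q} {suc t} q-prime J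
          t′ , z≡ = jump⇒position {z} {i} {t} (subst (λ q → Jump z q (suc t)) q≡ J)
      in others∉ z∈ (subst (_∈ positions) (sym z≡)
           (∈-concat⁺′ (∈-tabulate⁺ {f = position i} t′) (∈-tabulate⁺ {f = λ i → tabulate (position i)} i)))
    all-ones : ∀ zs → (∀ {z} → z ∈ zs → ρ z ≡ 1) → map ρ zs ≡ replicate (length zs) 1
    all-ones []       _  = refl
    all-ones (z ∷ zs) eq = cong₂ _∷_ (eq (here refl)) (all-ones zs (eq ∘ there))
    length-others : length others ≡ n ℕ.∸ sum (tabulate α)
    length-others = sym (trans (cong₂ ℕ._∸_
      (trans (sym (length-tabulate {n = n} (λ j → j))) (trans (Perm.↭-length split) (length-++ positions)))
      (sym length-positions)) (ℕ.m+n∸m≡n (length positions) (length others)))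
    ρ-others : map ρ others ≡ replicate (n ℕ.∸ sum (tabulate α)) 1
    ρ-others = trans (all-ones others λ {z} z∈ → no-jump⇒ratio≡1 0<n profile z (none z∈))
      (cong (λ k → replicate k 1) length-others)

theorem2p19 :
    ∀ (n r : ℕ) (p α : Fin r → ℕ) →
    0 < n →
    (p-prime : ∀ i → Prime (p i)) →
    Injective _≡_ _≡_ p →
    (∀ i → 0 < α i) →
    n ≡ product (tabulate (λ i → p i ^ α i)) →
    (A : Matrix n n) → IsMatrixOfΨ n A →
    (e : Fin n → ℕ) → ElementaryDivisors A e →
    Σ (∀ k → NonZero (withe₀ e k)) λ e≢0 →
      (tabulate (ratio e e≢0)
        ↭ concat (tabulate (λ i → replicate (α i) (p i)))
          ++ replicate (n ∸ sum (tabulate α)) 1)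
      × (∀ (j : Fin n) (i : Fin r) →
          ratio e e≢0 j ≡ p i
            ⇔ ∃ λ t → 1 ≤ t × t ≤ α i × suc (toℕ j) ≡ n ∸ n / p i ^ t [ p-prime i ] + 1)
theorem2p19 n r p α 0<n p-prime p-injective _ n≡ A isMatrix e ed =
  withe₀≢0 0<n profile , ratios-↭ 0<n p α p-prime p-injective n≡ profile , ratio≡prime⇔ 0<n p α p-prime p-injective n≡ profile
  where
  profile : HasProfile n e
  profile = record
    { chain    = ElementaryDivisors.chain ed
    ; at-most  = prime-power-∣-elementaryDivisor⇒ 0<n A isMatrix ed
    ; at-least = prime-power-∣-elementaryDivisor 0<n A isMatrix ed
    }
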